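{- Let $d,p,q$ be positive integers with $p\le q$, and let $M$ be an annular map of type $(p,q)$ having no face of degree less than $d$. Then $M$ admits a $d/(d-2)$-orientation if and only if $M$ belongs to $\mathcal{A}_{d}^{(p,q)}$. In this case, there exists a unique $d/(d-2)$-orientation of $M$ that is suitable.
   Context: A planar map is a connected graph (loops and multiple edges allowed) embedded in the oriented sphere up to continuous deformation; the degree of a face or vertex is its number of incident corners (angular sections between consecutive half-edges around a vertex). A plane map has a distinguished face, the root-face, drawn as the outer face. An annular map is a plane map with an additional distinguished face distinct from the outer face, called the inner root-face; it has type $(p,q)$ if the outer root-face has degree $p$ and the inner root-face has degree $q$. Faces other than the two root-faces are non-root faces. Vertices, edges and half-edges are outer if incident to (lying on an edge incident to) the outer root-face, inner otherwise. A cycle is separating if it encloses the inner root-face, non-separating otherwise; the separating (resp. non-separating) girth is the minimal length of a separating (resp. non-separating) cycle. $\mathcal{A}_{d}^{(p,q)}$ denotes the class of annular maps of type $(p,q)$ with non-separating girth at least $d$ and separating girth equal to $p$. A biorientation assigns each half-edge a direction: ingoing (toward its vertex) or outgoing. An edge is $i$-way if exactly $i$ of its half-edges are ingoing. An edge $\{u,v\}$ can be traversed from $u$ to $v$ if it is 2-way or 1-way with ingoing half-edge at $v$. A biorientation is accessible from $v$ if every vertex is reachable from $v$ along traversable edges. It is minimal if there is no counterclockwise circuit, i.e. no simple cycle all of whose edges can be traversed in the direction keeping the interior of the cycle on the left. A $\mathbb{Z}$-biorientation carries an integer weight on each half-edge, positive if ingoing and non-positive if outgoing; the weight of an edge is the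 sum of its two half-edge weights, the weight of a vertex is the sum of the weights of its incident ingoing half-edges, and the weight $w(f)$ of a face $f$ is the sum of the weights of the outgoing half-edges $h$ incident to $f$ having $f$ on their right (traversing $h$ from its vertex toward the middle of its edge). It is admissible if the contour of the outer face is a simple cycle of 1-way edges each with weights $0$ (outgoing) and $1$ (ingoing), and every inner half-edge incident to an outer vertex is outgoing; it is suitable if minimal, admissible and accessible from every outer vertex. A $d/(d-2)$-orientation of $M$ is an admissible $\mathbb{Z}$-biorientation in which every outgoing half-edge has weight $0$, $-1$ or $-2$ and (i) each inner edge has weight $d-2$, (ii) each inner vertex has weight $d$, (iii) each non-root face $f$ satisfies $\deg(f)+w(f)=d$, (iv) the inner root-face has degree $q$ and weight $p-q$. -}

module Defs where

open import Data.Nat as ℕ using (ℕ; zero; suc; _≤_)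
open import Data.Integer as ℤ using (ℤ; +_; +0; +[1+_])
open import Data.Fin using (Fin; zero; suc; inject₁; fromℕ)
open import Data.Fin.Properties using (_≟_)
open import Data.List using (List; filterᵇ; length; map; foldr; allFin)
open import Data.Bool using (Bool; true; false; _∧_; not; T)
open import Data.Product using (Σ; ∃; ∃-syntax; _×_; _,_)
open import Data.Sum using (_⊎_)
open import Relation.Nullary using (¬_; does)
open import Relation.Binary.PropositionalEquality using (_≡_; _≢_)
open import Function.Bundles using (_⇔_)

-- Combinatorial maps (rotation systems).
-- Half-edges are Fin n.  σ is the COUNTERCLOCKWISE rotation of half-edges
-- around their vertex (orientation of the sphere), α the fixed-point-free
-- involution pairing the two half-edges of an edge.
-- Corners are identified with half-edges: half-edge h stands for the corner
-- between h and σ h, i.e. the corner lying on the LEFT of h when h is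
-- traversed from its vertex towards the middle of its edge.
-- Faces are orbits of corners under φ = σ⁻¹ ∘ α (walking with face on the left).

iter : {A : Set} → (A → A) → ℕ → A → A
iter f zero    x = x
iter f (suc k) x = f (iter f k x)

SameOrbit : {n : ℕ} → (Fin n → Fin n) → Fin n → Fin n → Set
SameOrbit π h h' = ∃[ k ] iter π k h ≡ h'

data Conn {n : ℕ} (σ α : Fin n → Fin n) (h : Fin n) : Fin n → Set where
  here  : Conn σ α h h
  stepσ : ∀ {h'} → Conn σ α h h' → Conn σ α h (σ h')
  stepα : ∀ {h'} → Conn σ α h h' → Conn σ α h (α h')

record PlaneMap : Set where
  field
    n      : ℕ
    σ σ⁻   : Fin n → Fin n
    σσ⁻    : ∀ h → σ (σ⁻ h) ≡ h
    σ⁻σ    : ∀ h → σ⁻ (σ h) ≡ h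
    α      : Fin n → Fin n
    αα     : ∀ h → α (α h) ≡ h
    α-free : ∀ h → α h ≢ h
    connected : ∀ h h' → Conn σ α h h'
    V      : ℕ
    vert   : Fin n → Fin V
    vert-orbit : ∀ h h' → (vert h ≡ vert h') ⇔ SameOrbit σ h h'
    vert-surj  : ∀ v → ∃[ h ] vert h ≡ v
    F      : ℕ
    face   : Fin n → Fin F
    face-orbit : ∀ h h' → (face h ≡ face h') ⇔ SameOrbit (λ x → σ⁻ (α x)) h h'
    face-surj  : ∀ f → ∃[ h ] face h ≡ f
    -- planarity (genus 0): Euler's formula V - E + F = 2 with n = 2E
    euler  : 2 ℕ.* (V ℕ.+ F) ≡ n ℕ.+ 4

record AnnularMap : Set where
  field
    pmap  : PlaneMap
  open PlaneMap pmap public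
  field
    outer : Fin F
    inner : Fin F
    inner≢outer : inner ≢ outer

module _ (M : AnnularMap) where
  open AnnularMap M

  countHE : (Fin n → Bool) → ℕ
  countHE P = length (filterᵇ P (allFin n))

  sumℤ : List ℤ → ℤ
  sumℤ = foldr ℤ._+_ +0

  faceDeg : Fin F → ℕ
  faceDeg f = countHE (λ h → does (face h ≟ f))

  vertDeg : Fin V → ℕ
  vertDeg v = countHE (λ h → does (vert h ≟ v))

  faceL faceR : Fin n → Fin F
  faceL h = face h
  faceR h = face (α h)

  HasType : ℕ → ℕ → Set
  HasType p q = faceDeg outer ≡ p × faceDeg inner ≡ q

  OuterHE : Fin n → Set
  OuterHE h = faceL h ≡ outer ⊎ faceR h ≡ outer

  OuterVertex : Fin V → Set
  OuterVertex v = ∃[ h ] (vert h ≡ v × face h ≡ outer)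

  record SimpleCycle : Set where
    field
      m    : ℕ
      he   : Fin (suc m) → Fin n
      consec : ∀ (i : Fin m) → vert (α (he (inject₁ i))) ≡ vert (he (suc i))
      close  : vert (α (he (fromℕ m))) ≡ vert (he zero)
      vert-distinct : ∀ i j → vert (he i) ≡ vert (he j) → i ≡ j
      edge-distinct : ∀ i j → (he i ≡ he j ⊎ he i ≡ α (he j)) → i ≡ j

    len : ℕ
    len = suc m

    OnCycle : Fin n → Set
    OnCycle h = ∃[ i ] (he i ≡ h ⊎ he i ≡ α h)

  data DualReach (C : SimpleCycle) (f : Fin F) : Fin F → Set where
    here : DualReach C f f
    step : ∀ {h} → DualReach C f (faceL h) → ¬ SimpleCycle.OnCycle C h →
           DualReach C f (faceR h)

  -- separating = encloses the inner root-face, i.e. the cycle separates it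
  -- from the outer root-face
  Separating : SimpleCycle → Set
  Separating C = ¬ DualReach C outer inner

  -- the class 𝒜_d^{(p,q)} (the type (p,q) is assumed separately)
  InA : ℕ → ℕ → Set
  InA d p =
    (∀ (C : SimpleCycle) → ¬ Separating C → d ≤ SimpleCycle.len C) ×
    (∀ (C : SimpleCycle) → Separating C → p ≤ SimpleCycle.len C) ×
    (Σ SimpleCycle λ C → Separating C × SimpleCycle.len C ≡ p)

  record ZBiorientation : Set where
    field
      ingoing : Fin n → Bool
      wt      : Fin n → ℤ
      wt-in   : ∀ h → ingoing h ≡ true  → ℤ._>_ (wt h) +0
      wt-out  : ∀ h → ingoing h ≡ false → ℤ._≤_ (wt h) +0

    edgeWeight : Fin n → ℤ
    edgeWeight h = wt h ℤ.+ wt (α h)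

    vertWeight : Fin V → ℤ
    vertWeight v =
      sumℤ (map wt (filterᵇ (λ h → ingoing h ∧ does (vert h ≟ v)) (allFin n)))

    faceWeight : Fin F → ℤ
    faceWeight f =
      sumℤ (map wt (filterᵇ (λ h → not (ingoing h) ∧ does (faceR h ≟ f)) (allFin n)))

    Traversable : Fin n → Set
    Traversable h = ingoing (α h) ≡ true

  open ZBiorientation

  data Reach (O : ZBiorientation) (v : Fin V) : Fin V → Set where
    here : Reach O v v
    step : ∀ {h} → Reach O v (vert h) → Traversable O h → Reach O v (vert (α h))

  AccessibleFrom : ZBiorientation → Fin V → Set
  AccessibleFrom O v = ∀ u → Reach O v u

  -- counterclockwise circuit: simple cycle traversable along its direction
  -- whose interior (the side not containing the outer root-face) is on its left
  CCWCircuit : ZBiorientation → SimpleCycle → Set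
  CCWCircuit O C =
    (∀ i → Traversable O (SimpleCycle.he C i)) ×
    ¬ DualReach C (faceL (SimpleCycle.he C zero)) outer

  Minimal : ZBiorientation → Set
  Minimal O = ∀ C → ¬ CCWCircuit O C

  OuterContourSimple : Set
  OuterContourSimple =
    (∀ h h' → face h ≡ outer → face h' ≡ outer → vert h ≡ vert h' → h ≡ h') ×
    (∀ h → faceL h ≡ outer → faceR h ≢ outer)

  OneWay : ZBiorientation → Fin n → Set
  OneWay O h = ingoing O h ≢ ingoing O (α h)

  Admissible : ZBiorientation → Set
  Admissible O =
    OuterContourSimple ×
    (∀ h → OuterHE h → OneWay O h) ×
    (∀ h → OuterHE h → ingoing O h ≡ true  → wt O h ≡ + 1) ×
    (∀ h → OuterHE h → ingoing O h ≡ false → wt O h ≡ + 0) ×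
    (∀ h → ¬ OuterHE h → OuterVertex (vert h) → ingoing O h ≡ false)

  Suitable : ZBiorientation → Set
  Suitable O = Minimal O × Admissible O × (∀ v → OuterVertex v → AccessibleFrom O v)

  DOrientation : ℕ → ℕ → ℕ → ZBiorientation → Set
  DOrientation d p q O =
    Admissible O ×
    (∀ h → ingoing O h ≡ false →
       wt O h ≡ + 0 ⊎ wt O h ≡ ℤ.- (+ 1) ⊎ wt O h ≡ ℤ.- (+ 2)) ×
    (∀ h → ¬ OuterHE h → edgeWeight O h ≡ + d ℤ.- + 2) ×
    (∀ v → ¬ OuterVertex v → vertWeight O v ≡ + d) ×
    (∀ f → f ≢ outer → f ≢ inner → + faceDeg f ℤ.+ faceWeight O f ≡ + d) ×
    (faceDeg inner ≡ q × faceWeight O inner ≡ + p ℤ.- + q)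

  SameOrientation : ZBiorientation → ZBiorientation → Set
  SameOrientation O O' = ∀ h → ingoing O h ≡ ingoing O' h × wt O h ≡ wt O' h

{-# OPTIONS --safe #-}

-- An orientation is read as a flow: pos h is the positive part of the weight of the
-- half-edge h, and x h its negative part, seen as an amount that the face on the
-- right of h sends to the edge of h.  Vertices, edges and faces prescribe the
-- divergence of this flow, and two flows with the same divergence differ by a
-- potential on the corners, because Euler's formula makes the sphere simply connected.
--
-- The amount of flow crossing a curve drawn along the left side of a simple cycle
-- of length ℓ, its cost, is determined by the divergence: Euler's relation for the
-- disc on the left gives ℓ - d, or ℓ - p if the disc contains the inner root-face,
-- and at least ℓ + d if it contains the outer one.  So a non-negative flow forces
-- the girth conditions.
--
-- Conversely, start from a flow with pos ≥ 0 and raise the lower bound of x step by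
-- step by changing the potential.  The only obstruction is a closed walk of negative
-- cost keeping to the left sides of edges.  A shortest one is a simple cycle, which
-- the girth conditions exclude, or contains two loops each lying on the left of the
-- other, which is absurd.
--
-- A flow of maximal potential never has pos h and x h both positive, so it comes from
-- an orientation, and it has no counterclockwise circuit.  In any minimal orientation,
-- walking backwards through the first ingoing half-edge counterclockwise at each vertex
-- must lead to the outer cycle.  This gives accessibility, and as nothing crosses these
-- walks, it makes the potential maximal, hence unique.

module Submission where

open import Defs
open import Data.Nat as ℕ using (ℕ; zero; suc)
import Data.Nat.Properties as ℕ
open import Data.Nat.DivMod using (_%_; _/_; m≡m%n+[m/n]*n; m%n<n; m<n⇒m%n≡m; [m+kn]%n≡m%n; [m+n]%n≡m%n; n%n≡0)
open import Data.Nat.Induction using (<-rec)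
open import Data.Integer as ℤ using (ℤ; +_; 0ℤ; 1ℤ; _+_; _-_; _*_; -_; _≤_; _<_)
import Data.Integer.Properties as ℤ
open import Data.Integer.Tactic.RingSolver using (solve-∀)
open import Data.Fin as Fin using (Fin; zero; suc; inject₁; fromℕ; toℕ)
open import Data.Fin.Properties as Fin using (_≟_)
open import Data.Fin.Induction using (<-weakInduction)
import Data.Fin.Permutation as Perm
open import Data.Fin.Relation.Unary.Top using (view; ‵fromℕ; ‵inject₁)
open import Data.List using (List; []; _∷_; filterᵇ; length; map; foldr; tabulate)
open import Data.Bool using (Bool; true; false; _∧_; _∨_; not; if_then_else_)
import Data.Bool.Properties as Bool
open import Data.Product using (Σ; ∃-syntax; _×_; _,_; proj₁; proj₂)
open import Data.Sum as Sum using (_⊎_; inj₁; inj₂)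
open import Data.Empty using (⊥; ⊥-elim)
open import Relation.Nullary using (¬_; Dec; yes; no; does)
open import Relation.Binary.Definitions using (tri<; tri≈; tri>)
open import Relation.Nullary.Decidable using (dec-true; dec-false; _×-dec_; _⊎-dec_; ¬?)
open import Relation.Binary.PropositionalEquality
open import Function using (_∘_; id)
open import Function.Bundles using (_⇔_; mk⇔; Equivalence)
open import Algebra.Properties.Semiring.Sum ℤ.+-*-semiring as FinSum using (sum)

-- The corners form a graph: `c` is joined to `σ⁻ c` by a rotation that crosses the half-edge `c` at
-- price `pos c`, and to `φ c` by an advance inside the same face at price `x (α c)`. A potential on
-- corners replaces these prices by reduced prices and changes neither the divergences nor the price
-- of a closed walk. Finding a non-negative flow is thus a feasible potential problem, and the
-- maximal flow is the one given by distances from the outer face.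
--
-- The obstacle is that feasibility has to be tested on all closed walks, while the girth conditions
-- speak of simple cycles only. Restricting walks to free rotations and to advances at or below the
-- current bound, itself at most 0, lets a loop cut out of a walk be treated as a simple cycle whose
-- left side it hugs. Raising the bound by one unit at a time keeps every violation equal to 1,
-- which one unit of potential repairs.
--
-- Planarity enters through a spanning tree of the map and one of its dual which, by Euler's
-- formula, share out the edges. Besides the potentials on faces they give the two sides of a simple
-- cycle and Euler's relation in a disc.

from-difference : ∀ {x y} → x - y ≡ 0ℤ → x ≡ y
from-difference {x} {y} = ℤ.i-j≡0⇒i≡j x y

-- Certificates for linear consequences: the difference of the two sides of the goal is exhibited as
-- the sum of the differences of the hypotheses, which the ring solver can check. Multipliers are
-- put into the hypotheses through `cong`; `≤-from` does the same for inequalities, with a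
-- non-negative slack.
eq₁ : ∀ {x y l r} → l ≡ r → x - y ≡ l - r → x ≡ y
eq₁ {l = l} refl e = from-difference (trans e (ℤ.+-inverseʳ l))

eq₂ : ∀ {x y l r l' r'} → l ≡ r → l' ≡ r' → x - y ≡ (l - r) + (l' - r') → x ≡ y
eq₂ {l = l} {l' = l'} refl refl e = from-difference (trans e (cong₂ _+_ (ℤ.+-inverseʳ l) (ℤ.+-inverseʳ l')))

eq₃ : ∀ {x y l r l' r' l'' r''} → l ≡ r → l' ≡ r' → l'' ≡ r'' →
      x - y ≡ (l - r) + (l' - r') + (l'' - r'') → x ≡ y
eq₃ {l = l} {l' = l'} {l'' = l''} refl refl refl e =
  from-difference (trans e (cong₂ _+_ (cong₂ _+_ (ℤ.+-inverseʳ l) (ℤ.+-inverseʳ l')) (ℤ.+-inverseʳ l'')))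

≤-from : ∀ {a b k} → 0ℤ ≤ k → b - a ≡ k → a ≤ b
≤-from nn e = ℤ.0≤i-j⇒j≤i (subst (0ℤ ≤_) (sym e) nn)

0≤-diff : ∀ {a b} → a ≤ b → 0ℤ ≤ b - a
0≤-diff = ℤ.i≤j⇒0≤j-i

0≤-+ : ∀ {a b} → 0ℤ ≤ a → 0ℤ ≤ b → 0ℤ ≤ a + b
0≤-+ = ℤ.+-mono-≤

0≤-* : ∀ {a b} → 0ℤ ≤ a → 0ℤ ≤ b → 0ℤ ≤ a * b
0≤-* {+ a} {+ b} _ _ = subst (0ℤ ≤_) (ℤ.pos-* a b) (ℤ.+≤+ ℕ.z≤n)

0≤1 : 0ℤ ≤ 1ℤ
0≤1 = ℤ.+≤+ ℕ.z≤n

1≰0 : ¬ 1ℤ ≤ 0ℤ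
1≰0 (ℤ.+≤+ ())

<⇒1≤ : ∀ {a b} → a < b → 1ℤ + a ≤ b
<⇒1≤ = ℤ.i<j⇒suc[i]≤j

0<⇒1≤ : ∀ {b} → 0ℤ < b → 1ℤ ≤ b
0<⇒1≤ = <⇒1≤

nonneg-sum-zero : ∀ {a b} → 0ℤ ≤ a → 0ℤ ≤ b → a + b ≡ 0ℤ → a ≡ 0ℤ
nonneg-sum-zero {+ zero} {+ b} _ _ _ = refl
nonneg-sum-zero {+ suc a} {+ b} _ _ ()

nonneg-≢0 : ∀ {a} → 0ℤ ≤ a → a ≢ 0ℤ → 0ℤ < a
nonneg-≢0 {+ zero} _ a≢0 = ⊥-elim (a≢0 refl)
nonneg-≢0 {+ suc a} _ _ = ℤ.+<+ (ℕ.s≤s ℕ.z≤n)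

*-distribˡ-- : ∀ a b c → a * (b - c) ≡ a * b - a * c
*-distribˡ-- = solve-∀

flip-- : ∀ a b → a - b ≡ - (b - a)
flip-- = solve-∀

*-swap : ∀ a b c → a * (b * c) ≡ b * (a * c)
*-swap = solve-∀

double : ∀ a → a + a ≡ + 2 * a
double = solve-∀

-- Indicators with integer values

⟦_⟧ : Bool → ℤ
⟦ true ⟧ = 1ℤ
⟦ false ⟧ = 0ℤ

0≤⟦⟧ : ∀ b → 0ℤ ≤ ⟦ b ⟧
0≤⟦⟧ true = 0≤1
0≤⟦⟧ false = ℤ.≤-refl

⟦⟧≤1 : ∀ b → ⟦ b ⟧ ≤ 1ℤ
⟦⟧≤1 true = ℤ.≤-refl
⟦⟧≤1 false = 0≤1

δ : ∀ {n} → Fin n → Fin n → ℤ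
δ i j = ⟦ does (i ≟ j) ⟧

δ-yes : ∀ {n} {i j : Fin n} → i ≡ j → δ i j ≡ 1ℤ
δ-yes {i = i} {j} e = cong ⟦_⟧ (dec-true (i ≟ j) e)

δ-refl : ∀ {n} (i : Fin n) → δ i i ≡ 1ℤ
δ-refl i = δ-yes {i = i} refl

δ-no : ∀ {n} {i j : Fin n} → i ≢ j → δ i j ≡ 0ℤ
δ-no {i = i} {j} e = cong ⟦_⟧ (dec-false (i ≟ j) e)

δ-sym : ∀ {n} (i j : Fin n) → δ i j ≡ δ j i
δ-sym i j with i ≟ j
... | yes e = sym (δ-yes (sym e))
... | no ne = sym (δ-no (λ e → ne (sym e)))

0≤δ : ∀ {n} (i j : Fin n) → 0ℤ ≤ δ i j
0≤δ i j = 0≤⟦⟧ (does (i ≟ j))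

δ-suc : ∀ {n} (i j : Fin n) → δ (suc i) (suc j) ≡ δ i j
δ-suc i j with i ≟ j
... | yes e = refl
... | no _ = refl

does-≡ : ∀ {n} {i j : Fin n} → does (i ≟ j) ≡ true → i ≡ j
does-≡ {i = i} {j} e with i ≟ j
... | yes p = p

-- Finite sums

opaque
  ∑ : ∀ {n} → (Fin n → ℤ) → ℤ
  ∑ = sum

  ∑-cong : ∀ {n} {f g : Fin n → ℤ} → (∀ i → f i ≡ g i) → ∑ f ≡ ∑ g
  ∑-cong = FinSum.sum-cong-≗

  ∑-+ : ∀ {n} (f g : Fin n → ℤ) → ∑ (λ i → f i + g i) ≡ ∑ f + ∑ g
  ∑-+ = FinSum.∑-distrib-+

  ∑-swap : ∀ {m n} (f : Fin m → Fin n → ℤ) → ∑ (λ i → ∑ (f i)) ≡ ∑ (λ j → ∑ (λ i → f i j))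
  ∑-swap = FinSum.∑-comm

  ∑-*ˡ : ∀ {n} c (g : Fin n → ℤ) → c * ∑ g ≡ ∑ (λ i → c * g i)
  ∑-*ˡ = FinSum.*-distribˡ-sum

  ∑-suc : ∀ {n} (g : Fin (suc n) → ℤ) → ∑ g ≡ g zero + ∑ (g ∘ suc)
  ∑-suc g = refl

  ∑-init-last : ∀ {n} (g : Fin (suc n) → ℤ) → ∑ g ≡ ∑ (g ∘ inject₁) + g (fromℕ n)
  ∑-init-last = FinSum.sum-init-last

  ∑-reindex : ∀ {n} (f f⁻ : Fin n → Fin n) → (∀ h → f (f⁻ h) ≡ h) → (∀ h → f⁻ (f h) ≡ h) →
    (g : Fin n → ℤ) → ∑ (g ∘ f) ≡ ∑ g
  ∑-reindex f f⁻ ff⁻ f⁻f g = sym (FinSum.∑-permute g (Perm.permutation f f⁻ ff⁻ f⁻f))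

  ∑-neg : ∀ {n} (g : Fin n → ℤ) → ∑ (λ i → - g i) ≡ - ∑ g
  ∑-neg {zero} g = refl
  ∑-neg {suc n} g = trans (cong (_+_ (- g zero)) (∑-neg (g ∘ suc))) (sym (ℤ.neg-distrib-+ (g zero) _))

  ∑-nonneg : ∀ {n} {g : Fin n → ℤ} → (∀ i → 0ℤ ≤ g i) → 0ℤ ≤ ∑ g
  ∑-nonneg {zero} nn = ℤ.≤-refl
  ∑-nonneg {suc n} nn = 0≤-+ (nn zero) (∑-nonneg (nn ∘ suc))

  ∑-mono : ∀ {n} {f g : Fin n → ℤ} → (∀ i → f i ≤ g i) → ∑ f ≤ ∑ g
  ∑-mono {zero} m = ℤ.≤-refl
  ∑-mono {suc n} m = ℤ.+-mono-≤ (m zero) (∑-mono (m ∘ suc))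

  ∑-nonneg-zero : ∀ {n} {g : Fin n → ℤ} → (∀ i → 0ℤ ≤ g i) → ∑ g ≡ 0ℤ → ∀ i → g i ≡ 0ℤ
  ∑-nonneg-zero nn e zero = nonneg-sum-zero (nn zero) (∑-nonneg (nn ∘ suc)) e
  ∑-nonneg-zero {suc n} {g} nn e (suc i) = ∑-nonneg-zero (nn ∘ suc)
    (nonneg-sum-zero (∑-nonneg (nn ∘ suc)) (nn zero) (trans (ℤ.+-comm _ (g zero)) e)) i

  ∑-term≤ : ∀ {n} {g : Fin n → ℤ} → (∀ i → 0ℤ ≤ g i) → ∀ i → g i ≤ ∑ g
  ∑-term≤ {g = g} nn zero = subst (_≤ ∑ g) (ℤ.+-identityʳ (g zero)) (ℤ.+-monoʳ-≤ (g zero) (∑-nonneg (nn ∘ suc)))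
  ∑-term≤ {suc n} {g} nn (suc i) = ℤ.≤-trans (∑-term≤ (nn ∘ suc) i)
    (subst (_≤ ∑ g) (ℤ.+-identityˡ _) (ℤ.+-monoˡ-≤ (∑ (g ∘ suc)) (nn zero)))

  sum-filter : ∀ {n} {A : Set} (f : Fin n → A) (P : A → Bool) (w : A → ℤ) →
    foldr _+_ 0ℤ (map w (filterᵇ P (tabulate f))) ≡ ∑ (λ i → ⟦ P (f i) ⟧ * w (f i))
  sum-filter {zero} f P w = refl
  sum-filter {suc n} f P w with P (f zero) | sum-filter (f ∘ suc) P w
  ... | true | ih = cong₂ _+_ (sym (ℤ.*-identityˡ (w (f zero)))) ih
  ... | false | ih = trans ih (sym (ℤ.+-identityˡ _))

  length-filter : ∀ {n} {A : Set} (f : Fin n → A) (P : A → Bool) →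
    + length (filterᵇ P (tabulate f)) ≡ ∑ (λ i → ⟦ P (f i) ⟧)
  length-filter {zero} f P = refl
  length-filter {suc n} f P with P (f zero) | length-filter (f ∘ suc) P
  ... | true | ih = cong (_+_ 1ℤ) ih
  ... | false | ih = trans ih (sym (ℤ.+-identityˡ _))

  ∑-zero : ∀ {n} {g : Fin n → ℤ} → (∀ i → g i ≡ 0ℤ) → ∑ g ≡ 0ℤ
  ∑-zero {n} z = trans (∑-cong z) (FinSum.sum-replicate-zero n)

  ∑-δ : ∀ {n} (a : Fin n) (g : Fin n → ℤ) → ∑ (λ i → δ a i * g i) ≡ g a
  ∑-δ zero g = trans (cong₂ _+_ (ℤ.*-identityˡ (g zero)) (∑-zero {g = λ i → δ zero (suc i) * g (suc i)} (λ i → refl))) (ℤ.+-identityʳ _)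
  ∑-δ (suc a) g = trans (ℤ.+-identityˡ _)
    (trans (∑-cong (λ i → cong (_* g (suc i)) (δ-suc a i))) (∑-δ a (g ∘ suc)))

  ∑-const : ∀ n (c : ℤ) → ∑ {n} (λ _ → c) ≡ + n * c
  ∑-const zero c = refl
  ∑-const (suc n) c = trans (cong (_+_ c) (∑-const n c)) (lem c (+ n))
    where
    lem : ∀ c m → c + m * c ≡ (1ℤ + m) * c
    lem = solve-∀

∑-- : ∀ {n} (f g : Fin n → ℤ) → ∑ (λ i → f i - g i) ≡ ∑ f - ∑ g
∑-- f g = trans (∑-+ f (λ i → - g i)) (cong (_+_ (∑ f)) (∑-neg g))

∑-*ʳ : ∀ {n} (c : ℤ) (g : Fin n → ℤ) → ∑ (λ i → g i * c) ≡ ∑ g * c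
∑-*ʳ c g = trans (∑-cong (λ i → ℤ.*-comm (g i) c)) (trans (sym (∑-*ˡ c g)) (ℤ.*-comm c (∑ g)))

-- The terms `g i - f i` are non-negative with sum at most 0. This turns equality in a global count
-- into equality everywhere.
∑-tight : ∀ {n} {f g : Fin n → ℤ} → (∀ i → f i ≤ g i) → ∑ g ≤ ∑ f → ∀ i → f i ≡ g i
∑-tight {f = f} {g} f≤g g≤f i = sym (from-difference (∑-nonneg-zero (λ i → 0≤-diff (f≤g i))
  (trans (∑-- g f) (trans (cong (_- ∑ f) (ℤ.≤-antisym g≤f (∑-mono f≤g))) (ℤ.+-inverseʳ (∑ f)))) i))

∑-δ₁ : ∀ {n} (a : Fin n) → ∑ (δ a) ≡ 1ℤ
∑-δ₁ a = trans (∑-cong (λ i → sym (ℤ.*-identityʳ (δ a i)))) (∑-δ a (λ _ → 1ℤ))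

∑-ones : ∀ n → ∑ {n} (λ _ → 1ℤ) ≡ + n
∑-ones n = trans (∑-const n 1ℤ) (ℤ.*-identityʳ (+ n))

∑-all : ∀ {n} (S : Fin n → Bool) → (∀ i → S i ≡ true) → ∑ (λ i → ⟦ S i ⟧) ≡ + n
∑-all {n} S all = trans (∑-cong (λ i → cong ⟦_⟧ (all i))) (∑-ones n)

-- After exchanging the sums, each `h` meets only the point below it. Laws stated at each vertex or
-- face are in this way integrated against a weight `χ`.
∑-fibre : ∀ {n N} (π : Fin n → Fin N) (χ : Fin N → ℤ) (g : Fin n → ℤ) →
  ∑ (λ v → χ v * ∑ (λ h → δ (π h) v * g h)) ≡ ∑ (λ h → χ (π h) * g h)
∑-fibre π χ g = begin
  ∑ (λ v → χ v * ∑ (λ h → δ (π h) v * g h))   ≡⟨ ∑-cong (λ v → ∑-*ˡ (χ v) (λ h → δ (π h) v * g h)) ⟩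
  ∑ (λ v → ∑ (λ h → χ v * (δ (π h) v * g h))) ≡⟨ ∑-swap (λ v h → χ v * (δ (π h) v * g h)) ⟩
  ∑ (λ h → ∑ (λ v → χ v * (δ (π h) v * g h))) ≡⟨ ∑-cong (λ h → trans (∑-cong (λ v → *-swap (χ v) (δ (π h) v) (g h))) (∑-δ (π h) (λ v → χ v * g h))) ⟩
  ∑ (λ h → χ (π h) * g h) ∎
  where
  open ≡-Reasoning

∑-fibre₁ : ∀ {n N} (π : Fin n → Fin N) (g : Fin n → ℤ) →
  ∑ (λ v → ∑ (λ h → δ (π h) v * g h)) ≡ ∑ g
∑-fibre₁ π g = trans (∑-cong (λ v → sym (ℤ.*-identityˡ _)))
  (trans (∑-fibre π (λ _ → 1ℤ) g) (∑-cong (λ h → ℤ.*-identityˡ (g h))))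

injection-count : ∀ {m n} (f : Fin m → Fin n) → (∀ i j → f i ≡ f j → i ≡ j) →
  (P : Fin n → Bool) → (∀ i → P (f i) ≡ true) → + m ≤ ∑ (λ h → ⟦ P h ⟧)
injection-count {zero} f inj P Pf = ∑-nonneg (λ h → 0≤⟦⟧ (P h))
injection-count {suc m} f inj P Pf = subst₂ _≤_ refl split (ℤ.+-monoʳ-≤ 1ℤ rec)
  where
  P' : _ → Bool
  P' h = not (does (f zero ≟ h)) ∧ P h
  P'f : ∀ i → P' (f (suc i)) ≡ true
  P'f i with f zero ≟ f (suc i)
  ... | no _ = Pf (suc i)
  ... | yes e with inj zero (suc i) e
  ...   | ()
  rec : + m ≤ ∑ (λ h → ⟦ P' h ⟧)
  rec = injection-count (f ∘ suc) (λ i j e → Fin.suc-injective (inj (suc i) (suc j) e)) P' P'f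
  pw : ∀ h → δ (f zero) h + ⟦ P' h ⟧ ≡ ⟦ P h ⟧
  pw h with f zero ≟ h
  ... | yes refl = cong ⟦_⟧ (sym (Pf zero))
  ... | no _ = ℤ.+-identityˡ _
  split : 1ℤ + ∑ (λ h → ⟦ P' h ⟧) ≡ ∑ (λ h → ⟦ P h ⟧)
  split = trans (cong (_+ ∑ (λ h → ⟦ P' h ⟧)) (sym (∑-δ₁ (f zero))))
    (trans (sym (∑-+ (δ (f zero)) (λ h → ⟦ P' h ⟧))) (∑-cong pw))

-- Growing a finite set until it is closed

add : ∀ {N} → Fin N → (Fin N → Bool) → Fin N → Bool
add w S v = does (w ≟ v) ∨ S v

add-new : ∀ {N} (w : Fin N) S → add w S w ≡ true
add-new w S = cong (_∨ S w) (dec-true (w ≟ w) refl)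

add-old : ∀ {N} (w : Fin N) S {v} → S v ≡ true → add w S v ≡ true
add-old w S {v} e with does (w ≟ v)
... | true = refl
... | false = e

add-inv : ∀ {N} (w : Fin N) S {v} → add w S v ≡ true → w ≡ v ⊎ S v ≡ true
add-inv w S {v} e with w ≟ v
... | yes p = inj₁ p
... | no _ = inj₂ e

defect : ∀ {N} → (Fin N → Bool) → ℕ
defect {zero} S = 0
defect {suc N} S = (if S zero then 0 else 1) ℕ.+ defect (S ∘ suc)

defect-mono : ∀ {N} (S S' : Fin N → Bool) → (∀ v → S v ≡ true → S' v ≡ true) → defect S' ℕ.≤ defect S
defect-mono {zero} S S' sub = ℕ.z≤n
defect-mono {suc N} S S' sub = ℕ.+-mono-≤ head (defect-mono (S ∘ suc) (S' ∘ suc) (sub ∘ suc))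
  where
  head : (if S' zero then 0 else 1) ℕ.≤ (if S zero then 0 else 1)
  head with S zero | S' zero | sub zero
  ... | _     | true  | _ = ℕ.z≤n
  ... | false | false | _ = ℕ.≤-refl
  ... | true  | false | s with s refl
  ...   | ()

defect-strict : ∀ {N} (S S' : Fin N → Bool) → (∀ v → S v ≡ true → S' v ≡ true) →
  ∀ w → S w ≡ false → S' w ≡ true → defect S' ℕ.< defect S
defect-strict {suc N} S S' sub zero e e' rewrite e | e' = ℕ.s≤s (defect-mono (S ∘ suc) (S' ∘ suc) (sub ∘ suc))
defect-strict {suc N} S S' sub (suc w) e e' = ℕ.+-mono-≤-< head (defect-strict (S ∘ suc) (S' ∘ suc) (sub ∘ suc) w e e')
  where
  head : (if S' zero then 0 else 1) ℕ.≤ (if S zero then 0 else 1)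
  head with S zero | S' zero | sub zero
  ... | _     | true  | _ = ℕ.z≤n
  ... | false | false | _ = ℕ.≤-refl
  ... | true  | false | s with s refl
  ...   | ()

saturate : ∀ {N} (Inv Done : (Fin N → Bool) → Set) →
  (∀ S → Inv S → Done S ⊎ Σ (Fin N) (λ w → S w ≡ false × Inv (add w S))) →
  ∀ S → Inv S → Σ (Fin N → Bool) (λ S' → Inv S' × Done S')
saturate {N} Inv Done next S₀ i₀ = go (defect S₀) S₀ i₀ ℕ.≤-refl
  where
  go : ∀ k S → Inv S → defect S ℕ.≤ k → Σ (Fin N → Bool) (λ S' → Inv S' × Done S')
  go k S i le with next S i
  ... | inj₁ done = S , i , done
  ... | inj₂ (w , new , i') with ℕ.≤-trans (defect-strict S (add w S) (λ v → add-old w S) w new (add-new w S)) le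
  go (suc k) S i le | inj₂ (w , new , i') | ℕ.s≤s le' = go k (add w S) i' le'

true≢false : ∀ {b} → b ≡ true → b ≢ false
true≢false refl ()

bool-cases : ∀ b → b ≡ true ⊎ b ≡ false
bool-cases true = inj₁ refl
bool-cases false = inj₂ refl

≢true : ∀ {b} → b ≢ true → b ≡ false
≢true {false} _ = refl
≢true {true} ne = ⊥-elim (ne refl)

-- Spanning trees

-- Darts are reversed by α; a dart goes from src h to src (α h).
module Graph {n N : ℕ} (α : Fin n → Fin n) (αα : ∀ h → α (α h) ≡ h)
             (α-free : ∀ h → α h ≢ h) (src : Fin n → Fin N) where

  -- A forest with root set `S₀`, or a tree once the roots are merged. Each new dart ends at a point
  -- not yet reached, so that acyclicity is built in and induction on `Tree` removes leaves.
  data Tree (S₀ : Fin N → Bool) (ok : Fin n → Bool) : (Fin N → Bool) → List (Fin n) → Set where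
    root : Tree S₀ ok S₀ []
    grow : ∀ {S T} → Tree S₀ ok S T → (e : Fin n) → ok e ≡ true →
           S (src e) ≡ true → S (src (α e)) ≡ false → Tree S₀ ok (add (src (α e)) S) (e ∷ T)

  -- The indicator of the tree edges, carried by both darts of each edge; sums of `μ` are therefore
  -- twice numbers of edges.
  μ : List (Fin n) → Fin n → ℤ
  μ [] h = 0ℤ
  μ (e ∷ T) h = (δ e h + δ (α e) h) + μ T h

  Closed : (Fin n → Bool) → (Fin N → Bool) → Set
  Closed ok S = ∀ e → ok e ≡ true → S (src e) ≡ true → S (src (α e)) ≡ true

  δ-α : ∀ e h → δ (α e) (α h) ≡ δ e h
  δ-α e h with e ≟ h
  ... | yes p = δ-yes (cong α p)
  ... | no np = δ-no (λ p → np (trans (sym (αα e)) (trans (cong α p) (αα h))))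

  δ-α′ : ∀ e h → δ e (α h) ≡ δ (α e) h
  δ-α′ e h = trans (sym (δ-α e (α h))) (cong (δ (α e)) (αα h))

  μ-sym : ∀ T h → μ T (α h) ≡ μ T h
  μ-sym [] h = refl
  μ-sym (e ∷ T) h = cong₂ _+_ (trans (cong₂ _+_ (δ-α′ e h) (δ-α e h)) (ℤ.+-comm (δ (α e) h) (δ e h))) (μ-sym T h)

  spanning : ∀ S₀ ok → ∃[ S ] ∃[ T ] (Tree S₀ ok S T × Closed ok S)
  spanning S₀ ok with saturate (λ S → ∃[ T ] Tree S₀ ok S T) (Closed ok) next S₀ ([] , root)
    where
    next : ∀ S → ∃[ T ] Tree S₀ ok S T → Closed ok S ⊎ Σ (Fin N) (λ w → S w ≡ false × ∃[ T ] Tree S₀ ok (add w S) T)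
    next S (T , t) with Fin.any? (λ e → (ok e Bool.≟ true) ×-dec ((S (src e) Bool.≟ true) ×-dec (S (src (α e)) Bool.≟ false)))
    ... | yes (e , oe , se , ne) = inj₂ (src (α e) , ne , e ∷ T , grow t e oe se ne)
    ... | no none = inj₁ λ e oe se → closed e oe se (bool-cases (S (src (α e))))
      where
      closed : ∀ e → ok e ≡ true → S (src e) ≡ true → S (src (α e)) ≡ true ⊎ S (src (α e)) ≡ false → S (src (α e)) ≡ true
      closed e oe se (inj₁ x) = x
      closed e oe se (inj₂ x) = ⊥-elim (none (e , oe , se , x))
  ... | S , (T , t) , c = S , T , t , c

  module _ {S₀ : Fin N → Bool} {ok : Fin n → Bool} where

    roots⊆ : ∀ {S T} → Tree S₀ ok S T → ∀ {v} → S₀ v ≡ true → S v ≡ true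
    roots⊆ root e = e
    roots⊆ (grow {S} t e _ _ _) x = add-old (src (α e)) S (roots⊆ t x)

    new-dart : ∀ {S T} → Tree S₀ ok S T → ∀ {h} → S (src h) ≡ false → μ T h ≡ 0ℤ
    new-dart root _ = refl
    new-dart (grow {S} {T} t e _ se _) {h} nh = cong₂ _+_
      (cong₂ _+_ (δ-no ne) (δ-no ne')) (new-dart t (≢true λ x → true≢false (add-old (src (α e)) S x) nh))
      where
      ne : e ≢ h
      ne refl = true≢false (add-old (src (α e)) S se) nh
      ne' : α e ≢ h
      ne' refl = true≢false (add-new (src (α e)) S) nh

    μ-01 : ∀ {S T} → Tree S₀ ok S T → ∀ h → μ T h ≡ 0ℤ ⊎ μ T h ≡ 1ℤ
    μ-01 root h = inj₁ refl
    μ-01 (grow {S} {T} t e _ se ne) h with e ≟ h | α e ≟ h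
    ... | yes refl | yes p = ⊥-elim (α-free e p)
    ... | yes refl | no _ = inj₂ (cong (_+_ 1ℤ) (trans (sym (μ-sym T e)) (new-dart t ne)))
    ... | no _ | yes refl = inj₂ (cong (_+_ 1ℤ) (new-dart t ne))
    ... | no _ | no _ = subst (λ z → z ≡ 0ℤ ⊎ z ≡ 1ℤ) (sym (ℤ.+-identityˡ (μ T h))) (μ-01 t h)

    μ-ok : (∀ h → ok (α h) ≡ ok h) → ∀ {S T} → Tree S₀ ok S T → ∀ {h} → ok h ≡ false → μ T h ≡ 0ℤ
    μ-ok ok-sym root _ = refl
    μ-ok ok-sym (grow {S} {T} t e oe _ _) {h} nh = cong₂ _+_
      (cong₂ _+_ (δ-no ne) (δ-no ne')) (μ-ok ok-sym t nh)
      where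
      ne : e ≢ h
      ne refl = true≢false oe nh
      ne' : α e ≢ h
      ne' refl = true≢false (trans (ok-sym e) oe) nh

    -- Each tree edge is paired with the point that it was first to reach, and these points are
    -- exactly those of `S` outside the roots. With constant weights this counts the edges; with
    -- weights supported on one side of a cycle it counts the edges there.
    tree-sum : (g : Fin N → ℤ) (κ : Fin n → ℤ) → (∀ h → κ (α h) ≡ κ h) →
      (∀ e → ok e ≡ true → S₀ (src (α e)) ≡ false → κ e ≡ g (src (α e))) →
      ∀ {S T} → Tree S₀ ok S T →
      ∑ (λ h → μ T h * κ h) ≡ + 2 * (∑ (λ v → ⟦ S v ⟧ * g v) - ∑ (λ v → ⟦ S₀ v ⟧ * g v))
    tree-sum g κ κ-sym κ-g root = trans (∑-zero {g = λ h → 0ℤ * κ h} (λ h → refl)) (lem (∑ (λ v → ⟦ S₀ v ⟧ * g v)))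
      where
      lem : ∀ a → 0ℤ ≡ + 2 * (a - a)
      lem = solve-∀
    tree-sum g κ κ-sym κ-g (grow {S} {T} t e oe se ne) =
      trans lhs (eq₂ (tree-sum g κ κ-sym κ-g t) (sym rhs) (lem (κ e) (∑ (λ h → μ T h * κ h)) _ (∑ (λ v → ⟦ S v ⟧ * g v)) (∑ (λ v → ⟦ S₀ v ⟧ * g v))))
      where
      w = src (α e)
      distr : ∀ a b c k → ((a + b) + c) * k ≡ (a * k + b * k) + c * k
      distr = solve-∀
      lhs : ∑ (λ h → μ (e ∷ T) h * κ h) ≡ (κ e + κ e) + ∑ (λ h → μ T h * κ h)
      lhs = trans (∑-cong (λ h → distr (δ e h) (δ (α e) h) (μ T h) (κ h)))
        (trans (∑-+ (λ h → δ e h * κ h + δ (α e) h * κ h) (λ h → μ T h * κ h))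
          (cong (_+ ∑ (λ h → μ T h * κ h)) (trans (∑-+ (λ h → δ e h * κ h) (λ h → δ (α e) h * κ h))
             (cong₂ _+_ (∑-δ e κ) (trans (∑-δ (α e) κ) (κ-sym e))))))
      pw : ∀ v → ⟦ add w S v ⟧ * g v ≡ δ w v * g v + ⟦ S v ⟧ * g v
      pw v with w ≟ v
      ... | yes refl rewrite ne = trans (sym (ℤ.+-identityʳ _)) refl
      ... | no _ = sym (ℤ.+-identityˡ _)
      rhs : + 2 * ∑ (λ v → ⟦ add w S v ⟧ * g v) ≡ + 2 * (κ e + ∑ (λ v → ⟦ S v ⟧ * g v))
      rhs = cong (_*_ (+ 2)) (trans (∑-cong pw) (trans (∑-+ (λ v → δ w v * g v) (λ v → ⟦ S v ⟧ * g v))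
        (cong (_+ ∑ (λ v → ⟦ S v ⟧ * g v)) (trans (∑-δ w g) (sym (κ-g e oe (≢true λ x → true≢false (roots⊆ t x) ne)))))))
      lem : ∀ k m s' s s₀ → ((k + k) + m) - + 2 * (s' - s₀) ≡ (m - + 2 * (s - s₀)) + (+ 2 * (k + s) - + 2 * s')
      lem = solve-∀

    tree-count : ∀ {S T} → Tree S₀ ok S T →
      ∑ (μ T) ≡ + 2 * (∑ (λ v → ⟦ S v ⟧) - ∑ (λ v → ⟦ S₀ v ⟧))
    tree-count {S} {T} t = trans (∑-cong (λ h → sym (ℤ.*-identityʳ (μ T h))))
      (trans (tree-sum (λ _ → 1ℤ) (λ _ → 1ℤ) (λ _ → refl) (λ _ _ _ → refl) t)
        (cong (_*_ (+ 2)) (cong₂ _-_ (∑-cong (λ v → ℤ.*-identityʳ ⟦ S v ⟧)) (∑-cong (λ v → ℤ.*-identityʳ ⟦ S₀ v ⟧)))))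

    -- Prune the last leaf: it carries a single dart of the support.
    vanish : (g : Fin n → ℤ) → (∀ h → g (α h) ≡ - g h) →
      (∀ w → S₀ w ≡ false → ∑ (λ h → δ (src h) w * g h) ≡ 0ℤ) →
      ∀ {S T} → Tree S₀ ok S T → (∀ h → μ T h ≡ 0ℤ → g h ≡ 0ℤ) → ∀ h → g h ≡ 0ℤ
    vanish g anti div root supp h = supp h refl
    vanish g anti div (grow {S} {T} t e oe se ne) supp = vanish g anti div t supp'
      where
      w = src (α e)
      only : ∀ h → δ (src h) w * g h ≡ δ (α e) h * g h
      only h with src h ≟ w | α e ≟ h
      ... | yes _ | yes _ = refl
      ... | no sh | yes refl = ⊥-elim (sh refl)
      ... | no _ | no _ = refl
      ... | yes sh | no ah = trans (ℤ.*-identityˡ (g h)) (supp h (cong₂ _+_ (cong₂ _+_ (δ-no eh) (δ-no ah)) (new-dart t (trans (cong S sh) ne))))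
        where
        eh : e ≢ h
        eh refl = true≢false se (trans (cong S sh) ne)
      gαe : g (α e) ≡ 0ℤ
      gαe = trans (sym (∑-δ (α e) g)) (trans (sym (∑-cong only)) (div w (≢true λ x → true≢false (roots⊆ t x) ne)))
      ge : g e ≡ 0ℤ
      ge = trans (sym (ℤ.neg-involutive (g e))) (cong -_ (trans (sym (anti e)) gαe))
      supp' : ∀ h → μ T h ≡ 0ℤ → g h ≡ 0ℤ
      supp' h z with e ≟ h | α e ≟ h
      ... | yes refl | _ = ge
      ... | no _ | yes refl = gαe
      ... | no eh | no ah = supp h (cong₂ _+_ (cong₂ _+_ (δ-no eh) (δ-no ah)) z)

    -- `ω` is integrated outwards from the roots: a new point receives the value forced by the edge
    -- that reaches it, and earlier values stay as they are.
    tree-potential : (ω : Fin n → ℤ) → (∀ h → ω (α h) ≡ - ω h) → ∀ {S T} → Tree S₀ ok S T →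
      Σ (Fin N → ℤ) λ θ → (∀ h → μ T h ≢ 0ℤ → θ (src h) - θ (src (α h)) ≡ ω h)
    tree-potential ω anti root = (λ _ → 0ℤ) , λ h ne → ⊥-elim (ne refl)
    tree-potential ω anti (grow {S} {T} t e oe se ne) with tree-potential ω anti t
    ... | θ , good = θ' , good'
      where
      w = src (α e)
      θ' : Fin N → ℤ
      θ' v = if does (w ≟ v) then θ (src e) - ω e else θ v
      θ'-w : θ' w ≡ θ (src e) - ω e
      θ'-w = cong (λ b → if b then θ (src e) - ω e else θ w) (dec-true (w ≟ w) refl)
      θ'-old : ∀ {v} → S v ≡ true → θ' v ≡ θ v
      θ'-old {v} sv = cong (λ b → if b then θ (src e) - ω e else θ v) (dec-false (w ≟ v) λ { refl → true≢false sv ne })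
      good' : ∀ h → μ (e ∷ T) h ≢ 0ℤ → θ' (src h) - θ' (src (α h)) ≡ ω h
      good' h nz with e ≟ h | α e ≟ h
      ... | yes refl | _ = trans (cong₂ _-_ (θ'-old se) θ'-w) (lem (θ (src e)) (ω e))
        where
        lem : ∀ a b → a - (a - b) ≡ b
        lem = solve-∀
      ... | no _ | yes refl = trans (cong₂ _-_ θ'-w (trans (cong (θ' ∘ src) (αα e)) (θ'-old se))) (trans (lem (θ (src e)) (ω e)) (sym (anti e)))
        where
        lem : ∀ a b → (a - b) - a ≡ - b
        lem = solve-∀
      ... | no eh | no ah = trans (cong₂ _-_ (θ'-old (old h nz')) (θ'-old (old (α h) λ z → nz' (trans (sym (μ-sym T h)) z)))) (good h nz')
        where
        nz' : μ T h ≢ 0ℤ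
        nz' z = nz (trans (ℤ.+-identityˡ (μ T h)) z)
        old : ∀ k → μ T k ≢ 0ℤ → S (src k) ≡ true
        old k nk with bool-cases (S (src k))
        ... | inj₁ y = y
        ... | inj₂ y = ⊥-elim (nk (new-dart t y))

-- Planar maps

module Map (M : AnnularMap) where
  open AnnularMap M public

  φ : Fin n → Fin n
  φ h = σ⁻ (α h)

  face-φ : ∀ h → face (φ h) ≡ face h
  face-φ h = sym (Equivalence.from (face-orbit h (φ h)) (1 , refl))

  vert-σ⁻ : ∀ h → vert (σ⁻ h) ≡ vert h
  vert-σ⁻ h = Equivalence.from (vert-orbit (σ⁻ h) h) (1 , σσ⁻ h)

  vert-σ : ∀ h → vert (σ h) ≡ vert h
  vert-σ h = sym (Equivalence.from (vert-orbit h (σ h)) (1 , refl))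

  vert-φ : ∀ h → vert (φ h) ≡ vert (α h)
  vert-φ h = vert-σ⁻ (α h)

  φ-ασ : ∀ h → φ (α (σ h)) ≡ h
  φ-ασ h = trans (cong σ⁻ (αα (σ h))) (σ⁻σ h)

  ασ-φ : ∀ h → α (σ (φ h)) ≡ h
  ασ-φ h = trans (cong α (σσ⁻ (α h))) (αα h)

  face-ασ : ∀ h → face (α (σ h)) ≡ face h
  face-ασ h = trans (sym (face-φ (α (σ h)))) (cong face (φ-ασ h))

  face-σ⁻ : ∀ h → face (σ⁻ h) ≡ face (α h)
  face-σ⁻ h = trans (cong (face ∘ σ⁻) (sym (αα h))) (face-φ (α h))

  α-injective : ∀ {h k} → α h ≡ α k → h ≡ k
  α-injective {h} {k} e = trans (sym (αα h)) (trans (cong α e) (αα k))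

  around-vertex : (Q : Fin n → Set) → (∀ y → Q y → Q (σ y)) → ∀ {k y} → vert k ≡ vert y → Q k → Q y
  around-vertex Q closed {k} {y} e qk with Equivalence.to (vert-orbit k y) e
  ... | r , refl = go r
    where
    go : ∀ r → Q (iter σ r k)
    go zero = qk
    go (suc r) = closed _ (go r)

  around-face : (Q : Fin n → Set) → (∀ y → Q y → Q (φ y)) → ∀ {k y} → face k ≡ face y → Q k → Q y
  around-face Q closed {k} {y} e qk with Equivalence.to (face-orbit k y) e
  ... | r , refl = go r
    where
    go : ∀ r → Q (iter φ r k)
    go zero = qk
    go (suc r) = closed _ (go r)

  dart-connected : (P : Fin n → Set) → (∀ h → P h → P (σ h)) → (∀ h → P h → P (α h)) →
    ∀ h k → P h → P k
  dart-connected P s a h k ph = go (connected h k)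
    where
    go : ∀ {k} → Conn σ α h k → P k
    go Conn.here = ph
    go (Conn.stepσ c) = s _ (go c)
    go (Conn.stepα c) = a _ (go c)

  dual-connected : (P : Fin F → Set) → (∀ h → P (face h) → P (face (α h))) → ∀ f g → P f → P g
  dual-connected P cl f g pf with face-surj f | face-surj g
  ... | h , refl | k , refl = dart-connected (P ∘ face)
    (λ h ph → subst P (cong face (αα (σ h))) (cl (α (σ h)) (subst P (sym (face-ασ h)) ph))) cl h k pf

  primal-connected : (P : Fin V → Set) → (∀ h → P (vert h) → P (vert (α h))) → ∀ u v → P u → P v
  primal-connected P cl u v pu with vert-surj u | vert-surj v
  ... | h , refl | k , refl = dart-connected (P ∘ vert)
    (λ h ph → subst P (sym (vert-σ h)) ph) cl h k pu

  ∑-α : (g : Fin n → ℤ) → ∑ (g ∘ α) ≡ ∑ g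
  ∑-α = ∑-reindex α α αα αα

  ∑-σ⁻ : (g : Fin n → ℤ) → ∑ (g ∘ σ⁻) ≡ ∑ g
  ∑-σ⁻ = ∑-reindex σ⁻ σ σ⁻σ σσ⁻

  ∑-φ : (g : Fin n → ℤ) → ∑ (g ∘ φ) ≡ ∑ g
  ∑-φ g = trans (∑-α (g ∘ σ⁻)) (∑-σ⁻ g)

  -- The sum telescopes round the face, since `φ h` starts where `h` ends. In `boundary-vertex` it
  -- telescopes round the vertex, since the right face of `h` is the left face of `σ⁻ h`.
  coboundary-face : (a : Fin V → ℤ) → ∀ f → ∑ (λ h → δ (face h) f * (a (vert h) - a (vert (α h)))) ≡ 0ℤ
  coboundary-face a f = begin
    ∑ (λ h → δ (face h) f * (a (vert h) - a (vert (α h))))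
      ≡⟨ ∑-cong (λ h → *-distribˡ-- (δ (face h) f) _ _) ⟩
    ∑ (λ h → G h - δ (face h) f * a (vert (α h)))
      ≡⟨ ∑-- G (λ h → δ (face h) f * a (vert (α h))) ⟩
    ∑ G - ∑ (λ h → δ (face h) f * a (vert (α h)))
      ≡⟨ cong (_-_ (∑ G)) (trans (∑-cong (λ h → cong₂ (λ x y → δ x f * a y) (sym (face-φ h)) (sym (vert-φ h)))) (∑-φ G)) ⟩
    ∑ G - ∑ G ≡⟨ ℤ.+-inverseʳ (∑ G) ⟩
    0ℤ ∎
    where
    open ≡-Reasoning
    G : Fin n → ℤ
    G h = δ (face h) f * a (vert h)

  boundary-vertex : (b : Fin F → ℤ) → ∀ v → ∑ (λ h → δ (vert h) v * (b (face h) - b (face (α h)))) ≡ 0ℤ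
  boundary-vertex b v = begin
    ∑ (λ h → δ (vert h) v * (b (face h) - b (face (α h))))
      ≡⟨ ∑-cong (λ h → *-distribˡ-- (δ (vert h) v) _ _) ⟩
    ∑ (λ h → G h - δ (vert h) v * b (face (α h)))
      ≡⟨ ∑-- G (λ h → δ (vert h) v * b (face (α h))) ⟩
    ∑ G - ∑ (λ h → δ (vert h) v * b (face (α h)))
      ≡⟨ cong (_-_ (∑ G)) (trans (∑-cong (λ h → cong₂ (λ x y → δ x v * b y) (sym (vert-σ⁻ h)) (sym (face-σ⁻ h)))) (∑-σ⁻ G)) ⟩
    ∑ G - ∑ G ≡⟨ ℤ.+-inverseʳ (∑ G) ⟩
    0ℤ ∎
    where
    open ≡-Reasoning
    G : Fin n → ℤ
    G h = δ (vert h) v * b (face h)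

  euler-ℤ : + 2 * (+ V + + F) ≡ + n + + 4
  euler-ℤ = trans (cong (_*_ (+ 2)) (sym (ℤ.pos-+ V F))) (trans (sym (ℤ.pos-* 2 (V ℕ.+ F))) (trans (cong +_ euler) (ℤ.pos-+ n 4)))

  module Dual = Graph α αα α-free face
  module Primal = Graph α αα α-free vert

  -- The cut around S is a cocycle supported on the dual tree T*, so it vanishes.
  complementary-spanning : ∀ {S₀ ok S₁ S} {T* : List (Fin n)} (t : Dual.Tree S₀ ok S₁ T*) →
    Primal.Closed (λ h → does (Dual.μ T* h ℤ.≟ 0ℤ)) S → ∀ r → S r ≡ true → ∀ v → S v ≡ true
  complementary-spanning {S = S} {T*} t closed r Sr v = primal-connected (λ v → S v ≡ true) forced r v Sr
    where
    g : Fin n → ℤ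
    g h = ⟦ S (vert h) ⟧ - ⟦ S (vert (α h)) ⟧
    anti : ∀ h → g (α h) ≡ - g h
    anti h = trans (cong (λ k → ⟦ S (vert (α h)) ⟧ - ⟦ S (vert k) ⟧) (αα h)) (flip-- ⟦ S (vert (α h)) ⟧ ⟦ S (vert h) ⟧)
    same : ∀ h → Dual.μ T* h ≡ 0ℤ → S (vert h) ≡ true → S (vert (α h)) ≡ true
    same h z s = closed h (dec-true (Dual.μ T* h ℤ.≟ 0ℤ) z) s
    supp : ∀ h → Dual.μ T* h ≡ 0ℤ → g h ≡ 0ℤ
    supp h z with bool-cases (S (vert h)) | bool-cases (S (vert (α h)))
    ... | inj₁ x | _ = cong₂ (λ a b → ⟦ a ⟧ - ⟦ b ⟧) x (same h z x)
    ... | inj₂ x | inj₂ y = cong₂ (λ a b → ⟦ a ⟧ - ⟦ b ⟧) x y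
    ... | inj₂ x | inj₁ y = ⊥-elim (true≢false (trans (cong (S ∘ vert) (sym (αα h))) (same (α h) (trans (Dual.μ-sym T* h) z) y)) x)
    g≡0 : ∀ h → g h ≡ 0ℤ
    g≡0 = Dual.vanish g anti (λ f _ → coboundary-face (λ v → ⟦ S v ⟧) f) t supp
    forced : ∀ h → S (vert h) ≡ true → S (vert (α h)) ≡ true
    forced h s with bool-cases (S (vert (α h)))
    ... | inj₁ y = y
    ... | inj₂ y with trans (sym (cong₂ (λ a b → ⟦ a ⟧ - ⟦ b ⟧) s y)) (g≡0 h)
    ...   | ()

  opaque
    -- The first homology of the sphere vanishes. `θ` integrates `ω` along a dual spanning tree; the
    -- remainder `ω'` is 0 there, hence supported on the primal tree, on which a divergence-free
    -- function can only be zero.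
    exact : (ω : Fin n → ℤ) → (∀ h → ω (α h) ≡ - ω h) →
      (∀ v → ∑ (λ h → δ (vert h) v * ω h) ≡ 0ℤ) →
      Σ (Fin F → ℤ) λ θ → ∀ h → θ (face h) - θ (face (α h)) ≡ ω h
    exact ω anti div with Dual.spanning (λ f → does (outer ≟ f)) (λ _ → true)
    ... | S₁ , T* , t* , closed* with Primal.spanning (λ v → does (vert (proj₁ (face-surj outer)) ≟ v)) (λ h → does (Dual.μ T* h ℤ.≟ 0ℤ))
    ...   | S , T , t , closed = θ , λ h → sym (from-difference (ω'≡0 h))
      where
      open Dual using () renaming (μ to μ*)
      open Primal using (μ)
      r : Fin V
      r = vert (proj₁ (face-surj outer))
      all₁ : ∀ f → S₁ f ≡ true
      all₁ f = dual-connected (λ f → S₁ f ≡ true) (λ h → closed* h refl) outer f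
        (Dual.roots⊆ t* (dec-true (outer ≟ outer) refl))
      all : ∀ v → S v ≡ true
      all = complementary-spanning {S = S} t* closed r (Primal.roots⊆ t (dec-true (r ≟ r) refl))
      dichotomy : ∀ h → 0ℤ ≤ 1ℤ - (μ* T* h + μ T h)
      dichotomy h with Dual.μ-01 t* h
      ... | inj₁ z with Primal.μ-01 t h
      ...   | inj₁ z' rewrite z | z' = 0≤1
      ...   | inj₂ z' rewrite z | z' = ℤ.≤-refl
      dichotomy h | inj₂ o rewrite o | Primal.μ-ok (λ h → cong (λ z → does (z ℤ.≟ 0ℤ)) (Dual.μ-sym T* h)) t {h} (cong (λ z → does (z ℤ.≟ 0ℤ)) o) = ℤ.≤-refl
      -- The two trees have `F - 1` and `V - 1` edges, which is all the edges by Euler's formula. As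
      -- no edge lies in both, every edge lies in one of them.
      total : ∑ (λ h → 1ℤ - (μ* T* h + μ T h)) ≡ 0ℤ
      total = trans (∑-- (λ _ → 1ℤ) (λ h → μ* T* h + μ T h))
        (trans (cong₂ _-_ (∑-ones n)
          (trans (∑-+ (μ* T*) (μ T)) (cong₂ _+_
             (trans (Dual.tree-count t*) (cong (_*_ (+ 2)) (cong₂ _-_ (∑-all S₁ all₁) (∑-δ₁ outer))))
             (trans (Primal.tree-count t) (cong (_*_ (+ 2)) (cong₂ _-_ (∑-all S all) (∑-δ₁ r)))))))
        (eq₁ (sym euler-ℤ) (lem (+ n) (+ F) (+ V))))
        where
        lem : ∀ n f v → n - (+ 2 * (f - 1ℤ) + + 2 * (v - 1ℤ)) - 0ℤ ≡ n + + 4 - + 2 * (v + f)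
        lem = solve-∀
      covered : ∀ h → 1ℤ - (μ* T* h + μ T h) ≡ 0ℤ
      covered = ∑-nonneg-zero dichotomy total
      θ : Fin F → ℤ
      θ = proj₁ (Dual.tree-potential ω anti t*)
      ω' : Fin n → ℤ
      ω' h = ω h - (θ (face h) - θ (face (α h)))
      anti' : ∀ h → ω' (α h) ≡ - ω' h
      anti' h = trans (cong₂ (λ x k → x - (θ (face (α h)) - θ (face k))) (anti h) (αα h)) (lem (ω h) (θ (face h)) (θ (face (α h))))
        where
        lem : ∀ w a b → - w - (b - a) ≡ - (w - (a - b))
        lem = solve-∀
      div' : ∀ v → ∑ (λ h → δ (vert h) v * ω' h) ≡ 0ℤ
      div' v = trans (∑-cong (λ h → *-distribˡ-- (δ (vert h) v) (ω h) _))
        (trans (∑-- (λ h → δ (vert h) v * ω h) (λ h → δ (vert h) v * (θ (face h) - θ (face (α h)))))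
          (cong₂ _-_ (div v) (boundary-vertex θ v)))
      supp : ∀ h → μ T h ≡ 0ℤ → ω' h ≡ 0ℤ
      supp h z = trans (cong (_-_ (ω h)) (proj₂ (Dual.tree-potential ω anti t*) h λ z* → impossible z*)) (ℤ.+-inverseʳ (ω h))
        where
        impossible : μ* T* h ≡ 0ℤ → ⊥
        impossible z* with trans (sym (cong₂ (λ a b → 1ℤ - (a + b)) z* z)) (covered h)
        ... | ()
      ω'≡0 : ∀ h → ω' h ≡ 0ℤ
      ω'≡0 = Primal.vanish ω' anti' (λ v _ → div' v) t supp

-- Simple cycles and their two sides

any-count : ∀ {m n} (f : Fin m → Fin n) → (∀ i j → f i ≡ f j → i ≡ j) → ∀ v →
  ⟦ does (Fin.any? (λ i → f i ≟ v)) ⟧ ≡ ∑ (λ i → δ (f i) v)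
any-count f inj v with Fin.any? (λ i → f i ≟ v)
... | yes (i , refl) = sym (trans (∑-cong pw) (∑-δ₁ i))
  where
  pw : ∀ j → δ (f j) (f i) ≡ δ i j
  pw j with i ≟ j
  ... | yes refl = δ-refl (f j)
  ... | no ne = δ-no (λ e → ne (sym (inj j i e)))
... | no none = sym (∑-zero (λ i → δ-no (λ e → none (i , e))))

module Cycle (M : AnnularMap) (C : SimpleCycle M) where
  open Map M
  open SimpleCycle C public

  infix 4 _~_
  _~_ : Fin F → Fin F → Set
  f ~ g = DualReach M C f g

  prev : Fin (suc m) → Fin (suc m)
  prev zero = fromℕ m
  prev (suc i) = inject₁ i

  vert-prev : ∀ j → vert (α (he (prev j))) ≡ vert (he j)
  vert-prev zero = close
  vert-prev (suc i) = consec i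

  prev-surjective : ∀ i → ∃[ j ] prev j ≡ i
  prev-surjective i with view i
  ... | ‵fromℕ = zero , refl
  ... | ‵inject₁ j = suc j , refl

  OnCycle-α : ∀ {h} → OnCycle h → OnCycle (α h)
  OnCycle-α {h} (i , inj₁ e) = i , inj₂ (trans e (sym (αα h)))
  OnCycle-α {h} (i , inj₂ e) = i , inj₁ e

  OnCycle-α⁻ : ∀ {h} → OnCycle (α h) → OnCycle h
  OnCycle-α⁻ {h} o = subst OnCycle (αα h) (OnCycle-α o)

  opaque
    onCycle? : ∀ h → Dec (OnCycle h)
    onCycle? h = Fin.any? (λ i → (he i ≟ h) ⊎-dec (he i ≟ α h))

  on-vertex : ∀ {k} → OnCycle k → ∃[ j ] vert (he j) ≡ vert k
  on-vertex (i , inj₁ refl) = i , refl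
  on-vertex {k} (i , inj₂ e) with prev-surjective i
  ... | j , refl = j , trans (sym (vert-prev j)) (cong vert (trans (cong α e) (αα k)))

  star : ∀ j {k} → vert k ≡ vert (he j) → OnCycle k → k ≡ he j ⊎ k ≡ α (he (prev j))
  star j {k} vk (i , inj₁ refl) = inj₁ (cong he (vert-distinct i j vk))
  star j {k} vk (i , inj₂ e) with prev-surjective i
  ... | j' , refl with vert-distinct j' j (trans (sym (vert-prev j')) (trans (cong vert (trans (cong α e) (αα k))) vk))
  ...   | refl = inj₂ (trans (sym (αα k)) (cong α (sym e)))

  ~-trans : ∀ {f g h} → f ~ g → g ~ h → f ~ h
  ~-trans p DualReach.here = p
  ~-trans p (DualReach.step q off) = DualReach.step (~-trans p q) off

  ~-across : ∀ h → ¬ OnCycle h → face h ~ face (α h)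
  ~-across h off = DualReach.step DualReach.here off

  ~-sym : ∀ {f g} → f ~ g → g ~ f
  ~-sym DualReach.here = DualReach.here
  ~-sym (DualReach.step {h} p off) = ~-trans
    (subst (face (α h) ~_) (cong face (αα h)) (~-across (α h) (λ o → off (OnCycle-α⁻ o)))) (~-sym p)

  -- Turning counterclockwise from `k`, only edges off the cycle are crossed before `k'` is met, and
  -- the last corner before `k'` is `σ⁻ k'`.
  arc : ∀ k k' → (∀ x → vert x ≡ vert k → OnCycle x → x ≡ k ⊎ x ≡ k') → k ≢ k' → vert k ≡ vert k' →
    face k ~ face (σ⁻ k')
  arc k k' only k≢k' vk = finish (proj₁ (around-vertex Q turn vk (inj₁ (k≢k' , DualReach.here) , refl)))
    where
    Found : Set
    Found = face k ~ face (σ⁻ k')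
    -- The orbit is followed until it stands at `k'`, where the first alternative is void. So the
    -- corner before `k'` has been passed, and `Found` remembers it from then on.
    Q : Fin n → Set
    Q y = ((y ≢ k' × face k ~ face y) ⊎ Found) × vert y ≡ vert k
    turn : ∀ y → Q y → Q (σ y)
    turn y (inj₂ found , vy) = inj₂ found , trans (vert-σ y) vy
    turn y (inj₁ (_ , p) , vy) with σ y ≟ k'
    ... | yes hit = inj₂ (subst (λ x → face k ~ face x) (trans (sym (σ⁻σ y)) (cong σ⁻ hit)) p) , trans (vert-σ y) vy
    ... | no miss with onCycle? (σ y)
    ...   | no off = inj₁ (miss , ~-trans p (subst (_~ face (σ y)) (face-ασ y) (~-sym (~-across (σ y) off)))) , trans (vert-σ y) vy
    ...   | yes on with only (σ y) (trans (vert-σ y) vy) on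
    ...     | inj₁ back = inj₁ (miss , subst (λ x → face k ~ face x) (sym back) DualReach.here) , trans (vert-σ y) vy
    ...     | inj₂ hit = ⊥-elim (miss hit)
    finish : (k' ≢ k' × face k ~ face k') ⊎ Found → Found
    finish (inj₁ (ne , _)) = ⊥-elim (ne refl)
    finish (inj₂ found) = found

  he≢α : ∀ i j → he i ≢ α (he j)
  he≢α i j e with edge-distinct i j (inj₂ e)
  ... | refl = α-free (he i) (sym e)

  left-prev : ∀ j → face (he j) ~ face (he (prev j))
  left-prev j = subst (face (he j) ~_) (face-φ (he (prev j)))
    (arc (he j) (α (he (prev j))) (λ x → star j) (he≢α j (prev j)) (sym (vert-prev j)))

  right-prev : ∀ j → face (α (he (prev j))) ~ face (α (he j))
  right-prev j = subst (face (α (he (prev j))) ~_) (face-σ⁻ (he j))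
    (arc (α (he (prev j))) (he j) (λ x vx o → Sum.swap (star j (trans vx (vert-prev j)) o)) (λ e → he≢α j (prev j) (sym e)) (vert-prev j))

  left : ∀ i → face (he zero) ~ face (he i)
  left = <-weakInduction (λ i → face (he zero) ~ face (he i)) DualReach.here
    (λ i p → ~-trans p (~-sym (left-prev (suc i))))

  right : ∀ i → face (α (he zero)) ~ face (α (he i))
  right = <-weakInduction (λ i → face (α (he zero)) ~ face (α (he i))) DualReach.here
    (λ i p → ~-trans p (right-prev (suc i)))

  two-sides : ∀ f → face (he zero) ~ f ⊎ face (α (he zero)) ~ f
  two-sides f = dual-connected (λ f → face (he zero) ~ f ⊎ face (α (he zero)) ~ f) advance (face (he zero)) f (inj₁ DualReach.here)
    where
    advance : ∀ h → face (he zero) ~ face h ⊎ face (α (he zero)) ~ face h → face (he zero) ~ face (α h) ⊎ face (α (he zero)) ~ face (α h)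
    advance h p with onCycle? h
    ... | yes (i , inj₁ refl) = inj₂ (right i)
    ... | yes (i , inj₂ e) = inj₁ (subst (λ x → face (he zero) ~ face x) e (left i))
    advance h (inj₁ p) | no off = inj₁ (DualReach.step p off)
    advance h (inj₂ p) | no off = inj₂ (DualReach.step p off)

  # : Fin n → ℤ
  # h = ∑ (λ i → δ (he i) h)

  #-he : ∀ i → # (he i) ≡ 1ℤ
  #-he i = trans (∑-cong pw) (∑-δ₁ i)
    where
    pw : ∀ j → δ (he j) (he i) ≡ δ i j
    pw j with i ≟ j
    ... | yes refl = δ-refl (he j)
    ... | no ne = δ-no (λ e → ne (sym (edge-distinct j i (inj₁ e))))

  #-αhe : ∀ i → # (α (he i)) ≡ 0ℤ
  #-αhe i = ∑-zero (λ j → δ-no (he≢α j i))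

  #-off : ∀ {h} → ¬ OnCycle h → # h ≡ 0ℤ
  #-off off = ∑-zero (λ j → δ-no (λ e → off (j , inj₁ e)))

  ∑-# : (g : Fin n → ℤ) → ∑ (λ h → # h * g h) ≡ ∑ (λ i → g (he i))
  ∑-# g = trans (∑-cong (λ h → sym (∑-*ʳ (g h) (λ i → δ (he i) h))))
    (trans (∑-swap (λ h i → δ (he i) h * g h)) (∑-cong (λ i → ∑-δ (he i) g)))

  ∑-shift : (g : Fin V → ℤ) → ∑ (λ i → g (vert (α (he i)))) ≡ ∑ (λ i → g (vert (he i)))
  ∑-shift g = trans (∑-init-last (λ i → g (vert (α (he i)))))
    (trans (cong₂ _+_ (∑-cong (λ i → cong g (consec i))) (cong g close))
      (trans (ℤ.+-comm (∑ (λ i → g (vert (he (suc i))))) (g (vert (he zero)))) (sym (∑-suc (λ i → g (vert (he i)))))))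

  -- The cycle leaves each vertex as often as it enters it, so its signed indicator has no
  -- divergence. The resulting function on faces is the winding number, up to a constant.
  winding : Σ (Fin F → ℤ) λ θ → ∀ h → θ (face h) - θ (face (α h)) ≡ # h - # (α h)
  winding = exact (λ h → # h - # (α h))
    (λ h → trans (cong (λ k → # (α h) - # k) (αα h)) (flip-- (# (α h)) (# h))) div
    where
    distr : ∀ a b c → a * (b - c) ≡ b * a - c * a
    distr = solve-∀
    div : ∀ v → ∑ (λ h → δ (vert h) v * (# h - # (α h))) ≡ 0ℤ
    div v = trans (∑-cong (λ h → distr (δ (vert h) v) (# h) (# (α h))))
      (trans (∑-- (λ h → # h * δ (vert h) v) (λ h → # (α h) * δ (vert h) v))
        (trans (cong₂ _-_ (∑-# (λ h → δ (vert h) v))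
           (trans (∑-cong (λ h → cong (λ k → # (α h) * δ (vert k) v) (sym (αα h))))
             (trans (∑-α (λ h → # h * δ (vert (α h)) v))
               (trans (∑-# (λ h → δ (vert (α h)) v)) (∑-shift (λ u → δ u v))))))
           (ℤ.+-inverseʳ (∑ (λ i → δ (vert (he i)) v)))))

  private
    θ = proj₁ winding

  θ-~ : ∀ {f g} → f ~ g → θ f ≡ θ g
  θ-~ DualReach.here = refl
  θ-~ (DualReach.step {h} p off) = trans (θ-~ p) (from-difference
    (trans (proj₂ winding h) (cong₂ _-_ (#-off off) (#-off (λ o → off (OnCycle-α⁻ o))))))

  -- The Jordan curve property: the winding number is constant on each side and jumps by 1 across
  -- the first edge of the cycle.
  not-both : ∀ {f} → face (he zero) ~ f → face (α (he zero)) ~ f → ⊥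
  not-both {f} l r = 0≢1 0≡1
    where
    0≢1 : 0ℤ ≢ 1ℤ
    0≢1 ()
    0≡1 : 0ℤ ≡ 1ℤ
    0≡1 = begin
      0ℤ                                          ≡⟨ sym (ℤ.+-inverseʳ (θ f)) ⟩
      θ f - θ f                                   ≡⟨ cong₂ _-_ (sym (θ-~ l)) (sym (θ-~ r)) ⟩
      θ (face (he zero)) - θ (face (α (he zero))) ≡⟨ proj₂ winding (he zero) ⟩
      # (he zero) - # (α (he zero))               ≡⟨ cong₂ _-_ (#-he zero) (#-αhe zero) ⟩
      1ℤ                                          ∎
      where open ≡-Reasoning

  opaque
    -- The left side as a Boolean function. `DualReach` comes without a decision procedure;
    -- `two-sides` makes the choice and `not-both` shows that it is the only one possible.
    inside : Fin F → Bool
    inside f with two-sides f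
    ... | inj₁ _ = true
    ... | inj₂ _ = false

    inside⇒left : ∀ {f} → inside f ≡ true → face (he zero) ~ f
    inside⇒left {f} e with two-sides f
    ... | inj₁ p = p

    outside⇒right : ∀ {f} → inside f ≡ false → face (α (he zero)) ~ f
    outside⇒right {f} e with two-sides f
    ... | inj₂ p = p

    left⇒inside : ∀ {f} → face (he zero) ~ f → inside f ≡ true
    left⇒inside {f} l with two-sides f
    ... | inj₁ p = refl
    ... | inj₂ r = ⊥-elim (not-both l r)

    right⇒outside : ∀ {f} → face (α (he zero)) ~ f → inside f ≡ false
    right⇒outside {f} r with two-sides f
    ... | inj₁ l = ⊥-elim (not-both l r)
    ... | inj₂ p = refl

  inside-~ : ∀ {f g} → f ~ g → inside f ≡ inside g
  inside-~ {f} p with bool-cases (inside f)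
  ... | inj₁ y = trans y (sym (left⇒inside (~-trans (inside⇒left y) p)))
  ... | inj₂ y = trans y (sym (right⇒outside (~-trans (outside⇒right y) p)))

  inside-left : ∀ i → inside (face (he i)) ≡ true
  inside-left i = left⇒inside (left i)

  inside-right : ∀ i → inside (face (α (he i))) ≡ false
  inside-right i = right⇒outside (right i)

  inside-off : ∀ {h} → ¬ OnCycle h → inside (face h) ≡ inside (face (α h))
  inside-off {h} off = inside-~ (~-across h off)

  same-side⇒~ : ∀ {f g} → inside f ≡ inside g → f ~ g
  same-side⇒~ {f} {g} e with bool-cases (inside f)
  ... | inj₁ y = ~-trans (~-sym (inside⇒left y)) (inside⇒left (trans (sym e) y))
  ... | inj₂ y = ~-trans (~-sym (outside⇒right y)) (outside⇒right (trans (sym e) y))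

  separating⇒sides-differ : Separating M C → inside inner ≡ not (inside outer)
  separating⇒sides-differ sep with inside inner in ei | inside outer in eo
  ... | true | true = ⊥-elim (sep (same-side⇒~ (trans eo (sym ei))))
  ... | true | false = refl
  ... | false | true = refl
  ... | false | false = ⊥-elim (sep (same-side⇒~ (trans eo (sym ei))))

  boundary-left : ∀ {h} → inside (face h) ≡ true → inside (face (α h)) ≡ false → ∃[ i ] he i ≡ h
  boundary-left {h} y z with onCycle? h
  ... | yes (i , inj₁ e) = i , e
  ... | yes (i , inj₂ e) = ⊥-elim (true≢false (trans (cong (inside ∘ face) (sym e)) (inside-left i)) z)
  ... | no off = ⊥-elim (true≢false (trans (sym (inside-off off)) y) z)

-- Euler's relation for the disc on the left of a cycle

module Disc (M : AnnularMap) (C : SimpleCycle M) where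
  open Map M
  open Cycle M C

  opaque
    vertexOn? : ∀ v → Dec (∃[ i ] vert (he i) ≡ v)
    vertexOn? v = Fin.any? (λ i → vert (he i) ≟ v)

    vertexOn-count : ∀ v → ⟦ does (vertexOn? v) ⟧ ≡ ∑ (λ i → δ (vert (he i)) v)
    vertexOn-count = any-count (vert ∘ he) vert-distinct

  off : Fin n → Bool
  off h = not (does (onCycle? h))

  off-true : ∀ {h} → off h ≡ true → ¬ OnCycle h
  off-true {h} e with onCycle? h
  ... | no no′ = no′

  ¬on⇒off : ∀ {h} → ¬ OnCycle h → off h ≡ true
  ¬on⇒off {h} n′ = cong not (dec-false (onCycle? h) n′)

  on⇒¬off : ∀ {h} → OnCycle h → off h ≡ false
  on⇒¬off {h} o = cong not (dec-true (onCycle? h) o)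

  off-α : ∀ h → off (α h) ≡ off h
  off-α h with onCycle? h
  ... | yes o = on⇒¬off (OnCycle-α o)
  ... | no n′ = ¬on⇒off (λ o → n′ (OnCycle-α⁻ o))

  -- κ and ν below are the indicators of the edges and of the vertices strictly inside.
  κ : Fin n → ℤ
  κ h = ⟦ off h ⟧ * ⟦ inside (face h) ⟧

  κ-α : ∀ h → κ (α h) ≡ κ h
  κ-α h with bool-cases (off h)
  ... | inj₁ y = cong₂ (λ a b → ⟦ a ⟧ * ⟦ b ⟧) (off-α h) (sym (inside-off (off-true y)))
  ... | inj₂ z = trans (cong (λ a → ⟦ a ⟧ * ⟦ inside (face (α h)) ⟧) (trans (off-α h) z)) (sym (cong (λ a → ⟦ a ⟧ * ⟦ inside (face h) ⟧) z))

  κ-on : ∀ {h} → OnCycle h → κ h ≡ 0ℤ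
  κ-on {h} o = cong (λ a → ⟦ a ⟧ * ⟦ inside (face h) ⟧) (on⇒¬off o)

  κ-off : ∀ {h} → ¬ OnCycle h → κ h ≡ ⟦ inside (face h) ⟧
  κ-off {h} n′ = trans (cong (λ a → ⟦ a ⟧ * ⟦ inside (face h) ⟧) (¬on⇒off n′)) (ℤ.*-identityˡ _)

  ν : Fin V → ℤ
  ν v = ⟦ not (does (vertexOn? v)) ⟧ * ⟦ inside (face (proj₁ (vert-surj v))) ⟧

  ν-on : ∀ {v} → ∃[ i ] vert (he i) ≡ v → ν v ≡ 0ℤ
  ν-on {v} o = cong (λ a → ⟦ not a ⟧ * ⟦ inside (face (proj₁ (vert-surj v))) ⟧) (dec-true (vertexOn? v) o)

  corners-agree : ∀ h k → vert h ≡ vert k → ¬ (∃[ i ] vert (he i) ≡ vert h) → inside (face h) ≡ inside (face k)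
  corners-agree h k vk n′ = proj₁ (around-vertex Q turn vk (refl , refl))
    where
    Q : Fin n → Set
    Q y = inside (face h) ≡ inside (face y) × vert y ≡ vert h
    turn : ∀ y → Q y → Q (σ y)
    turn y (e , vy) = trans e (trans (cong inside (sym (face-ασ y))) (sym (inside-off off′))) , trans (vert-σ y) vy
      where
      off′ : ¬ OnCycle (σ y)
      off′ o with on-vertex o
      ... | i , e = n′ (i , trans e (trans (vert-σ y) vy))

  ν-off : ∀ h → ¬ (∃[ i ] vert (he i) ≡ vert h) → ν (vert h) ≡ ⟦ inside (face h) ⟧
  ν-off h n′ = trans (cong (λ a → ⟦ not a ⟧ * ⟦ inside (face (proj₁ (vert-surj (vert h)))) ⟧) (dec-false (vertexOn? (vert h)) n′))
    (trans (ℤ.*-identityˡ _) (cong ⟦_⟧ (sym (corners-agree h (proj₁ (vert-surj (vert h))) (sym (proj₂ (vert-surj (vert h)))) n′))))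

  c : Fin n → ℤ
  c h = # h + # (α h)

  c-on : ∀ {h} → OnCycle h → c h ≡ 1ℤ
  c-on (i , inj₁ refl) = cong₂ _+_ (#-he i) (#-αhe i)
  c-on {h} (i , inj₂ e) = cong₂ _+_ (trans (cong # (trans (sym (αα h)) (cong α (sym e)))) (#-αhe i)) (trans (cong # (sym e)) (#-he i))

  c-off : ∀ {h} → ¬ OnCycle h → c h ≡ 0ℤ
  c-off n′ = cong₂ _+_ (#-off n′) (#-off (λ o → n′ (OnCycle-α⁻ o)))

  ∑-#₁ : ∑ # ≡ + len
  ∑-#₁ = trans (∑-cong (λ h → sym (ℤ.*-identityʳ (# h)))) (trans (∑-# (λ _ → 1ℤ)) (∑-ones len))

  opaque
    -- The dual forest grows from the two faces at the first edge, the primal forest from all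
    -- vertices of the cycle, both off the cycle. An edge off the cycle lies on the same side as the
    -- face or vertex that it adds. So the edges strictly inside match the inside faces but one, the
    -- root, together with the vertices strictly inside; `κ` counts each edge twice.
    disc-euler : ∑ κ ≡ + 2 * (∑ (λ f → ⟦ inside f ⟧) + ∑ ν - 1ℤ)
    disc-euler with Dual.spanning (λ f → does (face (he zero) ≟ f) ∨ does (face (α (he zero)) ≟ f)) off
    ... | S₁ , T* , t* , closed* with Primal.spanning (λ v → does (vertexOn? v)) (λ h → off h ∧ does (Dual.μ T* h ℤ.≟ 0ℤ))
    ...   | S , T , t , closed = result
      where
      open Dual using () renaming (μ to μ*)
      open Primal using (μ)
      fL fR : Fin F
      fL = face (he zero)
      fR = face (α (he zero))
      fL≢fR : fL ≢ fR
      fL≢fR e = true≢false (trans (cong inside (sym e)) (inside-left zero)) (inside-right zero)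
      ~-closed : ∀ {f g} → f ~ g → S₁ f ≡ true → S₁ g ≡ true
      ~-closed DualReach.here s = s
      ~-closed (DualReach.step {h} p n′) s = closed* h (¬on⇒off n′) (~-closed p s)
      all₁ : ∀ f → S₁ f ≡ true
      all₁ f with two-sides f
      ... | inj₁ p = ~-closed p (Dual.roots⊆ t* (cong (_∨ does (fR ≟ fL)) (dec-true (fL ≟ fL) refl)))
      ... | inj₂ p = ~-closed p (Dual.roots⊆ t* (trans (cong (does (fL ≟ fR) ∨_) (dec-true (fR ≟ fR) refl)) (Bool.∨-zeroʳ (does (fL ≟ fR)))))
      closed′ : Primal.Closed (λ h → does (μ* T* h ℤ.≟ 0ℤ)) S
      closed′ h z s with bool-cases (off h)
      ... | inj₁ y = closed h (trans (cong (_∧ does (μ* T* h ℤ.≟ 0ℤ)) y) z) s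
      ... | inj₂ y with onCycle? h
      ...   | yes o = Primal.roots⊆ t (dec-true (vertexOn? (vert (α h))) (on-vertex (OnCycle-α o)))
      all : ∀ v → S v ≡ true
      all = complementary-spanning {S = S} t* closed′ (vert (he zero)) (Primal.roots⊆ t (dec-true (vertexOn? (vert (he zero))) (zero , refl)))
      ok-sym : ∀ h → (off (α h) ∧ does (μ* T* (α h) ℤ.≟ 0ℤ)) ≡ (off h ∧ does (μ* T* h ℤ.≟ 0ℤ))
      ok-sym h = cong₂ (λ a z → a ∧ does (z ℤ.≟ 0ℤ)) (off-α h) (Dual.μ-sym T* h)
      dichotomy : ∀ h → 0ℤ ≤ 1ℤ - (μ* T* h + μ T h + c h)
      dichotomy h with onCycle? h
      ... | yes o rewrite Dual.μ-ok off-α t* {h} (on⇒¬off o) | Primal.μ-ok ok-sym t {h} (cong (_∧ does (μ* T* h ℤ.≟ 0ℤ)) (on⇒¬off o)) | c-on o = ℤ.≤-refl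
      ... | no n′ rewrite c-off n′ with Dual.μ-01 t* h
      ...   | inj₁ z with Primal.μ-01 t h
      ...     | inj₁ z' rewrite z | z' = 0≤1
      ...     | inj₂ z' rewrite z | z' = ℤ.≤-refl
      dichotomy h | no n′ | inj₂ o rewrite o | Primal.μ-ok ok-sym t {h} (trans (cong (λ z → off h ∧ does (z ℤ.≟ 0ℤ)) o) (Bool.∧-zeroʳ (off h))) = ℤ.≤-refl
      all-count : ∀ {N} (S : Fin N → Bool) (g : Fin N → ℤ) → (∀ v → S v ≡ true) → ∑ (λ v → ⟦ S v ⟧ * g v) ≡ ∑ g
      all-count S g al = ∑-cong (λ v → trans (cong (λ b → ⟦ b ⟧ * g v) (al v)) (ℤ.*-identityˡ (g v)))
      root-δ : ∀ f → ⟦ does (fL ≟ f) ∨ does (fR ≟ f) ⟧ ≡ δ fL f + δ fR f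
      root-δ f with fL ≟ f | fR ≟ f
      ... | yes p | yes q = ⊥-elim (fL≢fR (trans p (sym q)))
      ... | yes _ | no _ = refl
      ... | no _ | yes _ = refl
      ... | no _ | no _ = refl
      roots* : (g : Fin F → ℤ) → ∑ (λ f → ⟦ does (fL ≟ f) ∨ does (fR ≟ f) ⟧ * g f) ≡ g fL + g fR
      roots* g = trans (∑-cong (λ f → trans (cong (_* g f) (root-δ f)) (ℤ.*-distribʳ-+ (g f) (δ fL f) (δ fR f))))
        (trans (∑-+ (λ f → δ fL f * g f) (λ f → δ fR f * g f)) (cong₂ _+_ (∑-δ fL g) (∑-δ fR g)))
      roots*₁ : ∑ (λ f → ⟦ does (fL ≟ f) ∨ does (fR ≟ f) ⟧) ≡ + 2
      roots*₁ = trans (∑-cong root-δ) (trans (∑-+ (δ fL) (δ fR)) (cong₂ _+_ (∑-δ₁ fL) (∑-δ₁ fR)))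
      roots₁ : ∑ (λ v → ⟦ does (vertexOn? v) ⟧) ≡ + len
      roots₁ = trans (∑-cong vertexOn-count)
        (trans (∑-swap (λ v i → δ (vert (he i)) v)) (trans (∑-cong (λ i → ∑-δ₁ (vert (he i)))) (∑-ones len)))
      ∑c : ∑ c ≡ + len + + len
      ∑c = trans (∑-+ # (# ∘ α)) (cong₂ _+_ ∑-#₁ (trans (∑-α #) ∑-#₁))
      -- `F - 2` dual edges, `V - len` primal edges and `len` edges of the cycle make `F + V - 2`,
      -- the number of all edges.
      total : ∑ (λ h → 1ℤ - (μ* T* h + μ T h + c h)) ≡ 0ℤ
      total = trans (∑-- (λ _ → 1ℤ) (λ h → μ* T* h + μ T h + c h))
        (trans (cong₂ _-_ (∑-ones n)
          (trans (∑-+ (λ h → μ* T* h + μ T h) c) (cong₂ _+_ (trans (∑-+ (μ* T*) (μ T)) (cong₂ _+_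
             (trans (Dual.tree-count t*) (cong (_*_ (+ 2)) (cong₂ _-_ (∑-all S₁ all₁) roots*₁)))
             (trans (Primal.tree-count t) (cong (_*_ (+ 2)) (cong₂ _-_ (∑-all S all) roots₁))))) ∑c)))
        (eq₁ (sym euler-ℤ) (lem (+ n) (+ F) (+ V) (+ len))))
        where
        lem : ∀ n f v l → n - (+ 2 * (f - + 2) + + 2 * (v - l) + (l + l)) - 0ℤ ≡ n + + 4 - + 2 * (v + f)
        lem = solve-∀
      covered : ∀ h → 1ℤ - (μ* T* h + μ T h + c h) ≡ 0ℤ
      covered = ∑-nonneg-zero dichotomy total
      split : ∀ h → κ h ≡ μ* T* h * κ h + μ T h * κ h
      split h = by-cases (onCycle? h)
        where
        lem₀ : ∀ a b → 0ℤ ≡ a * 0ℤ + b * 0ℤ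
        lem₀ = solve-∀
        lem : ∀ k a b c → k - (a * k + b * k) ≡ ((1ℤ - (a + b + c)) * k - 0ℤ * k) + (c * k - 0ℤ * k)
        lem = solve-∀
        by-cases : Dec (OnCycle h) → κ h ≡ μ* T* h * κ h + μ T h * κ h
        by-cases (yes o) = subst (λ k → k ≡ μ* T* h * k + μ T h * k) (sym (κ-on o)) (lem₀ (μ* T* h) (μ T h))
        by-cases (no n′) = eq₂ (cong (_* κ h) (covered h)) (cong (_* κ h) (c-off n′)) (lem (κ h) (μ* T* h) (μ T h) (c h))
      ∧-left : ∀ {a b} → a ∧ b ≡ true → a ≡ true
      ∧-left {true} _ = refl
      not-on : ∀ {v} → does (vertexOn? v) ≡ false → ¬ (∃[ i ] vert (he i) ≡ v)
      not-on {v} e with vertexOn? v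
      ... | no n′ = n′
      part* : ∑ (λ h → μ* T* h * κ h) ≡ + 2 * (∑ (λ f → ⟦ inside f ⟧) - (1ℤ + 0ℤ))
      part* = trans (Dual.tree-sum (λ f → ⟦ inside f ⟧) κ κ-α (λ e oe _ → trans (κ-off (off-true oe)) (cong ⟦_⟧ (inside-off (off-true oe)))) t*)
        (cong (_*_ (+ 2)) (cong₂ _-_ (all-count S₁ (λ f → ⟦ inside f ⟧) all₁)
          (trans (roots* (λ f → ⟦ inside f ⟧)) (cong₂ (λ a b → ⟦ a ⟧ + ⟦ b ⟧) (inside-left zero) (inside-right zero)))))
      part : ∑ (λ h → μ T h * κ h) ≡ + 2 * (∑ ν - 0ℤ)
      part = trans (Primal.tree-sum ν κ κ-α
          (λ e oe ne → let oe′ = off-true (∧-left oe) in trans (κ-off oe′) (trans (cong ⟦_⟧ (inside-off oe′)) (sym (ν-off (α e) (not-on ne))))) t)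
        (cong (_*_ (+ 2)) (cong₂ _-_ (all-count S ν all) (∑-zero roots-ν)))
        where
        roots-ν : ∀ v → ⟦ does (vertexOn? v) ⟧ * ν v ≡ 0ℤ
        roots-ν v with vertexOn? v
        ... | yes o = refl
        ... | no _ = refl
      result : ∑ κ ≡ + 2 * (∑ (λ f → ⟦ inside f ⟧) + ∑ ν - 1ℤ)
      result = trans (∑-cong split) (trans (∑-+ (λ h → μ* T* h * κ h) (λ h → μ T h * κ h))
        (trans (cong₂ _+_ part* part) (lem (∑ (λ f → ⟦ inside f ⟧)) (∑ ν))))
        where
        lem : ∀ a b → + 2 * (a - (1ℤ + 0ℤ)) + + 2 * (b - 0ℤ) ≡ + 2 * (a + b - 1ℤ)
        lem = solve-∀

-- Reversing a cycle

opposite-inject₁ : ∀ {m} (i : Fin m) → Fin.opposite (inject₁ i) ≡ suc (Fin.opposite i)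
opposite-inject₁ zero = refl
opposite-inject₁ (suc i) = cong inject₁ (opposite-inject₁ i)

module Reverse (M : AnnularMap) (C : SimpleCycle M) where
  open Map M
  open Cycle M C

  rev : SimpleCycle M
  rev = record
    { m = m
    ; he = λ i → α (he (Fin.opposite i))
    ; consec = λ i → trans (cong vert (αα _)) (trans (cong (vert ∘ he) (opposite-inject₁ i)) (sym (consec (Fin.opposite i))))
    ; close = trans (cong vert (αα _)) (trans (cong (vert ∘ he) opposite-last) (sym close))
    ; vert-distinct = λ i j e → opposite-injective (prev-injective (vert-distinct _ _ (trans (sym (vert-next _)) (trans e (vert-next _)))))
    ; edge-distinct = λ i j e → opposite-injective (edge-distinct _ _ (unreverse _ _ e))
    }
    where
    opposite-last : ∀ {m} → Fin.opposite (fromℕ m) ≡ zero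
    opposite-last {zero} = refl
    opposite-last {suc m} = cong inject₁ (opposite-last {m})
    opposite-injective : ∀ {m} {i j : Fin m} → Fin.opposite i ≡ Fin.opposite j → i ≡ j
    opposite-injective {i = i} {j} e = trans (sym (Fin.opposite-involutive i)) (trans (cong Fin.opposite e) (Fin.opposite-involutive j))
    next : ∀ i → Fin (suc m)
    next i = proj₁ (prev-surjective i)
    vert-next : ∀ i → vert (α (he i)) ≡ vert (he (next i))
    vert-next i = trans (cong (vert ∘ α ∘ he) (sym (proj₂ (prev-surjective i)))) (vert-prev (next i))
    prev-injective : ∀ {i j} → next i ≡ next j → i ≡ j
    prev-injective {i} {j} e = trans (sym (proj₂ (prev-surjective i))) (trans (cong prev e) (proj₂ (prev-surjective j)))
    unreverse : ∀ i j → α (he i) ≡ α (he j) ⊎ α (he i) ≡ α (α (he j)) → he i ≡ he j ⊎ he i ≡ α (he j)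
    unreverse i j (inj₁ e) = inj₁ (α-injective e)
    unreverse i j (inj₂ e) = inj₂ (α-injective e)

  open Cycle M rev using () renaming (OnCycle to OnRev; _~_ to _~ʳ_; ~-trans to ~ʳ-trans; right to rightʳ; inside to insideʳ; right⇒outside to right⇒outsideʳ)

  OnRev⇒On : ∀ {h} → OnRev h → OnCycle h
  OnRev⇒On {h} (i , inj₁ e) = Fin.opposite i , inj₂ (trans (sym (αα _)) (cong α e))
  OnRev⇒On {h} (i , inj₂ e) = Fin.opposite i , inj₁ (α-injective e)

  On⇒OnRev : ∀ {h} → OnCycle h → OnRev h
  On⇒OnRev {h} (i , inj₁ e) = Fin.opposite i , inj₂ (cong α (trans (cong he (Fin.opposite-involutive i)) e))
  On⇒OnRev {h} (i , inj₂ e) = Fin.opposite i , inj₁ (trans (cong α (trans (cong he (Fin.opposite-involutive i)) e)) (αα h))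

  ~⇒~ʳ : ∀ {f g} → f ~ g → f ~ʳ g
  ~⇒~ʳ DualReach.here = DualReach.here
  ~⇒~ʳ (DualReach.step p off) = DualReach.step (~⇒~ʳ p) (λ o → off (OnRev⇒On o))

  ~ʳ⇒~ : ∀ {f g} → f ~ʳ g → f ~ g
  ~ʳ⇒~ DualReach.here = DualReach.here
  ~ʳ⇒~ (DualReach.step p off) = DualReach.step (~ʳ⇒~ p) (λ o → off (On⇒OnRev o))

  -- Reversal keeps the edges of the cycle, hence `DualReach`, and exchanges left and right. It
  -- reduces the girth conditions to cycles that have the outer face on their right.
  inside⇒outside-rev : ∀ {f} → inside f ≡ true → insideʳ f ≡ false
  inside⇒outside-rev {f} y = right⇒outsideʳ (subst (_~ʳ f) (cong face (sym (αα (he (fromℕ m)))))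
    (~⇒~ʳ (~-trans (~-sym (left (fromℕ m))) (inside⇒left y))))

-- Flows

module Flows (M : AnnularMap) (d p : ℕ) where
  open Map M public

  D P : ℤ
  D = + d
  P = + p

  -- The outer face is given charge 2p and the outer vertices and edges are
  -- treated like the inner ones: the outer cycle then behaves as if each of its
  -- edges had weights (-2, d), and every vertex, edge and non-root face has
  -- the same charge.
  supply : Fin F → ℤ
  supply f = + faceDeg M f - D + δ inner f * (D - P) + δ outer f * (D + P)

  private
    supply-δ : ∀ f {a b} → δ inner f ≡ a → δ outer f ≡ b →
      supply f ≡ + faceDeg M f - D + a * (D - P) + b * (D + P)
    supply-δ f = cong₂ (λ a b → + faceDeg M f - D + a * (D - P) + b * (D + P))

  supply-outer : supply outer ≡ + faceDeg M outer + P
  supply-outer = trans (supply-δ outer (δ-no inner≢outer) (δ-refl outer)) (lem (+ faceDeg M outer) D P)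
    where
    lem : ∀ g d p → g - d + 0ℤ * (d - p) + 1ℤ * (d + p) ≡ g + p
    lem = solve-∀

  supply-inner : supply inner ≡ + faceDeg M inner - P
  supply-inner = trans (supply-δ inner (δ-refl inner) (δ-no (inner≢outer ∘ sym))) (lem (+ faceDeg M inner) D P)
    where
    lem : ∀ g d p → g - d + 1ℤ * (d - p) + 0ℤ * (d + p) ≡ g - p
    lem = solve-∀

  supply-other : ∀ {f} → f ≢ outer → f ≢ inner → supply f ≡ + faceDeg M f - D
  supply-other {f} no′ ni = trans (supply-δ f (δ-no (ni ∘ sym)) (δ-no (no′ ∘ sym))) (lem (+ faceDeg M f) D P)
    where
    lem : ∀ g d p → g - d + 0ℤ * (d - p) + 0ℤ * (d + p) ≡ g - d
    lem = solve-∀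

  -- No sign is imposed, and `pos h` and `x h` may both be non-zero: only the linear laws are kept,
  -- so that potentials act freely. Signs and complementarity are obtained afterwards.
  record Flow : Set where
    field
      pos x : Fin n → ℤ
      at-vertex : ∀ v → ∑ (λ h → δ (vert h) v * pos h) ≡ D
      at-edge   : ∀ h → pos h + pos (α h) ≡ D - + 2 + (x h + x (α h))
      at-face   : ∀ f → ∑ (λ h → δ (face (α h)) f * x h) ≡ supply f

  degree : ∀ f → + faceDeg M f ≡ ∑ (λ h → δ (face h) f)
  degree f = length-filter id (λ h → does (face h ≟ f))

  module EdgeSum (φ₀ : Flow) (κ : Fin n → ℤ) (κ-α : ∀ h → κ (α h) ≡ κ h) where
    open Flow φ₀

    private
      symmetrize : (y : Fin n → ℤ) → ∑ (λ h → κ h * (y h + y (α h))) ≡ + 2 * ∑ (λ h → κ h * y h)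
      symmetrize y = trans (∑-cong (λ h → ℤ.*-distribˡ-+ (κ h) (y h) (y (α h))))
        (trans (∑-+ (λ h → κ h * y h) (λ h → κ h * y (α h)))
          (trans (cong (_+_ (∑ (λ h → κ h * y h))) (trans (∑-cong (λ h → cong (_* y (α h)) (sym (κ-α h)))) (∑-α (λ h → κ h * y h))))
            (double (∑ (λ h → κ h * y h)))))

    edge-sum : + 2 * ∑ (λ h → κ h * pos h) ≡ (D - + 2) * ∑ κ + + 2 * ∑ (λ h → κ h * x h)
    edge-sum = trans (sym (symmetrize pos)) (trans (∑-cong (λ h → trans (cong (_*_ (κ h)) (at-edge h)) (lem (κ h) (D - + 2) (x h + x (α h)))))
      (trans (∑-+ (λ h → (D - + 2) * κ h) (λ h → κ h * (x h + x (α h)))) (cong₂ _+_ (sym (∑-*ˡ (D - + 2) κ)) (symmetrize x))))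
      where
      lem : ∀ k a b → k * (a + b) ≡ a * k + k * b
      lem = solve-∀

  module Cost (φ₀ : Flow) (C : SimpleCycle M) where
    open Flow φ₀
    open Cycle M C
    open Disc M C

    on : Fin V → ℤ
    on v = ⟦ does (vertexOn? v) ⟧

    -- The curve crosses the half-edges that leave the cycle to the left, at price `pos`, and passes
    -- beside each `he i`, whose left face is the right face of `α (he i)`.
    cost : ℤ
    cost = ∑ (λ h → κ h * on (vert h) * pos h) + ∑ (λ i → x (α (he i)))

    private
      K I N corr Kpos Kx X : ℤ
      K = ∑ κ
      I = ∑ (λ f → ⟦ inside f ⟧)
      N = ∑ ν
      corr = ⟦ inside inner ⟧ * (D - P) + ⟦ inside outer ⟧ * (D + P)
      Kpos = ∑ (λ h → κ h * pos h)
      Kx = ∑ (λ h → κ h * x h)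
      X = ∑ (λ i → x (α (he i)))

      vertex-split : ∀ h → κ h ≡ κ h * on (vert h) + ν (vert h)
      vertex-split h = by-cases (vertexOn? (vert h))
        where
        lem : ∀ k → k ≡ k * 1ℤ + 0ℤ
        lem = solve-∀
        lem′ : ∀ k → k ≡ k * 0ℤ + k
        lem′ = solve-∀
        by-cases : Dec (∃[ i ] vert (he i) ≡ vert h) → κ h ≡ κ h * on (vert h) + ν (vert h)
        by-cases (yes o) = trans (lem (κ h)) (sym (cong₂ (λ a b → κ h * ⟦ a ⟧ + b) (dec-true (vertexOn? (vert h)) o) (ν-on o)))
        by-cases (no n′) = trans (lem′ (κ h)) (sym (cong₂ (λ a b → κ h * ⟦ a ⟧ + b) (dec-false (vertexOn? (vert h)) n′)
          (trans (ν-off h n′) (sym (κ-off (λ o → n′ (on-vertex o)))))))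

      edge-split : ∀ h → ⟦ inside (face (α h)) ⟧ ≡ κ h + # (α h)
      edge-split h = by-cases (onCycle? h)
        where
        by-cases : Dec (OnCycle h) → ⟦ inside (face (α h)) ⟧ ≡ κ h + # (α h)
        by-cases (yes (i , inj₁ refl)) = trans (cong ⟦_⟧ (inside-right i)) (sym (cong₂ _+_ (κ-on (i , inj₁ refl)) (#-αhe i)))
        by-cases (yes (i , inj₂ e)) = trans (cong ⟦_⟧ (trans (cong (inside ∘ face) (sym e)) (inside-left i)))
          (sym (cong₂ _+_ (κ-on {h} (i , inj₂ e)) (trans (cong # (sym e)) (#-he i))))
        by-cases (no n′) = trans (cong ⟦_⟧ (sym (inside-off n′)))
          (trans (sym (trans (ℤ.+-identityʳ (κ h)) (κ-off n′))) (cong (_+_ (κ h)) (sym (#-off (λ o → n′ (OnCycle-α⁻ o))))))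

      vertices : Kpos ≡ ∑ (λ h → κ h * on (vert h) * pos h) + N * D
      vertices = trans (∑-cong (λ h → trans (cong (_* pos h) (vertex-split h)) (ℤ.*-distribʳ-+ (pos h) (κ h * on (vert h)) (ν (vert h)))))
        (trans (∑-+ (λ h → κ h * on (vert h) * pos h) (λ h → ν (vert h) * pos h))
          (cong (_+_ (∑ (λ h → κ h * on (vert h) * pos h))) (trans (sym (∑-fibre vert ν pos))
            (trans (∑-cong (λ v → cong (_*_ (ν v)) (at-vertex v))) (∑-*ʳ D ν)))))

      faces : Kx + X ≡ ∑ (λ f → ⟦ inside f ⟧ * supply f)
      faces = sym (trans (∑-cong (λ f → cong (_*_ ⟦ inside f ⟧) (sym (at-face f))))
        (trans (∑-fibre (face ∘ α) (λ f → ⟦ inside f ⟧) x)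
          (trans (∑-cong (λ h → trans (cong (_* x h) (edge-split h)) (ℤ.*-distribʳ-+ (x h) (κ h) (# (α h)))))
            (trans (∑-+ (λ h → κ h * x h) (λ h → # (α h) * x h))
              (cong (_+_ Kx) (trans (∑-cong (λ h → cong (λ k → # (α h) * x k) (sym (αα h))))
                (trans (∑-α (λ h → # h * x (α h))) (∑-# (x ∘ α)))))))))

      degrees : ∑ (λ f → ⟦ inside f ⟧ * + faceDeg M f) ≡ K + + len
      degrees = trans (∑-cong (λ f → cong (_*_ ⟦ inside f ⟧) (trans (degree f) (∑-cong (λ h → sym (ℤ.*-identityʳ (δ (face h) f)))))))
        (trans (∑-fibre face (λ f → ⟦ inside f ⟧) (λ _ → 1ℤ))
          (trans (∑-cong (λ h → ℤ.*-identityʳ _)) (trans (sym (∑-α (λ h → ⟦ inside (face h) ⟧)))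
            (trans (∑-cong edge-split) (trans (∑-+ κ (# ∘ α)) (cong (_+_ K) (trans (∑-α #) ∑-#₁)))))))

      supplies : ∑ (λ f → ⟦ inside f ⟧ * supply f) ≡ (K + + len) - I * D + corr
      supplies = trans (∑-cong (λ f → lem ⟦ inside f ⟧ (+ faceDeg M f) D (δ inner f) (D - P) (δ outer f) (D + P)))
        (trans (∑-+ (λ f → a f - b f) (λ f → c₁ f + c₂ f)) (cong₂ _+_
          (trans (∑-- a b) (cong₂ _-_ degrees (∑-*ʳ D (λ f → ⟦ inside f ⟧))))
          (trans (∑-+ c₁ c₂) (cong₂ _+_ (∑-δ inner (λ f → ⟦ inside f ⟧ * (D - P))) (∑-δ outer (λ f → ⟦ inside f ⟧ * (D + P)))))))
        where
        a b c₁ c₂ : Fin F → ℤ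
        a f = ⟦ inside f ⟧ * + faceDeg M f
        b f = ⟦ inside f ⟧ * D
        c₁ f = δ inner f * (⟦ inside f ⟧ * (D - P))
        c₂ f = δ outer f * (⟦ inside f ⟧ * (D + P))
        lem : ∀ i g d u s v t → i * (g - d + u * s + v * t) ≡ (i * g - i * d) + (u * (i * s) + v * (i * t))
        lem = solve-∀

    opaque
      -- The laws for vertices, edges and faces are added up over the disc. The interior sums `Kpos`
      -- and `Kx` cancel, and Euler's relation reduces the numbers of interior cells to a single
      -- `D`. Everything is doubled because `κ` counts both darts of an edge.
      cost-formula : cost ≡ + len - D + (⟦ inside inner ⟧ * (D - P) + ⟦ inside outer ⟧ * (D + P))
      cost-formula = ℤ.*-cancelˡ-≡ (+ 2) cost (+ len - D + corr)
        (eq₃ (cong (_*_ (- + 2)) vertices) (EdgeSum.edge-sum φ₀ κ κ-α)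
          (cong₂ (λ u v → + 2 * u + D * v) (trans faces supplies) disc-euler)
          (lem (∑ (λ h → κ h * on (vert h) * pos h)) X Kpos Kx K N I D corr (+ len)))
        where
        lem : ∀ A X Kp Kx K N I d c l →
          + 2 * (A + X) - + 2 * (l - d + c) ≡
          (- + 2 * Kp - - + 2 * (A + N * d)) + (+ 2 * Kp - ((d - + 2) * K + + 2 * Kx)) +
          ((+ 2 * (Kx + X) + d * K) - (+ 2 * ((K + l) - I * d + c) + d * (+ 2 * (I + N - 1ℤ))))
        lem = solve-∀

    cost-at : ∀ {a b} → inside inner ≡ a → inside outer ≡ b →
      cost ≡ + len - D + (⟦ a ⟧ * (D - P) + ⟦ b ⟧ * (D + P))
    cost-at ei eo = trans cost-formula (cong₂ (λ a b → + len - D + (⟦ a ⟧ * (D - P) + ⟦ b ⟧ * (D + P))) ei eo)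

    cost-neither : inside inner ≡ false → inside outer ≡ false → cost ≡ + len - D
    cost-neither ei eo = trans (cost-at ei eo) (lem (+ len) D P)
      where
      lem : ∀ l d p → l - d + (0ℤ * (d - p) + 0ℤ * (d + p)) ≡ l - d
      lem = solve-∀

    cost-inner : inside inner ≡ true → inside outer ≡ false → cost ≡ + len - P
    cost-inner ei eo = trans (cost-at ei eo) (lem (+ len) D P)
      where
      lem : ∀ l d p → l - d + (1ℤ * (d - p) + 0ℤ * (d + p)) ≡ l - p
      lem = solve-∀

    cost-nonneg : (∀ h → 0ℤ ≤ pos h) → (∀ h → 0ℤ ≤ x h) → 0ℤ ≤ cost
    cost-nonneg pos≥0 x≥0 = 0≤-+ (∑-nonneg (λ h → 0≤-* (0≤-* (0≤-* (0≤⟦⟧ (off h)) (0≤⟦⟧ _)) (0≤⟦⟧ _)) (pos≥0 h))) (∑-nonneg (λ i → x≥0 _))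

-- Loops in walks

Repeats : ∀ {N} → ℕ → (ℕ → Fin N) → Set
Repeats t f = ∃[ i ] ∃[ m ] (i ℕ.+ m ℕ.≤ t × f (i ℕ.+ suc m) ≡ f i ×
  (∀ a b → a ℕ.< b → b ℕ.≤ m → f (i ℕ.+ a) ≢ f (i ℕ.+ b)))

opaque
  -- Either the values at `0` to `t` are distinct, or a coincidence among them bounds a shorter
  -- closed stretch. In `Repeats` the loop occupies the indices `i` to `i + m` and closes at
  -- `i + suc m`.
  first-repeat : ∀ {N} t (f : ℕ → Fin N) → f (suc t) ≡ f 0 → Repeats t f
  first-repeat {N} = <-rec (λ t → ∀ f → f (suc t) ≡ f 0 → Repeats t f) body
    where
    body : ∀ t → (∀ {t'} → t' ℕ.< t → ∀ f → f (suc t') ≡ f 0 → Repeats {N} t' f) → ∀ f → f (suc t) ≡ f 0 → Repeats {N} t f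
    body t rec f e with Fin.any? (λ (b : Fin (suc t)) → Fin.any? (λ (a : Fin (suc t)) → (toℕ a ℕ.<? toℕ b) ×-dec (f (toℕ a) ≟ f (toℕ b))))
    ... | no none = 0 , t , ℕ.≤-refl , e , λ a b a<b b≤t fa≡fb → none
      (Fin.fromℕ< (ℕ.s≤s b≤t) , Fin.fromℕ< (ℕ.s≤s (ℕ.≤-trans (ℕ.<⇒≤ a<b) b≤t)) ,
       subst₂ ℕ._<_ (sym (Fin.toℕ-fromℕ< _)) (sym (Fin.toℕ-fromℕ< _)) a<b ,
       trans (cong f (Fin.toℕ-fromℕ< _)) (trans fa≡fb (cong f (sym (Fin.toℕ-fromℕ< _)))))
    ... | yes (b , a , a<b , fa≡fb) with ℕ.m≤n⇒∃[o]m+o≡n a<b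
    ...   | m' , eq with rec {m'} m'<t (λ k → f (toℕ a ℕ.+ k)) (trans (cong f (trans (ℕ.+-suc (toℕ a) m') eq)) (trans (sym fa≡fb) (cong f (sym (ℕ.+-identityʳ (toℕ a))))))
      where
      b≤t : toℕ b ℕ.≤ t
      b≤t = ℕ.s≤s⁻¹ (Fin.toℕ<n b)
      m'<t : m' ℕ.< t
      m'<t = ℕ.≤-trans (ℕ.s≤s (ℕ.m≤n+m m' (toℕ a))) (ℕ.≤-trans (ℕ.≤-reflexive eq) b≤t)
    ...     | i , m , i+m≤ , rep , dist = toℕ a ℕ.+ i , m ,
      ℕ.≤-trans (ℕ.≤-reflexive (ℕ.+-assoc (toℕ a) i m)) (ℕ.≤-trans (ℕ.+-monoʳ-≤ (toℕ a) i+m≤)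
        (ℕ.≤-trans (ℕ.n≤1+n _) (ℕ.≤-trans (ℕ.≤-reflexive eq) (ℕ.s≤s⁻¹ (Fin.toℕ<n b))))) ,
      trans (cong f (ℕ.+-assoc (toℕ a) i (suc m))) rep ,
      λ k l k<l l≤m e' → dist k l k<l l≤m (trans (cong f (sym (ℕ.+-assoc (toℕ a) i k))) (trans e' (cong f (ℕ.+-assoc (toℕ a) i l))))

upto-injective : ∀ {N} (f : ℕ → Fin N) m → (∀ a b → a ℕ.< b → b ℕ.≤ m → f a ≢ f b) →
  ∀ a b → a ℕ.≤ m → b ℕ.≤ m → f a ≡ f b → a ≡ b
upto-injective f m distinct a b a≤m b≤m e with ℕ.<-cmp a b
... | tri< a<b _ _ = ⊥-elim (distinct a b a<b b≤m e)
... | tri≈ _ e' _ = e'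
... | tri> _ _ b<a = ⊥-elim (distinct b a b<a a≤m (sym e))

module Loops (M : AnnularMap) where
  open Map M

  module Loop (h : ℕ → Fin n) (m : ℕ)
    (walk : ∀ k → k ℕ.≤ m → vert (α (h k)) ≡ vert (h (suc k)))
    (back : vert (h (suc m)) ≡ vert (h 0))
    (distinct : ∀ a b → a ℕ.< b → b ℕ.≤ m → vert (h a) ≢ vert (h b))
    (no-backtrack : ∀ a b → a ℕ.≤ m → b ℕ.≤ m → h a ≢ α (h b)) where

    private
      bound : (i : Fin (suc m)) → toℕ i ℕ.≤ m
      bound i = ℕ.s≤s⁻¹ (Fin.toℕ<n i)

      injective : ∀ i j → vert (h (toℕ i)) ≡ vert (h (toℕ j)) → i ≡ j
      injective i j e = Fin.toℕ-injective (upto-injective (vert ∘ h) m distinct _ _ (bound i) (bound j) e)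

    loop : SimpleCycle M
    loop = record
      { m = m
      ; he = λ i → h (toℕ i)
      ; consec = λ i → trans (cong (vert ∘ α ∘ h) (Fin.toℕ-inject₁ i)) (walk (toℕ i) (ℕ.<⇒≤ (Fin.toℕ<n i)))
      ; close = trans (cong (vert ∘ α ∘ h) (Fin.toℕ-fromℕ m)) (trans (walk m ℕ.≤-refl) back)
      ; vert-distinct = injective
      ; edge-distinct = λ { i j (inj₁ e) → injective i j (cong vert e)
                          ; i j (inj₂ e) → ⊥-elim (no-backtrack _ _ (bound i) (bound j) e) }
      }

    he-at : ∀ a → a ℕ.≤ m → ∃[ i ] SimpleCycle.he loop i ≡ h a
    he-at a a≤m = Fin.fromℕ< (ℕ.s≤s a≤m) , cong h (Fin.toℕ-fromℕ< (ℕ.s≤s a≤m))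

-- The contour of the outer face as a simple cycle

module OuterContour (M : AnnularMap) (simple : OuterContourSimple M) where
  open Map M

  private
    c₀ : Fin n
    c₀ = proj₁ (face-surj outer)
    period : ∃[ K ] iter φ (suc K) c₀ ≡ c₀
    period with Equivalence.to (face-orbit (φ c₀) c₀) (face-φ c₀)
    ... | K , e = K , trans (sym (commute K)) e
      where
      commute : ∀ k → iter φ k (φ c₀) ≡ φ (iter φ k c₀)
      commute zero = refl
      commute (suc k) = cong φ (commute k)
    face-iter : ∀ k → face (iter φ k c₀) ≡ outer
    face-iter zero = proj₂ (face-surj outer)
    face-iter (suc k) = trans (face-φ _) (face-iter k)
    repeat = first-repeat (proj₁ period) (λ k → vert (iter φ k c₀)) (cong vert (proj₂ period))
    i = proj₁ repeat
    m = proj₁ (proj₂ repeat)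
    h : ℕ → Fin n
    h k = iter φ (i ℕ.+ k) c₀
    h-suc : ∀ k → h (suc k) ≡ φ (h k)
    h-suc k = cong (λ j → iter φ j c₀) (ℕ.+-suc i k)
    back : vert (h (suc m)) ≡ vert (h 0)
    back = trans (proj₁ (proj₂ (proj₂ (proj₂ repeat)))) (cong (λ j → vert (iter φ j c₀)) (sym (ℕ.+-identityʳ i)))
    walk : ∀ k → k ℕ.≤ m → vert (α (h k)) ≡ vert (h (suc k))
    walk k _ = trans (sym (vert-φ (h k))) (cong vert (sym (h-suc k)))
    no-back : ∀ a b → a ℕ.≤ m → b ℕ.≤ m → h a ≢ α (h b)
    no-back a b _ _ e = proj₂ simple (h b) (face-iter (i ℕ.+ b)) (trans (cong face (sym e)) (face-iter (i ℕ.+ a)))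
    module L = Loops.Loop M h m walk back (proj₂ (proj₂ (proj₂ (proj₂ repeat)))) no-back

  opaque
    contour : SimpleCycle M
    contour = L.loop

    contour-outer : ∀ i → face (SimpleCycle.he contour i) ≡ outer
    contour-outer j = face-iter (i ℕ.+ toℕ j)

    -- The loop was cut out of the orbit of `φ`. Stepping beyond its end leads to a dart at its
    -- first vertex, which has only one corner in the outer face; so the loop is the whole orbit.
    contour-covers : ∀ k → face k ≡ outer → ∃[ j ] SimpleCycle.he contour j ≡ k
    contour-covers k fk with around-face (λ y → ∃[ a ] (a ℕ.≤ m × h a ≡ y)) advance (trans (face-iter (i ℕ.+ 0)) (sym fk)) (0 , ℕ.z≤n , refl)
      where
      advance : ∀ y → ∃[ a ] (a ℕ.≤ m × h a ≡ y) → ∃[ a ] (a ℕ.≤ m × h a ≡ φ y)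
      advance y (a , a≤m , e) with ℕ.m≤n⇒m<n∨m≡n a≤m
      ... | inj₁ a<m = suc a , a<m , trans (h-suc a) (cong φ e)
      ... | inj₂ refl = 0 , ℕ.z≤n , trans (sym (proj₁ simple _ _ (face-iter (i ℕ.+ suc m)) (face-iter (i ℕ.+ 0)) back)) (trans (h-suc m) (cong φ e))
    ... | a , a≤m , e with L.he-at a a≤m
    ...   | j , e' = j , trans e' e

  contour-separating : Separating M contour
  contour-separating r = inner≢outer (stuck r)
    where
    stuck : ∀ {f} → DualReach M contour outer f → f ≡ outer
    stuck DualReach.here = refl
    stuck (DualReach.step {k} p off) with contour-covers k (stuck p)
    ... | j , e = ⊥-elim (off (j , inj₁ e))

  contour-length : SimpleCycle.len contour ℕ.≤ faceDeg M outer
  contour-length = ℤ.drop‿+≤+ (subst (+ SimpleCycle.len contour ≤_) (sym (Flows.degree M 0 0 outer))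
    (injection-count (SimpleCycle.he contour) (λ i j e → SimpleCycle.vert-distinct contour i j (cong vert e))
      (λ h → does (face h ≟ outer)) (λ j → dec-true (face _ ≟ outer) (contour-outer j))))

-- The flow of an orientation

posOf xOf : (onOuter acrossOuter ingoing : Bool) (D w : ℤ) → ℤ
posOf true _ _ D w = D
posOf false true _ D w = 0ℤ
posOf false false true D w = w
posOf false false false D w = 0ℤ

xOf true _ _ D w = 0ℤ
xOf false true _ D w = + 2
xOf false false true D w = 0ℤ
xOf false false false D w = - w

module EdgeKind (M : AnnularMap) where
  open Map M

  data Kind (h : Fin n) : Set where
    outerL : face h ≡ outer → face (α h) ≢ outer → Kind h
    outerR : face h ≢ outer → face (α h) ≡ outer → Kind h
    innerE : ¬ OuterHE M h → Kind h

  kindOf : (∀ h → face h ≡ outer → face (α h) ≢ outer) → ∀ h → Kind h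
  kindOf one-sided h with face h ≟ outer | face (α h) ≟ outer
  ... | yes l | _ = outerL l (one-sided h l)
  ... | no nl | yes r = outerR nl r
  ... | no nl | no nr = innerE λ { (inj₁ l) → nl l ; (inj₂ r) → nr r }

  outerHE⇒outer-vertex : ∀ {h} → OuterHE M h → OuterVertex M (vert h)
  outerHE⇒outer-vertex {h} (inj₁ l) = h , refl , l
  outerHE⇒outer-vertex {h} (inj₂ r) = σ⁻ h , vert-σ⁻ h , trans (face-σ⁻ h) r

  innerE-α : ∀ {h} → ¬ OuterHE M h → ¬ OuterHE M (α h)
  innerE-α i (inj₁ e) = i (inj₂ e)
  innerE-α {h} i (inj₂ e) = i (inj₁ (trans (cong face (sym (αα h))) e))

outerVertex? : (M : AnnularMap) → ∀ v → Dec (OuterVertex M v)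
outerVertex? M v = Fin.any? (λ h → (AnnularMap.vert M h ≟ v) ×-dec (AnnularMap.face M h ≟ AnnularMap.outer M))

module OrientationFlow (M : AnnularMap) (d p q : ℕ) (type : HasType M p q)
                       (O : ZBiorientation M) (DO : DOrientation M d p q O) where
  open Flows M d p
  open ZBiorientation O

  admissible : Admissible M O
  admissible = proj₁ DO

  contour-simple : OuterContourSimple M
  contour-simple = proj₁ admissible

  private
    inner-edge : ∀ h → ¬ OuterHE M h → edgeWeight h ≡ D - + 2
    inner-edge = proj₁ (proj₂ (proj₂ DO))
    inner-vertex : ∀ v → ¬ OuterVertex M v → vertWeight v ≡ D
    inner-vertex = proj₁ (proj₂ (proj₂ (proj₂ DO)))
    inner-faces : ∀ f → f ≢ outer → f ≢ inner → + faceDeg M f + faceWeight f ≡ D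
    inner-faces = proj₁ (proj₂ (proj₂ (proj₂ (proj₂ DO))))
    root-face : faceDeg M inner ≡ q × faceWeight inner ≡ P - + q
    root-face = proj₂ (proj₂ (proj₂ (proj₂ (proj₂ DO))))
    outer-out : ∀ h → OuterHE M h → ingoing h ≡ false → wt h ≡ 0ℤ
    outer-out = proj₁ (proj₂ (proj₂ (proj₂ admissible)))
    outer-vertex-out : ∀ h → ¬ OuterHE M h → OuterVertex M (vert h) → ingoing h ≡ false
    outer-vertex-out = proj₂ (proj₂ (proj₂ (proj₂ admissible)))

  open EdgeKind M public

  kind : ∀ h → Kind h
  kind = kindOf (proj₂ contour-simple)

  -- On the contour the orientation is forgotten: `D` goes to the half-edge with the outer face on
  -- its left and 2 to its partner, whichever way `O` directs the edge. The direction of the contour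
  -- has to be recovered separately.
  pos x : Fin n → ℤ
  pos h = posOf (does (face h ≟ outer)) (does (face (α h) ≟ outer)) (ingoing h) D (wt h)
  x h = xOf (does (face h ≟ outer)) (does (face (α h) ≟ outer)) (ingoing h) D (wt h)

  pos-outerL : ∀ {h} → face h ≡ outer → pos h ≡ D
  pos-outerL {h} l = cong (λ b → posOf b (does (face (α h) ≟ outer)) (ingoing h) D (wt h)) (dec-true (face h ≟ outer) l)

  x-outerL : ∀ {h} → face h ≡ outer → x h ≡ 0ℤ
  x-outerL {h} l = cong (λ b → xOf b (does (face (α h) ≟ outer)) (ingoing h) D (wt h)) (dec-true (face h ≟ outer) l)

  pos-outerR : ∀ {h} → face h ≢ outer → face (α h) ≡ outer → pos h ≡ 0ℤ
  pos-outerR {h} nl r = cong₂ (λ b b' → posOf b b' (ingoing h) D (wt h)) (dec-false (face h ≟ outer) nl) (dec-true (face (α h) ≟ outer) r)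

  x-outerR : ∀ {h} → face h ≢ outer → face (α h) ≡ outer → x h ≡ + 2
  x-outerR {h} nl r = cong₂ (λ b b' → xOf b b' (ingoing h) D (wt h)) (dec-false (face h ≟ outer) nl) (dec-true (face (α h) ≟ outer) r)

  private
    pos-inner : ∀ {h} → ¬ OuterHE M h → pos h ≡ posOf false false (ingoing h) D (wt h)
    pos-inner {h} i = cong₂ (λ b b' → posOf b b' (ingoing h) D (wt h)) (dec-false (face h ≟ outer) (i ∘ inj₁)) (dec-false (face (α h) ≟ outer) (i ∘ inj₂))

    x-inner : ∀ {h} → ¬ OuterHE M h → x h ≡ xOf false false (ingoing h) D (wt h)
    x-inner {h} i = cong₂ (λ b b' → xOf b b' (ingoing h) D (wt h)) (dec-false (face h ≟ outer) (i ∘ inj₁)) (dec-false (face (α h) ≟ outer) (i ∘ inj₂))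

  pos-in : ∀ {h} → ¬ OuterHE M h → ingoing h ≡ true → pos h ≡ wt h
  pos-in {h} i e = trans (pos-inner i) (cong (λ b → posOf false false b D (wt h)) e)

  pos-out : ∀ {h} → ¬ OuterHE M h → ingoing h ≡ false → pos h ≡ 0ℤ
  pos-out {h} i e = trans (pos-inner i) (cong (λ b → posOf false false b D (wt h)) e)

  x-in : ∀ {h} → ¬ OuterHE M h → ingoing h ≡ true → x h ≡ 0ℤ
  x-in {h} i e = trans (x-inner i) (cong (λ b → xOf false false b D (wt h)) e)

  x-out : ∀ {h} → ¬ OuterHE M h → ingoing h ≡ false → x h ≡ - wt h
  x-out {h} i e = trans (x-inner i) (cong (λ b → xOf false false b D (wt h)) e)

  wt-split : ∀ {h} → ¬ OuterHE M h → wt h ≡ pos h - x h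
  wt-split {h} i with bool-cases (ingoing h)
  ... | inj₁ y = sym (trans (cong₂ _-_ (pos-in i y) (x-in i y)) (ℤ.+-identityʳ (wt h)))
  ... | inj₂ z = sym (trans (cong₂ _-_ (pos-out i z) (x-out i z)) (trans (ℤ.+-identityˡ _) (ℤ.neg-involutive (wt h))))

  pos≥0 : ∀ h → 0ℤ ≤ pos h
  pos≥0 h with kind h
  ... | outerL l _ = subst (0ℤ ≤_) (sym (pos-outerL l)) (ℤ.+≤+ ℕ.z≤n)
  ... | outerR nl r = subst (0ℤ ≤_) (sym (pos-outerR nl r)) ℤ.≤-refl
  ... | innerE i with bool-cases (ingoing h)
  ...   | inj₁ y = subst (0ℤ ≤_) (sym (pos-in i y)) (ℤ.<⇒≤ (wt-in h y))
  ...   | inj₂ z = subst (0ℤ ≤_) (sym (pos-out i z)) ℤ.≤-refl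

  x≥0 : ∀ h → 0ℤ ≤ x h
  x≥0 h with kind h
  ... | outerL l _ = subst (0ℤ ≤_) (sym (x-outerL l)) ℤ.≤-refl
  ... | outerR nl r = subst (0ℤ ≤_) (sym (x-outerR nl r)) (ℤ.+≤+ ℕ.z≤n)
  ... | innerE i with bool-cases (ingoing h)
  ...   | inj₁ y = subst (0ℤ ≤_) (sym (x-in i y)) ℤ.≤-refl
  ...   | inj₂ z = subst (0ℤ ≤_) (sym (x-out i z)) (ℤ.neg-mono-≤ (wt-out h z))

  complementary : ∀ h → ¬ OuterHE M h → 0ℤ < pos h → x h ≡ 0ℤ
  complementary h i 0<p with bool-cases (ingoing h)
  ... | inj₁ y = x-in i y
  ... | inj₂ z = ⊥-elim (ℤ.<-irrefl (sym (pos-out i z)) 0<p)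

  pos>0⇒in : ∀ {h} → ¬ OuterHE M h → 0ℤ < pos h → ingoing h ≡ true
  pos>0⇒in {h} i 0<p with bool-cases (ingoing h)
  ... | inj₁ y = y
  ... | inj₂ z = ⊥-elim (ℤ.<-irrefl (sym (pos-out i z)) 0<p)

  pos-outer-vertex : ∀ {h} → face h ≢ outer → OuterVertex M (vert h) → pos h ≡ 0ℤ
  pos-outer-vertex {h} nl ov with kind h
  ... | outerL l _ = ⊥-elim (nl l)
  ... | outerR nl r = pos-outerR nl r
  ... | innerE i = pos-out i (outer-vertex-out h i ov)

  flow : Flow
  flow = record { pos = pos ; x = x ; at-vertex = at-v ; at-edge = at-e ; at-face = at-f }
    where
    at-v : ∀ v → ∑ (λ h → δ (vert h) v * pos h) ≡ D
    at-v v with outerVertex? M v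
    -- At an outer vertex the inner half-edges are outgoing, so the whole `D` comes from the only
    -- dart there with the outer face on its left.
    ... | yes (k , refl , fk) = trans (∑-cong pw) (∑-δ k (λ _ → D))
      where
      pw : ∀ h → δ (vert h) (vert k) * pos h ≡ δ k h * D
      pw h with vert h ≟ vert k | k ≟ h
      ... | yes _ | yes refl = cong (_*_ 1ℤ) (pos-outerL fk)
      ... | no ne | yes refl = ⊥-elim (ne refl)
      ... | no _ | no _ = refl
      ... | yes e | no ne = trans (ℤ.*-identityˡ (pos h)) (pos-outer-vertex (λ l → ne (proj₁ contour-simple k h fk l (sym e))) (k , sym e , fk))
    ... | no nv = trans (∑-cong pw) (trans (sym (sum-filter id (λ h → ingoing h ∧ does (vert h ≟ v)) wt)) (inner-vertex v nv))
      where
      pw : ∀ h → δ (vert h) v * pos h ≡ ⟦ ingoing h ∧ does (vert h ≟ v) ⟧ * wt h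
      pw h with vert h ≟ v
      ... | no _ = sym (cong (λ b → ⟦ b ⟧ * wt h) (Bool.∧-zeroʳ (ingoing h)))
      ... | yes refl with bool-cases (ingoing h)
      ...   | inj₁ y = trans (cong (_*_ 1ℤ) (pos-in (λ o → nv (outerHE⇒outer-vertex o)) y)) (sym (cong (λ b → ⟦ b ∧ true ⟧ * wt h) y))
      ...   | inj₂ z = trans (cong (_*_ 1ℤ) (pos-out (λ o → nv (outerHE⇒outer-vertex o)) z)) (sym (cong (λ b → ⟦ b ∧ true ⟧ * wt h) z))
    outer-pair : ∀ h → face h ≡ outer → pos h + pos (α h) ≡ D - + 2 + (x h + x (α h))
    outer-pair h l = trans (cong₂ _+_ (pos-outerL l) (pos-outerR (proj₂ contour-simple h l) r))
      (trans (lem D) (cong (_+_ (D - + 2)) (sym (cong₂ _+_ (x-outerL l) (x-outerR (proj₂ contour-simple h l) r)))))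
      where
      r : face (α (α h)) ≡ outer
      r = trans (cong face (αα h)) l
      lem : ∀ a → a + 0ℤ ≡ a - + 2 + (0ℤ + + 2)
      lem = solve-∀
    at-e : ∀ h → pos h + pos (α h) ≡ D - + 2 + (x h + x (α h))
    at-e h with kind h
    ... | outerL l _ = outer-pair h l
    ... | outerR _ r = trans (ℤ.+-comm (pos h) (pos (α h)))
      (trans (subst (λ k → pos (α h) + pos k ≡ D - + 2 + (x (α h) + x k)) (αα h) (outer-pair (α h) r)) (cong (_+_ (D - + 2)) (ℤ.+-comm (x (α h)) (x h))))
    ... | innerE i = eq₁ (inner-edge h i) (trans (lem (pos h) (pos (α h)) (x h) (x (α h)) (D - + 2)) (cong (_- (D - + 2)) (sym (cong₂ _+_ (wt-split i) (wt-split (innerE-α i))))))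
      where
      lem : ∀ a b c e k → a + b - (k + (c + e)) ≡ (a - c) + (b - e) - k
      lem = solve-∀
    -- A contour half-edge with `f` on its right contributes 0 to both sides: it is outgoing of
    -- weight 0, or ingoing and left out of `faceWeight`.
    not-outer-face : ∀ f → f ≢ outer → ∑ (λ h → δ (face (α h)) f * x h) ≡ - faceWeight f
    not-outer-face f nf = trans (∑-cong pw) (trans (∑-neg _) (cong -_ (sym (sum-filter id (λ h → not (ingoing h) ∧ does (face (α h) ≟ f)) wt))))
      where
      pw : ∀ h → δ (face (α h)) f * x h ≡ - (⟦ not (ingoing h) ∧ does (face (α h) ≟ f) ⟧ * wt h)
      pw h with face (α h) ≟ f
      ... | no _ = sym (cong (λ b → - (⟦ b ⟧ * wt h)) (Bool.∧-zeroʳ (not (ingoing h))))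
      ... | yes refl with kind h | bool-cases (ingoing h)
      ...   | outerR _ r | _ = ⊥-elim (nf r)
      ...   | outerL l _ | inj₁ y = trans (cong (_*_ 1ℤ) (x-outerL l)) (sym (cong (λ b → - (⟦ not b ∧ true ⟧ * wt h)) y))
      ...   | outerL l _ | inj₂ z = trans (cong (_*_ 1ℤ) (x-outerL l)) (sym (cong₂ (λ b w → - (⟦ not b ∧ true ⟧ * w)) z (outer-out h (inj₁ l) z)))
      ...   | innerE i | inj₁ y = trans (cong (_*_ 1ℤ) (x-in i y)) (sym (cong (λ b → - (⟦ not b ∧ true ⟧ * wt h)) y))
      ...   | innerE i | inj₂ z = trans (cong (_*_ 1ℤ) (x-out i z)) (trans (lem (wt h)) (sym (cong (λ b → - (⟦ not b ∧ true ⟧ * wt h)) z)))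
        where
        lem : ∀ w → 1ℤ * - w ≡ - (1ℤ * w)
        lem = solve-∀
    at-f : ∀ f → ∑ (λ h → δ (face (α h)) f * x h) ≡ supply f
    at-f f with f ≟ outer | f ≟ inner
    ... | yes refl | _ = trans (∑-cong pw) (trans (∑-*ʳ (+ 2) (λ h → δ (face (α h)) outer))
        (trans (cong (_* + 2) (trans (∑-α (λ h → δ (face h) outer)) (trans (sym (degree outer)) deg)))
          (trans (lem P) (sym (trans supply-outer (cong (_+ P) deg))))))
      where
      deg : + faceDeg M outer ≡ P
      deg = cong +_ (proj₁ type)
      pw : ∀ h → δ (face (α h)) outer * x h ≡ δ (face (α h)) outer * + 2
      pw h = by-cases (face (α h) ≟ outer)
        where
        by-cases : Dec (face (α h) ≡ outer) → δ (face (α h)) outer * x h ≡ δ (face (α h)) outer * + 2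
        by-cases (yes r) = cong (_*_ (δ (face (α h)) outer)) (x-outerR (λ l → proj₂ contour-simple h l r) r)
        by-cases (no nr) = trans (cong (_* x h) (δ-no nr)) (sym (cong (_* + 2) (δ-no nr)))
      lem : ∀ p → p * + 2 ≡ p + p
      lem = solve-∀
    ... | no no′ | yes refl = trans (not-outer-face inner no′) (trans (cong -_ (proj₂ root-face))
        (trans (lem P (+ q)) (sym (trans supply-inner (cong (λ g → + g - P) (proj₂ type))))))
      where
      lem : ∀ p q → - (p - q) ≡ q - p
      lem = solve-∀
    ... | no no′ | no ni = trans (not-outer-face f no′) (trans
        (eq₁ (sym (inner-faces f no′ ni)) (lem (faceWeight f) (+ faceDeg M f) D)) (sym (supply-other no′ ni)))
      where
      lem : ∀ w g d → - w - (g - d) ≡ d - (g + w)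
      lem = solve-∀

-- Girth conditions from a non-negative flow

module FlowBounds (M : AnnularMap) (d p : ℕ) (φ₀ : Flows.Flow M d p)
  (pos≥0 : ∀ h → 0ℤ ≤ Flows.Flow.pos φ₀ h) (x≥0 : ∀ h → 0ℤ ≤ Flows.Flow.x φ₀ h) where
  open Flows M d p

  private
    ccw-bound : ∀ C → Cycle.inside M C outer ≡ false →
      (Cycle.inside M C inner ≡ false → d ℕ.≤ SimpleCycle.len C) ×
      (Cycle.inside M C inner ≡ true → p ℕ.≤ SimpleCycle.len C)
    ccw-bound C eo =
      (λ ei → ℤ.drop‿+≤+ (≤-from (cost-nonneg pos≥0 x≥0) (sym (cost-neither ei eo)))) ,
      (λ ei → ℤ.drop‿+≤+ (≤-from (cost-nonneg pos≥0 x≥0) (sym (cost-inner ei eo))))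
      where open Cost φ₀ C

    ccw-girth : ∀ C → Cycle.inside M C outer ≡ false →
      (¬ Separating M C → d ℕ.≤ SimpleCycle.len C) × (Separating M C → p ℕ.≤ SimpleCycle.len C)
    ccw-girth C eo = non-sep , λ sep → proj₂ (ccw-bound C eo) (trans (separating⇒sides-differ sep) (cong not eo))
      where
      open Cycle M C
      non-sep : ¬ Separating M C → d ℕ.≤ len
      non-sep ns with bool-cases (inside inner)
      ... | inj₂ z = proj₁ (ccw-bound C eo) z
      ... | inj₁ y = ⊥-elim (ns λ r → true≢false y (trans (sym (inside-~ r)) eo))

  girth : ∀ C → (¬ Separating M C → d ℕ.≤ SimpleCycle.len C) × (Separating M C → p ℕ.≤ SimpleCycle.len C)
  girth C with bool-cases (Cycle.inside M C outer)
  ... | inj₂ z = ccw-girth C z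
  ... | inj₁ y = (λ ns → proj₁ (ccw-girth rev (inside⇒outside-rev y)) (λ s → ns (λ r → s (~⇒~ʳ r)))) ,
                 (λ s → proj₂ (ccw-girth rev (inside⇒outside-rev y)) (λ r → s (~ʳ⇒~ r)))
    where open Reverse M C

orientation⇒girth : (M : AnnularMap) (d p q : ℕ) → HasType M p q →
  Σ (ZBiorientation M) (DOrientation M d p q) → InA M d p
orientation⇒girth M d p q type (O , DO) =
  (λ C → proj₁ (girth C)) , (λ C → proj₂ (girth C)) ,
  -- The contour attains the separating girth: it has at most `faceDeg M outer` darts, and the bound
  -- on separating cycles gives the converse inequality.
  (contour , contour-separating , ℕ.≤-antisym (ℕ.≤-trans contour-length (ℕ.≤-reflexive (proj₁ type))) (proj₂ (girth contour) contour-separating))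
  where
  open OrientationFlow M d p q type O DO
  open OuterContour M contour-simple
  open FlowBounds M d p flow pos≥0 x≥0

-- A first flow, with `pos` non-negative and `x` of any sign

lower-bound : ∀ {n} (g : Fin n → ℤ) → ∃[ N ] (∀ i → - + N ≤ g i)
lower-bound {zero} g = 0 , λ ()
lower-bound {suc n} g with lower-bound (g ∘ suc)
... | N , below = ℤ.∣ g zero ∣ ℕ.+ N , bound
  where
  below-abs : ∀ a → - + ℤ.∣ a ∣ ≤ a
  below-abs (+ zero) = ℤ.≤-refl
  below-abs (+ suc a) = ℤ.-≤+
  below-abs ℤ.-[1+ a ] = ℤ.≤-refl
  bound : ∀ i → - + (ℤ.∣ g zero ∣ ℕ.+ N) ≤ g i
  bound zero = ℤ.≤-trans (ℤ.neg-mono-≤ (ℤ.+≤+ (ℕ.m≤m+n ℤ.∣ g zero ∣ N))) (below-abs (g zero))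
  bound (suc i) = ℤ.≤-trans (ℤ.neg-mono-≤ (ℤ.+≤+ (ℕ.m≤n+m N ℤ.∣ g zero ∣))) (below i)

module BaseFlow (M : AnnularMap) (d p : ℕ) where
  open Flows M d p

  private
    inflow : (Fin n → ℤ) → Fin F → ℤ
    inflow z u = ∑ (λ h → δ (face (α h)) u * z h)

    inflow-+ : ∀ y z u → inflow (λ h → y h + z h) u ≡ inflow y u + inflow z u
    inflow-+ y z u = trans (∑-cong (λ h → ℤ.*-distribˡ-+ (δ (face (α h)) u) (y h) (z h))) (∑-+ _ _)

    δ-inflow : ∀ k u → inflow (δ k) u ≡ δ (face (α k)) u
    δ-inflow k u = trans (∑-cong (λ h → ℤ.*-comm (δ (face (α h)) u) (δ k h))) (∑-δ k (λ h → δ (face (α h)) u))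

    Antisymmetric : (Fin n → ℤ) → Set
    Antisymmetric z = ∀ h → z (α h) ≡ - z h

    Transfer : Fin F → Set
    Transfer g = Σ (Fin n → ℤ) λ z → Antisymmetric z × (∀ u → inflow z u ≡ δ g u - δ outer u)

    -- One unit is carried from the outer face to `g` across the edges of a dual path.
    transfer : ∀ g → Transfer g
    transfer g = dual-connected Transfer across outer g start
      where
      start : Transfer outer
      start = (λ _ → 0ℤ) , (λ _ → refl) , λ u → trans (∑-zero (λ h → ℤ.*-zeroʳ (δ (face (α h)) u))) (sym (ℤ.+-inverseʳ (δ outer u)))
      across : ∀ k → Transfer (face k) → Transfer (face (α k))
      across k (z , anti , flow) = (λ h → z h + (δ k h - δ (α k) h)) ,
        (λ h → trans (cong₂ _+_ (anti h) (cong₂ _-_ (Dual.δ-α′ k h) (Dual.δ-α k h))) (lem (z h) (δ k h) (δ (α k) h))) ,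
        λ u → trans (inflow-+ z (λ h → δ k h - δ (α k) h) u)
          (trans (cong₂ _+_ (flow u) (trans (trans (∑-cong (λ h → *-distribˡ-- (δ (face (α h)) u) (δ k h) (δ (α k) h))) (∑-- _ _))
            (cong₂ _-_ (δ-inflow k u) (trans (δ-inflow (α k) u) (cong (λ j → δ (face j) u) (αα k))))))
            (lem₃ (δ (face k) u) (δ outer u) (δ (face (α k)) u)))
        where
        lem : ∀ z a b → - z + (b - a) ≡ - (z + (a - b))
        lem = solve-∀
        lem₃ : ∀ a o b → (a - o) + (b - a) ≡ b - o
        lem₃ = solve-∀

    -- The transfers are superposed with the weights `s f`; what they take from the outer face is
    -- the total of `s`, which is 0. Antisymmetry keeps the sum over the two darts of an edge at 0,
    -- so such a correction respects the edge law.
    solve-inflow : (s : Fin F → ℤ) → ∑ s ≡ 0ℤ → Σ (Fin n → ℤ) λ z → Antisymmetric z × (∀ u → inflow z u ≡ s u)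
    solve-inflow s total = z , anti , flow
      where
      zs : Fin F → Fin n → ℤ
      zs f = proj₁ (transfer f)
      z : Fin n → ℤ
      z h = ∑ (λ f → s f * zs f h)
      anti : Antisymmetric z
      anti h = trans (∑-cong (λ f → trans (cong (_*_ (s f)) (proj₁ (proj₂ (transfer f)) h)) (sym (ℤ.neg-distribʳ-* (s f) (zs f h))))) (∑-neg _)
      flow : ∀ u → inflow z u ≡ s u
      flow u = begin
        ∑ (λ h → δ (face (α h)) u * ∑ (λ f → s f * zs f h))
          ≡⟨ ∑-cong (λ h → ∑-*ˡ (δ (face (α h)) u) _) ⟩
        ∑ (λ h → ∑ (λ f → δ (face (α h)) u * (s f * zs f h)))
          ≡⟨ ∑-swap _ ⟩
        ∑ (λ f → ∑ (λ h → δ (face (α h)) u * (s f * zs f h)))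
          ≡⟨ ∑-cong (λ f → trans (∑-cong (λ h → *-swap (δ (face (α h)) u) (s f) (zs f h))) (sym (∑-*ˡ (s f) _))) ⟩
        ∑ (λ f → s f * inflow (zs f) u)
          ≡⟨ ∑-cong (λ f → trans (cong (_*_ (s f)) (trans (proj₂ (proj₂ (transfer f)) u) (cong (_- δ outer u) (δ-sym f u)))) (lem₂ (s f) (δ u f) (δ outer u))) ⟩
        ∑ (λ f → δ u f * s f - s f * δ outer u)
          ≡⟨ trans (∑-- _ _) (cong₂ _-_ (∑-δ u s) (trans (∑-*ʳ (δ outer u) s) (cong (_* δ outer u) total))) ⟩
        s u - 0ℤ ≡⟨ ℤ.+-identityʳ (s u) ⟩
        s u ∎
        where
        open ≡-Reasoning
        lem₂ : ∀ s a b → s * (a - b) ≡ a * s - s * b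
        lem₂ = solve-∀

    rep : Fin V → Fin n
    rep v = proj₁ (vert-surj v)

    pos₀ : Fin n → ℤ
    pos₀ h = δ (rep (vert h)) h * D

    at-vertex₀ : ∀ v → ∑ (λ h → δ (vert h) v * pos₀ h) ≡ D
    at-vertex₀ v = trans (∑-cong pw) (∑-δ (rep v) (λ _ → D))
      where
      pw : ∀ h → δ (vert h) v * pos₀ h ≡ δ (rep v) h * D
      pw h = by-cases (vert h ≟ v)
        where
        by-cases : Dec (vert h ≡ v) → δ (vert h) v * pos₀ h ≡ δ (rep v) h * D
        by-cases (yes e) = trans (cong₂ (λ a w → a * (δ (rep w) h * D)) (δ-yes e) e) (ℤ.*-identityˡ _)
        by-cases (no ne) = trans (cong (_* pos₀ h) (δ-no ne)) (sym (cong (_* D) (δ-no (λ e → ne (trans (cong vert (sym e)) (proj₂ (vert-surj v)))))))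

    first : Fin n → Bool
    first h = does (toℕ h ℕ.<? toℕ (α h))

    first-pair : ∀ h → ⟦ first h ⟧ + ⟦ first (α h) ⟧ ≡ 1ℤ
    first-pair h with ℕ.<-cmp (toℕ h) (toℕ (α h))
    ... | tri< l _ g = cong₂ (λ a b → ⟦ a ⟧ + ⟦ b ⟧) (dec-true (_ ℕ.<? _) l) (dec-false (_ ℕ.<? _) (subst (λ k → ¬ toℕ (α h) ℕ.< toℕ k) (sym (αα h)) g))
    ... | tri≈ _ e _ = ⊥-elim (α-free h (sym (Fin.toℕ-injective e)))
    ... | tri> l _ g = cong₂ (λ a b → ⟦ a ⟧ + ⟦ b ⟧) (dec-false (_ ℕ.<? _) l) (dec-true (_ ℕ.<? _) (subst (λ k → toℕ (α h) ℕ.< toℕ k) (sym (αα h)) g))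

    -- The edge law determines only `x h + x (α h)`. The constant `D - + 2` is charged to the dart
    -- of smaller index; the face law is left to an antisymmetric correction.
    x₀ : Fin n → ℤ
    x₀ h = pos₀ h - ⟦ first h ⟧ * (D - + 2)

    -- This is Euler's formula multiplied by `D`. The extra charges `D - P` and `D + P` of the two
    -- root-faces add up to the `2 D` that it requires.
    balance : ∑ (λ f → supply f - inflow x₀ f) ≡ 0ℤ
    balance = ℤ.*-cancelˡ-≡ (+ 2) _ 0ℤ (eq₃ (cong (_*_ (+ 2)) (trans (∑-- supply (inflow x₀)) (cong₂ _-_ ∑supply ∑x₀)))
      (cong (_*_ (D - + 2)) twice-first) (cong (_*_ (- D)) euler-ℤ)
      (lem (∑ (λ f → supply f - inflow x₀ f)) (∑ (λ h → ⟦ first h ⟧)) (+ n) (+ F) (+ V) D))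
      where
      ∑deg : ∑ (λ f → + faceDeg M f) ≡ + n
      ∑deg = trans (∑-cong (λ f → trans (degree f) (∑-cong (λ h → sym (ℤ.*-identityʳ (δ (face h) f))))))
        (trans (∑-fibre₁ face (λ _ → 1ℤ)) (∑-ones n))
      ∑supply : ∑ supply ≡ + n - + F * D + (D - P) + (D + P)
      ∑supply = trans (∑-+ (λ f → + faceDeg M f - D + δ inner f * (D - P)) (λ f → δ outer f * (D + P)))
        (cong₂ _+_ (trans (∑-+ (λ f → + faceDeg M f - D) (λ f → δ inner f * (D - P)))
            (cong₂ _+_ (trans (∑-- (λ f → + faceDeg M f) (λ _ → D)) (cong₂ _-_ ∑deg (∑-const F D))) (∑-δ inner (λ _ → D - P))))
          (∑-δ outer (λ _ → D + P)))
      ∑x₀ : ∑ (inflow x₀) ≡ + V * D - ∑ (λ h → ⟦ first h ⟧) * (D - + 2)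
      ∑x₀ = trans (∑-fibre₁ (face ∘ α) x₀) (trans (∑-- pos₀ (λ h → ⟦ first h ⟧ * (D - + 2)))
        (cong₂ _-_ (trans (sym (∑-fibre₁ vert pos₀)) (trans (∑-cong at-vertex₀) (∑-const V D))) (∑-*ʳ (D - + 2) (λ h → ⟦ first h ⟧))))
      twice-first : ∑ (λ h → ⟦ first h ⟧) + ∑ (λ h → ⟦ first h ⟧) ≡ + n
      twice-first = trans (cong (_+_ (∑ (λ h → ⟦ first h ⟧))) (sym (∑-α (λ h → ⟦ first h ⟧))))
        (trans (sym (∑-+ _ _)) (trans (∑-cong first-pair) (∑-ones n)))
      lem : ∀ s b n f v d → + 2 * s - + 2 * 0ℤ ≡
        (+ 2 * s - + 2 * ((n - f * d + (d - + p) + (d + + p)) - (v * d - b * (d - + 2)))) +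
        ((d - + 2) * (b + b) - (d - + 2) * n) + (- d * (+ 2 * (v + f)) - - d * (n + + 4))
      lem s b n f v d = lem′ s b n f v d P
        where
        lem′ : ∀ s b n f v d p → + 2 * s - + 2 * 0ℤ ≡
          (+ 2 * s - + 2 * ((n - f * d + (d - p) + (d + p)) - (v * d - b * (d - + 2)))) +
          ((d - + 2) * (b + b) - (d - + 2) * n) + (- d * (+ 2 * (v + f)) - - d * (n + + 4))
        lem′ = solve-∀

  private
    correction : Σ (Fin n → ℤ) λ z → Antisymmetric z × (∀ u → inflow z u ≡ supply u - inflow x₀ u)
    correction = solve-inflow (λ f → supply f - inflow x₀ f) balance

    assemble : (z : Fin n → ℤ) → Antisymmetric z → (∀ u → inflow z u ≡ supply u - inflow x₀ u) → Flow
    assemble z anti flow = record { pos = pos₀ ; x = λ h → x₀ h + z h ; at-vertex = at-vertex₀ ; at-edge = at-e ; at-face = at-f }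
      where
      at-e : ∀ h → pos₀ h + pos₀ (α h) ≡ D - + 2 + ((x₀ h + z h) + (x₀ (α h) + z (α h)))
      at-e h = eq₂ (cong (_*_ (D - + 2)) (first-pair h)) (cong -_ (anti h)) (lem (pos₀ h) (pos₀ (α h)) (z h) (z (α h)) ⟦ first h ⟧ ⟦ first (α h) ⟧ (D - + 2))
        where
        lem : ∀ a b z y u v e → (a + b) - (e + (((a - u * e) + z) + ((b - v * e) + y))) ≡ (e * (u + v) - e * 1ℤ) + (- y - - - z)
        lem = solve-∀
      at-f : ∀ f → inflow (λ h → x₀ h + z h) f ≡ supply f
      at-f f = trans (inflow-+ x₀ z f) (trans (cong (_+_ (inflow x₀ f)) (flow f)) (lem (inflow x₀ f) (supply f)))
        where
        lem : ∀ a b → a + (b - a) ≡ b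
        lem = solve-∀

  opaque
    base-flow : Flow
    base-flow = assemble (proj₁ correction) (proj₁ (proj₂ correction)) (proj₂ (proj₂ correction))

    base-flow-pos : ∀ h → 0ℤ ≤ Flow.pos base-flow h
    base-flow-pos h = 0≤-* (0≤δ (rep (vert h)) h) (ℤ.+≤+ ℕ.z≤n)

-- Potentials on corners and rotations of zero weight

module Potentials (M : AnnularMap) (d p : ℕ) where
  open Flows M d p

  -- The price of an arc from `c` to `c'` gains `π c - π c'`, where `x h` is the price of passing
  -- from `α h` to `σ⁻ h`. The gains telescope round a vertex and round a face, and those of the two
  -- sides of the edge law are equal.
  shift : (Fin n → ℤ) → Flow → Flow
  shift π φ₀ = record
    { pos = λ h → pos h + (π h - π (σ⁻ h))
    ; x = λ h → x h + (π (α h) - π (σ⁻ h))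
    ; at-vertex = at-v ; at-edge = at-e ; at-face = at-f }
    where
    open Flow φ₀
    lem : ∀ k a b c → k * (a + (b - c)) ≡ k * a + (k * b - k * c)
    lem = solve-∀
    vanishes : ∀ {f : Fin n → ℤ} {a b : Fin n → ℤ} → ∑ a ≡ ∑ b → ∑ f + ∑ (λ h → a h - b h) ≡ ∑ f
    vanishes {f} {a} {b} e = trans (cong (_+_ (∑ f)) (trans (∑-- a b) (trans (cong (_- ∑ b) e) (ℤ.+-inverseʳ (∑ b))))) (ℤ.+-identityʳ _)
    at-v : ∀ v → ∑ (λ h → δ (vert h) v * (pos h + (π h - π (σ⁻ h)))) ≡ D
    at-v v = trans (∑-cong (λ h → lem (δ (vert h) v) (pos h) (π h) (π (σ⁻ h)))) (trans (∑-+ _ _) (trans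
      (vanishes (sym (trans (∑-cong (λ h → cong (λ u → δ u v * π (σ⁻ h)) (sym (vert-σ⁻ h)))) (∑-σ⁻ (λ h → δ (vert h) v * π h)))))
      (at-vertex v)))
    at-e : ∀ h → (pos h + (π h - π (σ⁻ h))) + (pos (α h) + (π (α h) - π (σ⁻ (α h)))) ≡
      D - + 2 + ((x h + (π (α h) - π (σ⁻ h))) + (x (α h) + (π (α (α h)) - π (σ⁻ (α h)))))
    at-e h = trans (eq₁ (at-edge h) (lem₂ (pos h) (pos (α h)) (x h) (x (α h)) (π h) (π (σ⁻ h)) (π (α h)) (π (σ⁻ (α h))) (D - + 2)))
      (cong (λ k → D - + 2 + ((x h + (π (α h) - π (σ⁻ h))) + (x (α h) + (π k - π (σ⁻ (α h)))))) (sym (αα h)))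
      where
      lem₂ : ∀ a b u v s t y z e → ((a + (s - t)) + (b + (y - z))) - (e + ((u + (y - t)) + (v + (s - z)))) ≡ (a + b) - (e + (u + v))
      lem₂ = solve-∀
    at-f : ∀ f → ∑ (λ h → δ (face (α h)) f * (x h + (π (α h) - π (σ⁻ h)))) ≡ supply f
    at-f f = trans (∑-cong (λ h → lem (δ (face (α h)) f) (x h) (π (α h)) (π (σ⁻ h)))) (trans (∑-+ _ _) (trans
      (vanishes (trans (∑-α (λ h → δ (face h) f * π h))
        (sym (trans (∑-cong (λ h → cong (λ g → δ g f * π (σ⁻ h)) (sym (face-σ⁻ h)))) (∑-σ⁻ (λ h → δ (face h) f * π h))))))
      (at-face f)))

  module Rotation (φ₀ : Flow) where
    open Flow φ₀

    -- The free moves of a walk: clockwise rotations that cross only half-edges with `pos` zero.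
    -- `Corner` records the corners met on the way, both ends included.
    data Rot : Fin n → Fin n → Set where
      done : ∀ {c} → Rot c c
      turn : ∀ {c c'} → pos c ≡ 0ℤ → Rot (σ⁻ c) c' → Rot c c'

    Corner : Fin n → ∀ {c c'} → Rot c c' → Set
    Corner y {c} done = y ≡ c
    Corner y {c} (turn _ r) = y ≡ c ⊎ Corner y r

    rot-vert : ∀ {c c'} → Rot c c' → vert c' ≡ vert c
    rot-vert done = refl
    rot-vert (turn _ r) = trans (rot-vert r) (vert-σ⁻ _)

    rot-trans : ∀ {c c' c''} → Rot c c' → Rot c' c'' → Rot c c''
    rot-trans done s = s
    rot-trans (turn z r) s = turn z (rot-trans r s)

    corner-last : ∀ {c c'} (r : Rot c c') → Corner c' r
    corner-last done = refl
    corner-last (turn _ r) = inj₂ (corner-last r)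

    corner-pos : ∀ {c c' y} (r : Rot c c') → Corner y r → y ≡ c' ⊎ pos y ≡ 0ℤ
    corner-pos done refl = inj₁ refl
    corner-pos (turn z r) (inj₁ refl) = inj₂ z
    corner-pos (turn z r) (inj₂ y∈) = corner-pos r y∈

    corner-σ : ∀ {c c' y} (r : Rot c c') → Corner y r → y ≡ c ⊎ Corner (σ y) r
    corner-σ done e = inj₁ e
    corner-σ (turn _ r) (inj₁ e) = inj₁ e
    corner-σ {c} (turn _ r) (inj₂ y∈) with corner-σ r y∈
    ... | inj₁ refl = inj₂ (inj₁ (σσ⁻ c))
    ... | inj₂ sy∈ = inj₂ (inj₂ sy∈)

    -- Such a rotation meets every corner of the vertex and crosses all its half-edges but `k` for
    -- free, so `k` carries the whole vertex weight.
    full-turn : ∀ {k} → Rot (σ⁻ k) k → pos k ≡ D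
    full-turn {k} r = trans (sym (∑-δ k pos)) (trans (∑-cong pw) (at-vertex (vert k)))
      where
      corners : ∀ y → vert y ≡ vert k → Corner y r
      corners y vy = around-vertex (λ y → Corner y r) closed (sym vy) (corner-last r)
        where
        closed : ∀ y → Corner y r → Corner (σ y) r
        closed y y∈ with corner-σ r y∈
        ... | inj₂ sy∈ = sy∈
        ... | inj₁ refl = subst (λ z → Corner z r) (sym (σσ⁻ k)) (corner-last r)
      pw : ∀ y → δ k y * pos y ≡ δ (vert y) (vert k) * pos y
      pw y with k ≟ y | vert y ≟ vert k
      ... | yes refl | yes _ = refl
      ... | yes refl | no ne = ⊥-elim (ne refl)
      ... | no _ | no _ = refl
      ... | no ne | yes vy with corner-pos r (corners y vy)
      ...   | inj₁ e = ⊥-elim (ne (sym e))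
      ...   | inj₂ z = sym (trans (ℤ.*-identityˡ (pos y)) z)

  -- A loop cut out of a longer walk need not turn freely at its base point, from its last dart to
  -- its first. Only if it does is the cost reduced to the `x` terms, hence the hypothesis of
  -- `closed-cost`.
  record TightCycle (φ₀ : Flow) (h : ℕ → Fin n) (m : ℕ) : Set where
    field
      cycle : SimpleCycle M
      he-time : ∀ i → ∃[ k ] (k ℕ.≤ m × SimpleCycle.he cycle i ≡ h k)
      time-he : ∀ k → k ℕ.≤ m → ∃[ i ] SimpleCycle.he cycle i ≡ h k
      outer-right : Cycle.inside M cycle outer ≡ false
      closed-cost : Rotation.Rot φ₀ (φ (h m)) (h 0) →
        Cost.cost φ₀ cycle ≡ ∑ (λ i → Flow.x φ₀ (α (SimpleCycle.he cycle i)))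

  -- A loop of a walk that follows its left side as closely as the rotations of zero
  -- weight allow.  If the outer face were on its left, the rotation at the
  -- base point would have to cost more than a full turn.
  module TightLoop (d≤p : d ℕ.≤ p) (φ₀ : Flow) (pos≥0 : ∀ h → 0ℤ ≤ Flow.pos φ₀ h)
    (h : ℕ → Fin n) (m : ℕ)
    (rot : ∀ k → k ℕ.< m → Rotation.Rot φ₀ (φ (h k)) (h (suc k)))
    (low : ∀ k → k ℕ.≤ m → Flow.x φ₀ (α (h k)) ≤ 0ℤ)
    (last : vert (α (h m)) ≡ vert (h (suc m)))
    (back : vert (h (suc m)) ≡ vert (h 0))
    (distinct : ∀ a b → a ℕ.< b → b ℕ.≤ m → vert (h a) ≢ vert (h b)) where
    open Flow φ₀
    open Rotation φ₀

    private
      walk : ∀ k → k ℕ.≤ m → vert (α (h k)) ≡ vert (h (suc k))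
      walk k k≤m with ℕ.m≤n⇒m<n∨m≡n k≤m
      ... | inj₁ k<m = sym (trans (rot-vert (rot k k<m)) (vert-φ (h k)))
      ... | inj₂ refl = last

      injective : ∀ a b → a ℕ.≤ m → b ℕ.≤ m → vert (h a) ≡ vert (h b) → a ≡ b
      injective = upto-injective (vert ∘ h) m distinct

      follows : ∀ a b → a ℕ.≤ m → b ℕ.≤ m → h a ≡ α (h b) → (b ℕ.< m × a ≡ suc b) ⊎ (b ≡ m × a ≡ 0)
      follows a b a≤m b≤m e with ℕ.m≤n⇒m<n∨m≡n b≤m
      ... | inj₁ b<m = inj₁ (b<m , injective a (suc b) a≤m b<m (trans (cong vert e) (walk b b≤m)))
      ... | inj₂ refl = inj₂ (refl , injective a 0 a≤m ℕ.z≤n (trans (cong vert e) (trans (walk b b≤m) back)))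

      -- Turning back at once is a full free turn, so `α (h 0)` carries `D`. But the edge law allows
      -- at most `D - 2`, since `x` is non-positive on both darts of the edge.
      backtrack : 1 ≡ m → h 1 ≢ α (h 0)
      backtrack refl e = impossible (full-turn (subst (λ k → Rot (φ (h 0)) k) e (rot 0 (ℕ.s≤s ℕ.z≤n))))
        where
        impossible : pos (α (h 0)) ≡ D → ⊥
        impossible pk = 1≰0 (≤-from (0≤-+ (0≤-+ (0≤-+ (pos≥0 (h 0)) (0≤-diff (low 0 ℕ.z≤n))) (0≤-diff xh)) 0≤1)
          (eq₂ pk (sym (at-edge (h 0))) (lem (pos (h 0)) (x (h 0)) (x (α (h 0))) (pos (α (h 0))) D)))
          where
          xh : x (h 0) ≤ 0ℤ
          xh = subst (λ k → x k ≤ 0ℤ) (trans (cong α e) (αα (h 0))) (low 1 ℕ.≤-refl)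
          lem : ∀ a b c k d → (0ℤ - 1ℤ) - (((a + (0ℤ - c)) + (0ℤ - b)) + 1ℤ) ≡ (k - d) + ((d - + 2 + (b + c)) - (a + k))
          lem = solve-∀

      no-backtrack : ∀ a b → a ℕ.≤ m → b ℕ.≤ m → h a ≢ α (h b)
      no-backtrack a b a≤m b≤m e with follows a b a≤m b≤m e | follows b a b≤m a≤m (trans (sym (αα (h b))) (cong α (sym e)))
      ... | inj₁ (_ , a≡) | inj₁ (_ , b≡) = ℕ.<-irrefl refl (ℕ.≤-trans (ℕ.≤-reflexive (sym a≡)) (ℕ.≤-trans (ℕ.n≤1+n a) (ℕ.≤-reflexive (sym b≡))))
      ... | inj₁ (_ , refl) | inj₂ (am , refl) = backtrack am e
      ... | inj₂ (bm , refl) | inj₁ (_ , refl) = backtrack bm (trans (sym (αα (h 1))) (cong α (sym e)))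
      ... | inj₂ (_ , refl) | inj₂ (_ , refl) = α-free (h 0) (sym e)

    open Loops.Loop M h m walk back distinct no-backtrack public
    open Cycle M loop hiding (m) public
    open Disc M loop
    open Cost φ₀ loop public

    private
      -- Counterclockwise from `φ (he (prev j))` comes the arriving edge, beyond which lies the
      -- right side; it ends at `he j`, where the corners of the rotation begin again.
      left-corner : ∀ j (r : Rot (φ (he (prev j))) (he j)) y → vert y ≡ vert (he j) → Corner y r ⊎ inside (face y) ≡ false
      left-corner j r y vy = proj₁ (around-vertex Q closed (sym vy) (inj₁ (corner-last r) , refl))
        where
        Q : Fin n → Set
        Q y = (Corner y r ⊎ inside (face y) ≡ false) × vert y ≡ vert (he j)
        closed : ∀ y → Q y → Q (σ y)
        closed y (inj₁ y∈ , vy) with corner-σ r y∈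
        ... | inj₂ sy∈ = inj₁ sy∈ , trans (vert-σ y) vy
        ... | inj₁ refl = inj₂ (trans (cong (inside ∘ face) (σσ⁻ (α (he (prev j))))) (inside-right (prev j))) , trans (vert-σ y) vy
        closed y (inj₂ z , vy) with onCycle? (σ y)
        ... | no off′ = inj₂ (trans (inside-off off′) (trans (cong inside (face-ασ y)) z)) , trans (vert-σ y) vy
        ... | yes o with star j (trans (vert-σ y) vy) o
        ...   | inj₁ e = inj₁ (subst (λ k → Corner k r) (sym e) (corner-last r)) , trans (vert-σ y) vy
        ...   | inj₂ e = inj₂ (trans (cong (inside ∘ face) e) (inside-right (prev j))) , trans (vert-σ y) vy

    turn-free : ∀ j → Rot (φ (he (prev j))) (he j) → ∀ y → vert y ≡ vert (he j) → κ y * pos y ≡ 0ℤ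
    turn-free j r y vy with left-corner j r y vy
    ... | inj₂ z = trans (cong (λ b → ⟦ off y ⟧ * ⟦ b ⟧ * pos y) z) (cong (_* pos y) (ℤ.*-zeroʳ ⟦ off y ⟧))
    ... | inj₁ y∈ with corner-pos r y∈
    ...   | inj₁ refl = cong (_* pos y) (κ-on (j , inj₁ refl))
    ...   | inj₂ z = trans (cong (_*_ (κ y)) z) (ℤ.*-zeroʳ (κ y))

    private
      inner-rot : ∀ (j : Fin (suc m)) → j ≢ zero → Rot (φ (he (prev j))) (he j)
      inner-rot zero ne = ⊥-elim (ne refl)
      inner-rot (suc i) _ = subst (λ k → Rot (φ (h k)) (h (suc (toℕ i)))) (sym (Fin.toℕ-inject₁ i)) (rot (toℕ i) (Fin.toℕ<n i))

      move : ∀ a b c → a * b * c ≡ b * (a * c)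
      move = solve-∀

      κ≤1 : ∀ y → κ y * on (vert y) ≤ 1ℤ
      κ≤1 y with off y | inside (face y) | does (vertexOn? (vert y))
      ... | false | _ | _ = 0≤1
      ... | true | false | _ = 0≤1
      ... | true | true | false = 0≤1
      ... | true | true | true = ℤ.≤-refl

      side-term : ∀ y → κ y * on (vert y) * pos y ≤ δ (vert y) (vert (he zero)) * pos y
      side-term y = by-cases (vert y ≟ vert (he zero)) (vertexOn? (vert y))
        where
        by-cases : Dec (vert y ≡ vert (he zero)) → Dec (∃[ i ] vert (he i) ≡ vert y) → κ y * on (vert y) * pos y ≤ δ (vert y) (vert (he zero)) * pos y
        by-cases (yes e) _ = subst (κ y * on (vert y) * pos y ≤_) (cong (_* pos y) (sym (δ-yes e)))
          (≤-from (0≤-* (0≤-diff (κ≤1 y)) (pos≥0 y)) (lem (κ y * on (vert y)) (pos y)))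
          where
          lem : ∀ a b → 1ℤ * b - a * b ≡ (1ℤ - a) * b
          lem = solve-∀
        by-cases (no ne) (no n′) = ℤ.≤-reflexive (trans (cong (λ b → κ y * ⟦ b ⟧ * pos y) (dec-false (vertexOn? (vert y)) n′))
          (trans (cong (_* pos y) (ℤ.*-zeroʳ (κ y))) (sym (cong (_* pos y) (δ-no ne)))))
        by-cases (no ne) (yes (j , e)) = ℤ.≤-reflexive (trans (move (κ y) (on (vert y)) (pos y))
          (trans (cong (_*_ (on (vert y))) (turn-free j (inner-rot j (λ { refl → ne (sym e) })) y (sym e)))
            (trans (ℤ.*-zeroʳ (on (vert y))) (sym (cong (_* pos y) (δ-no ne))))))

      -- The free turns contribute nothing, the turn at the base point at most the whole vertex
      -- weight, and the `x` terms are non-positive.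
      cost≤D : cost ≤ D
      cost≤D = subst (cost ≤_) (trans (cong (_+ 0ℤ) (at-vertex (vert (he zero)))) (ℤ.+-identityʳ D))
        (ℤ.+-mono-≤ (∑-mono side-term) (subst (∑ (λ i → x (α (he i))) ≤_) (∑-zero {g = λ (_ : Fin (suc m)) → 0ℤ} (λ _ → refl))
          (∑-mono (λ i → low (toℕ i) (ℕ.s≤s⁻¹ (Fin.toℕ<n i))))))

    opaque
      outer-right : inside outer ≡ false
      outer-right with bool-cases (inside outer)
      ... | inj₂ z = z
      ... | inj₁ y = ⊥-elim (by-cases (bool-cases (inside inner)))
        where
        0≤m : 0ℤ ≤ + m
        0≤m = ℤ.+≤+ ℕ.z≤n
        by-cases : inside inner ≡ true ⊎ inside inner ≡ false → ⊥
        by-cases (inj₁ ei) = 1≰0 (≤-from (0≤-+ (0≤-diff cost≤D) 0≤m) (eq₁ (cost-at ei y) (lem cost (+ m) D P)))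
          where
          lem : ∀ c l d p → (0ℤ - 1ℤ) - ((d - c) + l) ≡ c - (1ℤ + l - d + (1ℤ * (d - p) + 1ℤ * (d + p)))
          lem = solve-∀
        -- With the outer face but not the inner one on the left, the cost is `len + P`; this
        -- exceeds `D` because `d ≤ p`.
        by-cases (inj₂ ei) = 1≰0 (≤-from (0≤-+ (0≤-+ (0≤-diff cost≤D) 0≤m) (0≤-diff (ℤ.+≤+ d≤p))) (eq₁ (cost-at ei y) (lem cost (+ m) D P)))
          where
          lem : ∀ c l d p → (0ℤ - 1ℤ) - (((d - c) + l) + (p - d)) ≡ c - (1ℤ + l - d + (0ℤ * (d - p) + 1ℤ * (d + p)))
          lem = solve-∀

    closed-cost : Rot (φ (h m)) (h 0) → cost ≡ ∑ (λ i → x (α (he i)))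
    closed-cost r = trans (cong (_+ ∑ (λ i → x (α (he i)))) (∑-zero none)) (ℤ.+-identityˡ _)
      where
      all-rot : ∀ j → Rot (φ (he (prev j))) (he j)
      all-rot zero = subst (λ k → Rot (φ (h k)) (h 0)) (sym (Fin.toℕ-fromℕ m)) r
      all-rot (suc i) = inner-rot (suc i) λ ()
      none : ∀ y → κ y * on (vert y) * pos y ≡ 0ℤ
      none y = by-cases (vertexOn? (vert y))
        where
        by-cases : Dec (∃[ i ] vert (he i) ≡ vert y) → κ y * on (vert y) * pos y ≡ 0ℤ
        by-cases (no n′) = trans (cong (λ b → κ y * ⟦ b ⟧ * pos y) (dec-false (vertexOn? (vert y)) n′)) (cong (_* pos y) (ℤ.*-zeroʳ (κ y)))
        by-cases (yes (j , e)) = trans (move (κ y) (on (vert y)) (pos y)) (trans (cong (_*_ (on (vert y))) (turn-free j (all-rot j) y (sym e))) (ℤ.*-zeroʳ (on (vert y))))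

    tight-cycle : TightCycle φ₀ h m
    tight-cycle = record
      { cycle = loop
      ; he-time = λ i → toℕ i , ℕ.s≤s⁻¹ (Fin.toℕ<n i) , refl
      ; time-he = he-at
      ; outer-right = outer-right
      ; closed-cost = closed-cost
      }

-- Closed tight walks

remainders-differ : ∀ ℓ s t → s ℕ.< t → t ℕ.< s ℕ.+ suc ℓ → s % suc ℓ ≢ t % suc ℓ
remainders-differ ℓ s t s<t t<s+L e with ℕ.≤-<-connex (t / suc ℓ) (s / suc ℓ)
... | inj₁ le = ℕ.<⇒≱ s<t (begin
  t                                  ≡⟨ m≡m%n+[m/n]*n t (suc ℓ) ⟩
  t % suc ℓ ℕ.+ t / suc ℓ ℕ.* suc ℓ  ≤⟨ ℕ.+-mono-≤ (ℕ.≤-reflexive (sym e)) (ℕ.*-monoˡ-≤ (suc ℓ) le) ⟩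
  s % suc ℓ ℕ.+ s / suc ℓ ℕ.* suc ℓ  ≡⟨ sym (m≡m%n+[m/n]*n s (suc ℓ)) ⟩
  s                                  ∎)
  where open ℕ.≤-Reasoning
... | inj₂ lt = ℕ.<⇒≱ t<s+L (begin
  s ℕ.+ suc ℓ                                        ≡⟨ cong (ℕ._+ suc ℓ) (m≡m%n+[m/n]*n s (suc ℓ)) ⟩
  s % suc ℓ ℕ.+ s / suc ℓ ℕ.* suc ℓ ℕ.+ suc ℓ        ≡⟨ ℕ.+-assoc (s % suc ℓ) _ _ ⟩
  s % suc ℓ ℕ.+ (s / suc ℓ ℕ.* suc ℓ ℕ.+ suc ℓ)      ≡⟨ cong (s % suc ℓ ℕ.+_) (ℕ.+-comm _ (suc ℓ)) ⟩
  s % suc ℓ ℕ.+ suc (s / suc ℓ) ℕ.* suc ℓ            ≤⟨ ℕ.+-mono-≤ (ℕ.≤-reflexive e) (ℕ.*-monoˡ-≤ (suc ℓ) lt) ⟩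
  t % suc ℓ ℕ.+ t / suc ℓ ℕ.* suc ℓ                  ≡⟨ sym (m≡m%n+[m/n]*n t (suc ℓ)) ⟩
  t                                                  ∎)
  where open ℕ.≤-Reasoning

module Walks (M : AnnularMap) (d p : ℕ) (d≤p : d ℕ.≤ p) (inA : InA M d p)
             (φ₀ : Flows.Flow M d p) (pos≥0 : ∀ h → 0ℤ ≤ Flows.Flow.pos φ₀ h)
             (lo : ℤ) (lo≤0 : lo ≤ 0ℤ) where
  open Flows M d p
  open Potentials M d p
  open Flow φ₀
  open Rotation φ₀

  -- The bound `lo` is imposed on each step and not on the total, so that pieces of such a walk can
  -- be cut out and recombined without accounting.
  data Path : Fin n → Fin n → ℕ → Set where
    nil : ∀ {a} → Path a a 0
    cons : ∀ {a b c k} → x (α a) ≤ lo → Rot (φ a) b → Path b c k → Path a c (suc k)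

  _++ₚ_ : ∀ {a b c k l} → Path a b k → Path b c l → Path a c (k ℕ.+ l)
  nil ++ₚ q = q
  cons l r p ++ₚ q = cons l r (p ++ₚ q)

  node : ∀ {a c k} → Path a c k → ℕ → Fin n
  node {a} nil _ = a
  node {a} (cons _ _ _) zero = a
  node (cons _ _ p) (suc i) = node p i

  node-start : ∀ {a c k} (p : Path a c k) → node p 0 ≡ a
  node-start nil = refl
  node-start (cons _ _ _) = refl

  node-end : ∀ {a c k} (p : Path a c k) → node p k ≡ c
  node-end nil = refl
  node-end (cons _ _ p) = node-end p

  node-step : ∀ {a c k} (p : Path a c k) i → i ℕ.< k → x (α (node p i)) ≤ lo × Rot (φ (node p i)) (node p (suc i))
  node-step (cons l r p) zero _ = l , subst (Rot _) (sym (node-start p)) r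
  node-step (cons _ _ p) (suc i) (ℕ.s≤s i<k) = node-step p i i<k

  prefix : ∀ {a c k} (p : Path a c k) i → i ℕ.≤ k → Path a (node p i) i
  prefix p zero _ = subst (λ b → Path _ b 0) (sym (node-start p)) nil
  prefix (cons l r p) (suc i) (ℕ.s≤s i≤k) = cons l r (prefix p i i≤k)

  suffix : ∀ {a c k} (p : Path a c k) i → i ℕ.≤ k → Path (node p i) c (k ℕ.∸ i)
  suffix p zero _ = subst (λ b → Path b _ _) (sym (node-start p)) p
  suffix (cons _ _ p) (suc i) (ℕ.s≤s i≤k) = suffix p i i≤k

  split-rot : ∀ {c c' y} (r : Rot c c') → Corner y r → Rot c y × Rot y c'
  split-rot done refl = done , done
  split-rot (turn z r) (inj₁ refl) = done , turn z r
  split-rot (turn z r) (inj₂ y∈) with split-rot r y∈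
  ... | r₁ , r₂ = turn z r₁ , r₂

  module Shortest (b : Fin n) (bad : x (α b) < lo) (ℓ : ℕ) (path : Path b b (suc ℓ))
    (shortest : ∀ k → 0 ℕ.< k → k ℕ.< suc ℓ → ¬ Path b b k) where

    L : ℕ
    L = suc ℓ

    w : ℕ → Fin n
    w = node path

    -- The closed walk is unrolled periodically, so that a loop may straddle the base point `b`.
    h : ℕ → Fin n
    h t = w (t % L)

    private
      w-distinct : ∀ a c → a ℕ.< c → c ℕ.< L → w a ≢ w c
      w-distinct a c a<c c<L e = shortest (a ℕ.+ (L ℕ.∸ c))
        (ℕ.≤-trans (ℕ.m<n⇒0<n∸m c<L) (ℕ.m≤n+m (L ℕ.∸ c) a))
        (ℕ.≤-trans (ℕ.+-monoˡ-< (L ℕ.∸ c) a<c) (ℕ.≤-reflexive (ℕ.m+[n∸m]≡n (ℕ.<⇒≤ c<L))))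
        (subst (λ y → Path b y a) e (prefix path a (ℕ.≤-trans (ℕ.<⇒≤ a<c) (ℕ.<⇒≤ c<L))) ++ₚ suffix path c (ℕ.<⇒≤ c<L))

      -- If the rotation from `w a` to `w (suc a)` met `w c`, the walk could be shortened: for later
      -- `c` by leaving the rotation there, for earlier `c` by prolonging the rotation that leads
      -- into `w c` up to `w (suc a)`. For `c` zero it closes at once. In each case the walk is
      -- still based at `b`.
      no-shortcut : ∀ a c → a ℕ.< L → c ℕ.< L → c ≢ suc a → ¬ (suc a ≡ L × c ≡ 0) →
        Rot (φ (w a)) (w c) → Rot (w c) (w (suc a)) → ⊥
      no-shortcut a c a<L c<L c≢ not-wrap r₁ r₂ with ℕ.<-cmp c (suc a)
      ... | tri≈ _ e _ = c≢ e
      ... | tri> _ _ a+1<c = shortest (a ℕ.+ suc (L ℕ.∸ c)) (ℕ.≤-trans (ℕ.s≤s ℕ.z≤n) (ℕ.m≤n+m (suc (L ℕ.∸ c)) a))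
        (ℕ.≤-trans (ℕ.≤-reflexive (cong suc (ℕ.+-suc a (L ℕ.∸ c))))
          (ℕ.≤-trans (ℕ.+-monoˡ-≤ (L ℕ.∸ c) a+1<c) (ℕ.≤-reflexive (ℕ.m+[n∸m]≡n (ℕ.<⇒≤ c<L)))))
        (prefix path a (ℕ.<⇒≤ a<L) ++ₚ cons (proj₁ (node-step path a a<L)) r₁ (suffix path c (ℕ.<⇒≤ c<L)))
      no-shortcut a zero a<L c<L c≢ not-wrap r₁ r₂ | tri< _ _ _ = shortest (a ℕ.+ 1) (ℕ.m≤n+m 1 a)
        (ℕ.≤∧≢⇒< (ℕ.≤-trans (ℕ.≤-reflexive (ℕ.+-comm a 1)) a<L) (λ e → not-wrap (trans (ℕ.+-comm 1 a) e , refl)))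
        (prefix path a (ℕ.<⇒≤ a<L) ++ₚ cons (proj₁ (node-step path a a<L)) (subst (Rot _) (node-start path) r₁) nil)
      no-shortcut a (suc c) a<L c<L c≢ not-wrap r₁ r₂ | tri< c<a+1 _ _ = shortest (c ℕ.+ suc (L ℕ.∸ suc a)) (ℕ.≤-trans (ℕ.s≤s ℕ.z≤n) (ℕ.m≤n+m (suc (L ℕ.∸ suc a)) c))
        (ℕ.≤-trans (ℕ.≤-reflexive (cong suc (ℕ.+-suc c (L ℕ.∸ suc a))))
          (ℕ.≤-trans (ℕ.+-monoˡ-≤ (L ℕ.∸ suc a) c<a+1) (ℕ.≤-reflexive (ℕ.m+[n∸m]≡n a<L))))
        (prefix path c (ℕ.<⇒≤ c<L') ++ₚ cons (proj₁ (node-step path c c<L')) (rot-trans (proj₂ (node-step path c c<L')) r₂) (suffix path (suc a) a<L))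
        where
        c<L' : c ℕ.< L
        c<L' = ℕ.<⇒≤ c<L

      suc-% : ∀ t → (suc (t % L) ℕ.< L × suc t % L ≡ suc (t % L)) ⊎ (suc (t % L) ≡ L × suc t % L ≡ 0)
      suc-% t with ℕ.m≤n⇒m<n∨m≡n (m%n<n t L)
      ... | inj₁ lt = inj₁ (lt , trans expand (m<n⇒m%n≡m lt))
        where
        expand : suc t % L ≡ suc (t % L) % L
        expand = trans (cong (λ z → suc z % L) (m≡m%n+[m/n]*n t L)) ([m+kn]%n≡m%n (suc (t % L)) (t / L) L)
      ... | inj₂ eq = inj₂ (eq , trans expand (trans (cong (_% L) eq) (n%n≡0 L)))
        where
        expand : suc t % L ≡ suc (t % L) % L
        expand = trans (cong (λ z → suc z % L) (m≡m%n+[m/n]*n t L)) ([m+kn]%n≡m%n (suc (t % L)) (t / L) L)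

      h-suc : ∀ t → h (suc t) ≡ w (suc (t % L))
      h-suc t with suc-% t
      ... | inj₁ (_ , e) = cong w e
      ... | inj₂ (full , e) = trans (cong w e) (trans (node-start path) (trans (sym (node-end path)) (cong w (sym full))))

    h-distinct : ∀ s t → s ℕ.< t → t ℕ.< s ℕ.+ L → h s ≢ h t
    h-distinct s t s<t t<s+L with ℕ.<-cmp (s % L) (t % L)
    ... | tri< lt _ _ = w-distinct _ _ lt (m%n<n t L)
    ... | tri≈ _ e _ = ⊥-elim (remainders-differ ℓ s t s<t t<s+L e)
    ... | tri> _ _ gt = λ e → w-distinct _ _ gt (m%n<n s L) (sym e)

    h-low : ∀ t → x (α (h t)) ≤ lo
    h-low t = proj₁ (node-step path (t % L) (m%n<n t L))

    h-rot : ∀ t → Rot (φ (h t)) (h (suc t))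
    h-rot t = subst (Rot (φ (h t))) (sym (h-suc t)) (proj₂ (node-step path (t % L) (m%n<n t L)))

    h-periodic : ∀ t → h (t ℕ.+ L) ≡ h t
    h-periodic t = cong w ([m+n]%n≡m%n t L)

    not-crossed : ∀ s t → s ℕ.≤ t → t ℕ.< s ℕ.+ ℓ → (r : Rot (φ (h t)) (h (suc t))) → ¬ Corner (h s) r
    not-crossed s t s≤t t<s+ℓ r s∈ with split-rot r s∈
    ... | r₁ , r₂ = no-shortcut (t % L) (s % L) (m%n<n t L) (m%n<n s L) ne wrap r₁ (subst (Rot (h s)) (h-suc t) r₂)
      where
      differ : s % L ≢ suc t % L
      differ = remainders-differ ℓ s (suc t) (ℕ.s≤s s≤t) (ℕ.≤-trans (ℕ.s≤s t<s+ℓ) (ℕ.≤-reflexive (sym (ℕ.+-suc s ℓ))))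
      ne : s % L ≢ suc (t % L)
      ne e with suc-% t
      ... | inj₁ (_ , e') = differ (trans e (sym e'))
      ... | inj₂ (full , _) = ℕ.<-irrefl (trans e full) (m%n<n s L)
      wrap : ¬ (suc (t % L) ≡ L × s % L ≡ 0)
      wrap (full , z) with suc-% t
      ... | inj₁ (lt , _) = ℕ.<-irrefl full lt
      ... | inj₂ (_ , e') = differ (trans z (sym e'))

    Repeat : ℕ → ℕ → Set
    Repeat A m = vert (h (A ℕ.+ suc m)) ≡ vert (h A) ×
      (∀ a c → a ℕ.< c → c ℕ.≤ m → vert (h (A ℕ.+ a)) ≢ vert (h (A ℕ.+ c)))

    private
      cut : ∀ A m → Repeat A m → TightCycle φ₀ (λ k → h (A ℕ.+ k)) m
      cut A m (rep , dist) = TightLoop.tight-cycle d≤p φ₀ pos≥0 (λ k → h (A ℕ.+ k)) m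
        (λ k _ → g-rot k) (λ k _ → ℤ.≤-trans (h-low (A ℕ.+ k)) lo≤0)
        (sym (trans (rot-vert (g-rot m)) (vert-φ (h (A ℕ.+ m))))) (trans rep (cong (vert ∘ h) (sym (ℕ.+-identityʳ A)))) dist
        where
        g-rot : ∀ k → Rot (φ (h (A ℕ.+ k))) (h (A ℕ.+ suc k))
        g-rot k = subst (λ t → Rot (φ (h (A ℕ.+ k))) (h t)) (sym (ℕ.+-suc A k)) (h-rot (A ℕ.+ k))

      module LoopAt (A m : ℕ) (T : TightCycle φ₀ (λ k → h (A ℕ.+ k)) m) where
        open TightCycle T
        open Cycle M cycle hiding (m)

        -- A clockwise rotation leaves the left side only by crossing a cycle edge from its left,
        -- and then the crossed dart is some `he i`.
        stays : ∀ {c c'} (r : Rot c c') → (∀ y → Corner y r → ∀ i → he i ≢ y) → inside (face c) ≡ true → inside (face c') ≡ true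
        stays done _ y = y
        stays {c} (turn z r) avoid y with bool-cases (inside (face (α c)))
        ... | inj₁ y' = stays r (λ k k∈ → avoid k (inj₂ k∈)) (trans (cong inside (face-σ⁻ c)) y')
        ... | inj₂ z' with boundary-left y z'
        ...   | i , e = ⊥-elim (avoid c (inj₁ refl) i e)

        -- To leave the left side of the loop the walk would have to cross one of its darts,
        -- and could then be shortened.
        rest-inside : ∀ j → m ℕ.+ j ℕ.≤ ℓ → inside (face (h (A ℕ.+ m ℕ.+ j))) ≡ true
        rest-inside zero _ with time-he m ℕ.≤-refl
        ... | i , e = trans (cong (inside ∘ face) (trans (cong h (ℕ.+-identityʳ (A ℕ.+ m))) (sym e))) (inside-left i)
        rest-inside (suc j) m+j<ℓ = trans (cong (inside ∘ face ∘ h) (ℕ.+-suc (A ℕ.+ m) j))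
          (stays (h-rot t) avoid (trans (cong inside (face-φ (h t))) (rest-inside j (ℕ.≤-trans (ℕ.+-monoʳ-≤ m (ℕ.n≤1+n j)) m+j<ℓ))))
          where
          t : ℕ
          t = A ℕ.+ m ℕ.+ j
          avoid : ∀ y → Corner y (h-rot t) → ∀ i → he i ≢ y
          avoid y y∈ i e with he-time i
          ... | k , k≤m , e' = not-crossed (A ℕ.+ k) t
            (ℕ.≤-trans (ℕ.+-monoʳ-≤ A k≤m) (ℕ.m≤m+n (A ℕ.+ m) j))
            (ℕ.≤-trans (ℕ.≤-reflexive (trans (cong suc (ℕ.+-assoc A m j)) (sym (ℕ.+-suc A (m ℕ.+ j)))))
              (ℕ.≤-trans (ℕ.+-monoʳ-≤ A (ℕ.≤-trans (ℕ.≤-reflexive (sym (ℕ.+-suc m j))) m+j<ℓ)) (ℕ.+-monoˡ-≤ ℓ (ℕ.m≤m+n A k))))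
            (h-rot t) (subst (λ z → Corner z (h-rot t)) (trans (sym e) e') y∈)

        rest-inside′ : ∀ t → A ℕ.+ m ℕ.≤ t → t ℕ.≤ A ℕ.+ ℓ → inside (face (h t)) ≡ true
        rest-inside′ t lo′ hi with ℕ.m≤n⇒∃[o]m+o≡n lo′
        ... | j , refl = rest-inside j (ℕ.+-cancelˡ-≤ A (m ℕ.+ j) ℓ (ℕ.≤-trans (ℕ.≤-reflexive (sym (ℕ.+-assoc A m j))) hi))

      -- If the loop is the whole walk, the turn at its base is free too and the cost is the sum of
      -- the `x` terms, negative thanks to `b`. With the outer face on the right, the girth
      -- conditions make the cost non-negative.
      whole : TightCycle φ₀ h ℓ → ⊥
      whole T = ℤ.<⇒≱ cost<0 0≤cost
        where
        open TightCycle T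
        open Cycle M cycle hiding (m)
        open Cost φ₀ cycle using (cost; cost-inner; cost-neither)
        nonneg : ∀ i → 0ℤ ≤ - x (α (he i))
        nonneg i with he-time i
        ... | k , _ , e = ℤ.neg-mono-≤ (subst (λ z → x (α z) ≤ 0ℤ) (sym e) (ℤ.≤-trans (h-low k) lo≤0))
        cost<0 : cost < 0ℤ
        cost<0 with time-he 0 ℕ.z≤n
        ... | i , e = ℤ.neg-cancel-< (ℤ.<-≤-trans (ℤ.neg-mono-< x<0) (subst (- x (α (he i)) ≤_) total (∑-term≤ nonneg i)))
          where
          x<0 : x (α (he i)) < 0ℤ
          x<0 = ℤ.<-≤-trans (subst (λ k → x (α k) < lo) (sym (trans e (node-start path))) bad) lo≤0
          total : ∑ (λ i → - x (α (he i))) ≡ - cost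
          total = trans (∑-neg (λ i → x (α (he i)))) (cong -_ (sym (closed-cost (subst (Rot (φ (h ℓ))) (h-periodic 0) (h-rot ℓ)))))
        0≤cost : 0ℤ ≤ cost
        0≤cost with bool-cases (inside inner)
        ... | inj₁ y = subst (0ℤ ≤_) (sym (cost-inner y outer-right))
            (0≤-diff (ℤ.+≤+ (proj₁ (proj₂ inA) cycle (λ r → true≢false y (trans (sym (inside-~ r)) outer-right)))))
        ... | inj₂ z = subst (0ℤ ≤_) (sym (cost-neither z outer-right))
            (0≤-diff (ℤ.+≤+ (proj₁ inA cycle (λ sep → sep (same-side⇒~ (trans outer-right (sym z)))))))

      -- Each of the two loops lies on the left of the other, so that
      -- together their left sides cover everything, even the outer face.
      two-loops : ∀ A m B m' → TightCycle φ₀ (λ k → h (A ℕ.+ k)) m → TightCycle φ₀ (λ k → h (B ℕ.+ k)) m' →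
        A ℕ.+ m ℕ.< B → B ℕ.+ m' ℕ.≤ A ℕ.+ ℓ → ⊥
      two-loops A m B m' T₁ T₂ A+m<B B+m'≤A+ℓ =
        finish (dual-connected Covered across (face (C₁.he zero)) outer (inj₁ (C₁.inside-left zero)))
        where
        module T₁ = TightCycle T₁
        module T₂ = TightCycle T₂
        module C₁ = Cycle M T₁.cycle
        module C₂ = Cycle M T₂.cycle
        Covered : Fin F → Set
        Covered f = C₁.inside f ≡ true ⊎ C₂.inside f ≡ true
        finish : Covered outer → ⊥
        finish (inj₁ y) = true≢false y T₁.outer-right
        finish (inj₂ y) = true≢false y T₂.outer-right
        second-in-first : ∀ i → C₁.inside (face (C₂.he i)) ≡ true
        second-in-first i with T₂.he-time i
        ... | k , k≤m' , e = trans (cong (C₁.inside ∘ face) e) (LoopAt.rest-inside′ A m T₁ (B ℕ.+ k) (ℕ.≤-trans (ℕ.<⇒≤ A+m<B) (ℕ.m≤m+n B k))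
          (ℕ.≤-trans (ℕ.+-monoʳ-≤ B k≤m') B+m'≤A+ℓ))
        first-in-second : ∀ i → C₂.inside (face (C₁.he i)) ≡ true
        first-in-second i with T₁.he-time i
        ... | k , k≤m , e = trans (cong (C₂.inside ∘ face) (trans e (sym (h-periodic (A ℕ.+ k)))))
          (LoopAt.rest-inside′ B m' T₂ (A ℕ.+ k ℕ.+ L)
            (ℕ.≤-trans B+m'≤A+ℓ (ℕ.≤-trans (ℕ.+-monoˡ-≤ ℓ (ℕ.m≤m+n A k)) (ℕ.+-monoʳ-≤ (A ℕ.+ k) (ℕ.n≤1+n ℓ))))
            (ℕ.≤-trans (ℕ.≤-reflexive (ℕ.+-suc (A ℕ.+ k) ℓ)) (ℕ.+-monoˡ-≤ ℓ (ℕ.≤-trans (ℕ.s≤s (ℕ.+-monoʳ-≤ A k≤m)) A+m<B))))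
        disjoint : ∀ i j → C₁.he i ≢ C₂.he j
        disjoint i j e with T₁.he-time i | T₂.he-time j
        ... | k , k≤m , e₁ | l , l≤m' , e₂ = h-distinct (A ℕ.+ k) (B ℕ.+ l)
          (ℕ.≤-trans (ℕ.s≤s (ℕ.+-monoʳ-≤ A k≤m)) (ℕ.≤-trans A+m<B (ℕ.m≤m+n B l)))
          (ℕ.≤-trans (ℕ.s≤s (ℕ.≤-trans (ℕ.+-monoʳ-≤ B l≤m') B+m'≤A+ℓ))
            (ℕ.≤-trans (ℕ.≤-reflexive (sym (ℕ.+-suc A ℓ))) (ℕ.+-monoˡ-≤ L (ℕ.m≤m+n A k))))
          (trans (sym e₁) (trans e e₂))
        across : ∀ y → Covered (face y) → Covered (face (α y))
        across y c with bool-cases (C₁.inside (face (α y))) | bool-cases (C₂.inside (face (α y)))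
        across y c | inj₁ y₁ | _ = inj₁ y₁
        across y c | inj₂ _ | inj₁ y₂ = inj₂ y₂
        across y (inj₁ c) | inj₂ z₁ | inj₂ z₂ with C₁.boundary-left c z₁
        ... | i , e with C₂.boundary-left (trans (cong (C₂.inside ∘ face) (sym e)) (first-in-second i)) z₂
        ...   | j , e' = ⊥-elim (disjoint i j (trans e (sym e')))
        across y (inj₂ c) | inj₂ z₁ | inj₂ z₂ with C₂.boundary-left c z₂
        ... | j , e with C₁.boundary-left (trans (cong (C₁.inside ∘ face) (sym e)) (second-in-first j)) z₁
        ...   | i , e' = ⊥-elim (disjoint i j (trans e' (sym e)))

    -- A repeated vertex cuts a loop out of the walk. Unless this is a full period, the rest of the
    -- period is closed at the same vertex and contains a second loop, later than the first.
    impossible : ⊥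
    impossible with first-repeat ℓ (vert ∘ h) (cong vert (h-periodic 0))
    ... | A , m , A+m≤ℓ , rep , dist with ℕ.m≤n⇒m<n∨m≡n (ℕ.≤-trans (ℕ.m≤n+m m A) A+m≤ℓ)
    ...   | inj₂ refl = whole (subst (λ z → TightCycle φ₀ (λ k → h (z ℕ.+ k)) ℓ) A≡0 (cut A m (rep , dist)))
      where
      A≡0 : A ≡ 0
      A≡0 = ℕ.n≤0⇒n≡0 (ℕ.+-cancelʳ-≤ m A 0 A+m≤ℓ)
    ...   | inj₁ m<ℓ with first-repeat (ℓ ℕ.∸ suc m) (λ k → vert (h (A ℕ.+ suc m ℕ.+ k))) wraps
      where
      wraps : vert (h (A ℕ.+ suc m ℕ.+ suc (ℓ ℕ.∸ suc m))) ≡ vert (h (A ℕ.+ suc m ℕ.+ 0))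
      wraps = trans (cong (vert ∘ h) (trans (ℕ.+-assoc A (suc m) _) (cong (A ℕ.+_) (trans (ℕ.+-suc (suc m) _) (cong suc (ℕ.m+[n∸m]≡n m<ℓ))))))
        (trans (cong vert (h-periodic A)) (trans (sym rep) (cong (vert ∘ h) (sym (ℕ.+-identityʳ (A ℕ.+ suc m))))))
    ...     | i , m' , i+m'≤ , rep' , dist' = two-loops A m (A ℕ.+ suc m ℕ.+ i) m' (cut A m (rep , dist))
      (cut (A ℕ.+ suc m ℕ.+ i) m'
        (trans (cong (vert ∘ h) (ℕ.+-assoc (A ℕ.+ suc m) i (suc m'))) rep' ,
         λ a c a<c c≤m' e → dist' a c a<c c≤m' (trans (cong (vert ∘ h) (sym (ℕ.+-assoc (A ℕ.+ suc m) i a))) (trans e (cong (vert ∘ h) (ℕ.+-assoc (A ℕ.+ suc m) i c))))))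
      (ℕ.≤-trans (ℕ.≤-reflexive (sym (ℕ.+-suc A m))) (ℕ.m≤m+n (A ℕ.+ suc m) i))
      (ℕ.≤-trans (ℕ.≤-reflexive (trans (ℕ.+-assoc (A ℕ.+ suc m) i m') (ℕ.+-assoc A (suc m) (i ℕ.+ m'))))
        (ℕ.+-monoʳ-≤ A (ℕ.≤-trans (ℕ.+-monoʳ-≤ (suc m) i+m'≤) (ℕ.≤-reflexive (ℕ.m+[n∸m]≡n m<ℓ)))))

  opaque
    no-closed-walk : ∀ b → x (α b) < lo → ∀ k → ¬ Path b b (suc k)
    no-closed-walk b bad = <-rec (λ k → ¬ Path b b (suc k)) λ k rec path →
      Shortest.impossible b bad k path λ { (suc j) _ (ℕ.s≤s j<k) → rec j<k }

-- Changing the potential by one unit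

module Lowering (M : AnnularMap) (d p : ℕ) (φ₀ : Flows.Flow M d p)
                (pos≥0 : ∀ h → 0ℤ ≤ Flows.Flow.pos φ₀ h) (lo : ℤ) where
  open Flows M d p
  open Potentials M d p
  open Flow φ₀

  -- Every arc that leaves `S` has `pos` non-zero or `x` above `lo`, so it can afford to lose a
  -- unit.
  StepClosed : (Fin n → Bool) → Set
  StepClosed S = ∀ c → S c ≡ true →
    (pos c ≡ 0ℤ → S (σ⁻ c) ≡ true) × (x (α c) ≤ lo → S (φ c) ≡ true)

  closure : (Reached : Fin n → Set) →
    (∀ c → Reached c → pos c ≡ 0ℤ → Reached (σ⁻ c)) →
    (∀ c → Reached c → x (α c) ≤ lo → Reached (φ c)) →
    (S₀ : Fin n → Bool) → (∀ c → S₀ c ≡ true → Reached c) →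
    Σ (Fin n → Bool) λ S → ((∀ c → S₀ c ≡ true → S c ≡ true) × (∀ c → S c ≡ true → Reached c)) × StepClosed S
  closure Reached rotate along S₀ start = saturate Inv StepClosed next S₀ ((λ _ e → e) , start)
    where
    Inv : (Fin n → Bool) → Set
    Inv S = (∀ c → S₀ c ≡ true → S c ≡ true) × (∀ c → S c ≡ true → Reached c)
    extend : ∀ S → Inv S → ∀ w → S w ≡ false → Reached w → Σ (Fin n) (λ w → S w ≡ false × Inv (add w S))
    extend S (old , reached) w new rw = w , new , (λ c e → add-old w S (old c e)) , λ c e → Sum.[ (λ { refl → rw }) , reached c ]′ (add-inv w S e)
    next : ∀ S → Inv S → StepClosed S ⊎ Σ (Fin n) (λ w → S w ≡ false × Inv (add w S))
    next S inv with Fin.any? (λ c → (S c Bool.≟ true) ×-dec (((pos c ℤ.≟ 0ℤ) ×-dec (S (σ⁻ c) Bool.≟ false)) ⊎-dec ((x (α c) ℤ.≤? lo) ×-dec (S (φ c) Bool.≟ false))))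
    ... | yes (c , sc , inj₁ (z , new)) = inj₂ (extend S inv (σ⁻ c) new (rotate c (proj₂ inv c sc) z))
    ... | yes (c , sc , inj₂ (l , new)) = inj₂ (extend S inv (φ c) new (along c (proj₂ inv c sc) l))
    ... | no none = inj₁ λ c sc →
      (λ z → decide (λ new → none (c , sc , inj₁ (z , new)))) , (λ l → decide (λ new → none (c , sc , inj₂ (l , new))))
      where
      decide : ∀ {b} → b ≢ false → b ≡ true
      decide {true} _ = refl
      decide {false} ne = ⊥-elim (ne refl)

  module _ (S : Fin n → Bool) (closed : StepClosed S) where

    -- Arcs leaving `S` lose a unit and arcs entering `S` gain one; the others keep their price.
    potential : Fin n → ℤ
    potential c = - ⟦ S c ⟧

    lowered : Flow
    lowered = shift potential φ₀

    private
      change : ∀ a b c → a + (- b - - c) ≡ a + (c - b)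
      change = solve-∀

      one-less : ∀ {l a} b c → (b ≡ true → c ≡ false → 1ℤ + l ≤ a) → a ≤ a + (⟦ c ⟧ - ⟦ b ⟧) ⊎ l ≤ a + (⟦ c ⟧ - ⟦ b ⟧)
      one-less {a = a} true true _ = inj₁ (ℤ.≤-reflexive (sym (ℤ.+-identityʳ a)))
      one-less {a = a} false false _ = inj₁ (ℤ.≤-reflexive (sym (ℤ.+-identityʳ a)))
      one-less {a = a} false true _ = inj₁ (≤-from 0≤1 (lem a))
        where
        lem : ∀ a → a + (1ℤ - 0ℤ) - a ≡ 1ℤ
        lem = solve-∀
      one-less {l} {a} true false strict = inj₂ (≤-from (0≤-diff (strict refl refl)) (lem a l))
        where
        lem : ∀ a l → a + (0ℤ - 1ℤ) - l ≡ a - (1ℤ + l)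
        lem = solve-∀

    lowered-pos≥0 : ∀ h → 0ℤ ≤ Flow.pos lowered h
    lowered-pos≥0 h = subst (0ℤ ≤_) (sym (change (pos h) ⟦ S h ⟧ ⟦ S (σ⁻ h) ⟧))
      (Sum.[ ℤ.≤-trans (pos≥0 h) , id ]′ (one-less (S h) (S (σ⁻ h)) λ y z →
        0<⇒1≤ (nonneg-≢0 (pos≥0 h) (λ e → true≢false (proj₁ (closed h y) e) z))))

    lowered-x : ∀ c → Flow.x lowered (α c) ≡ x (α c) + (⟦ S (φ c) ⟧ - ⟦ S c ⟧)
    lowered-x c = trans (cong (λ k → x (α c) + (- ⟦ S k ⟧ - - ⟦ S (φ c) ⟧)) (αα c)) (change (x (α c)) ⟦ S c ⟧ ⟦ S (φ c) ⟧)

    lowered-x-cases : ∀ c → x (α c) ≤ Flow.x lowered (α c) ⊎ lo ≤ Flow.x lowered (α c)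
    lowered-x-cases c = subst (λ z → x (α c) ≤ z ⊎ lo ≤ z) (sym (lowered-x c))
      (one-less (S c) (S (φ c)) λ y z → <⇒1≤ (ℤ.≰⇒> (λ l → true≢false (proj₂ (closed c y) l) z)))

    lowered-x≥lo : ∀ c → lo ≤ x (α c) → lo ≤ Flow.x lowered (α c)
    lowered-x≥lo c l = Sum.[ ℤ.≤-trans l , id ]′ (lowered-x-cases c)

-- Existence of a non-negative flow

module Existence (M : AnnularMap) (d p : ℕ) (d≤p : d ℕ.≤ p) (inA : InA M d p) where
  open Flows M d p

  record FlowAbove (lo : ℤ) : Set where
    field
      flow : Flow
    open Flow flow public
    field
      pos≥0 : ∀ h → 0ℤ ≤ pos h
      x≥lo : ∀ c → lo ≤ x (α c)

  private
    good : ℤ → Flow → Fin n → Bool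
    good lo φ₀ c = does (lo ℤ.≤? Flow.x φ₀ (α c))

    module Fix (lo : ℤ) (lo≤0 : lo ≤ 0ℤ) (A : FlowAbove (lo - 1ℤ)) (b : Fin n) (bad : FlowAbove.x A (α b) < lo) where
      open FlowAbove A
      open Potentials M d p
      open Rotation flow
      open Walks M d p d≤p inA flow pos≥0 lo lo≤0
      open Lowering M d p flow pos≥0 lo

      Reached : Fin n → Set
      Reached c = Σ (Fin n) λ a → Σ ℕ λ k → Path b a k × x (α a) ≤ lo × Rot (φ a) c

      reached : Σ (Fin n → Bool) λ S → ((∀ c → does (φ b ≟ c) ≡ true → S c ≡ true) × (∀ c → S c ≡ true → Reached c)) × StepClosed S
      reached = closure Reached
        (λ { c (a , k , path , l , r) z → a , k , path , l , rot-trans r (turn z done) })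
        (λ { c (a , k , path , l , r) l' → c , k ℕ.+ 1 , path ++ₚ cons l r nil , l' , done })
        (λ c → does (φ b ≟ c)) (λ c e → b , 0 , nil , ℤ.<⇒≤ bad , subst (Rot (φ b)) (does-≡ e) done)

      S : Fin n → Bool
      S = proj₁ reached

      closed : StepClosed S
      closed = proj₂ (proj₂ reached)

      S-φb : S (φ b) ≡ true
      S-φb = proj₁ (proj₁ (proj₂ reached)) (φ b) (dec-true (φ b ≟ φ b) refl)

      -- If `b` could be reached from `φ b`, the violating arc would close a walk that the girth
      -- conditions exclude. So this arc enters `S`, gains a unit, and is repaired.
      S-b : S b ≡ false
      S-b with bool-cases (S b)
      ... | inj₂ z = z
      ... | inj₁ y with proj₂ (proj₁ (proj₂ reached)) b y
      ...   | a , k , path , l , r = ⊥-elim (no-closed-walk b bad k (subst (Path b b) (ℕ.+-comm k 1) (path ++ₚ cons l r nil)))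

      fixed : FlowAbove (lo - 1ℤ)
      fixed = record { flow = lowered S closed ; pos≥0 = lowered-pos≥0 S closed ; x≥lo = above }
        where
        above : ∀ c → lo - 1ℤ ≤ Flow.x (lowered S closed) (α c)
        above c with lowered-x-cases S closed c
        ... | inj₁ up = ℤ.≤-trans (x≥lo c) up
        ... | inj₂ l = ℤ.≤-trans (≤-from 0≤1 (lem lo)) l
          where
          lem : ∀ a → a - (a - 1ℤ) ≡ 1ℤ
          lem = solve-∀

      b-good : lo ≤ Flow.x (lowered S closed) (α b)
      b-good = ≤-from (0≤-diff (x≥lo b)) (trans (cong (_- lo) (trans (lowered-x S closed b) (cong₂ (λ u v → x (α b) + (⟦ u ⟧ - ⟦ v ⟧)) S-φb S-b))) (lem (x (α b)) lo))
        where
        lem : ∀ a l → a + (1ℤ - 0ℤ) - l ≡ a - (l - 1ℤ)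
        lem = solve-∀

      improves : defect (good lo (lowered S closed)) ℕ.< defect (good lo flow)
      improves = defect-strict (good lo flow) (good lo (lowered S closed))
        (λ c e → dec-true (lo ℤ.≤? _) (lowered-x≥lo S closed c (does-≤ e))) b (dec-false (lo ℤ.≤? _) (ℤ.<⇒≱ bad)) (dec-true (lo ℤ.≤? _) b-good)
        where
        does-≤ : ∀ {a b} → does (a ℤ.≤? b) ≡ true → a ≤ b
        does-≤ {a} {b} e with a ℤ.≤? b
        ... | yes p = p

    improve : ∀ lo → lo ≤ 0ℤ → FlowAbove (lo - 1ℤ) → FlowAbove lo
    improve lo lo≤0 A₀ = go (defect (good lo (FlowAbove.flow A₀))) A₀ ℕ.≤-refl
      where
      go : ∀ k (A : FlowAbove (lo - 1ℤ)) → defect (good lo (FlowAbove.flow A)) ℕ.≤ k → FlowAbove lo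
      by-cases : ∀ k (A : FlowAbove (lo - 1ℤ)) → defect (good lo (FlowAbove.flow A)) ℕ.≤ k →
        Dec (∃[ b ] FlowAbove.x A (α b) < lo) → FlowAbove lo
      go k A le = by-cases k A le (Fin.any? (λ b → FlowAbove.x A (α b) ℤ.<? lo))
      by-cases k A le (no none) = record { flow = FlowAbove.flow A ; pos≥0 = FlowAbove.pos≥0 A ; x≥lo = λ c → ℤ.≮⇒≥ (λ l → none (c , l)) }
      by-cases zero A le (yes (b , bad)) = ⊥-elim (ℕ.n≮0 (ℕ.≤-trans (Fix.improves lo lo≤0 A b bad) le))
      by-cases (suc k) A le (yes (b , bad)) = go k (Fix.fixed lo lo≤0 A b bad) (ℕ.s≤s⁻¹ (ℕ.≤-trans (Fix.improves lo lo≤0 A b bad) le))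

    descend : ∀ N → FlowAbove (- + N) → FlowAbove 0ℤ
    descend zero A = A
    descend (suc N) A = descend N (improve (- + N) (ℤ.neg-mono-≤ (ℤ.+≤+ ℕ.z≤n)) (subst FlowAbove (lem (+ N)) A))
      where
      lem : ∀ a → - (1ℤ + a) ≡ - a - 1ℤ
      lem = solve-∀

  opaque
    nonneg-flow : FlowAbove 0ℤ
    nonneg-flow = descend (proj₁ bound) (record { flow = base-flow ; pos≥0 = base-flow-pos ; x≥lo = proj₂ bound ∘ α })
      where
      open BaseFlow M d p
      bound : ∃[ N ] (∀ h → - + N ≤ Flow.x base-flow h)
      bound = lower-bound (Flow.x base-flow)

-- Maximal flows

module Maximal (M : AnnularMap) (d p : ℕ) where
  open Flows M d p
  open Potentials M d p

  record NonnegFlow : Set where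
    field
      flow : Flow
    open Flow flow public
    field
      pos≥0 : ∀ h → 0ℤ ≤ pos h
      x≥0 : ∀ h → 0ℤ ≤ x h

  -- The corners at distance 0 from the outer face, as witnessed by a walk. The form of the last two
  -- constructors is that of `StepClosed` with bound 0.
  data Tight (φ₀ : Flow) : Fin n → Set where
    start : ∀ {c} → face c ≡ outer → Tight φ₀ c
    rotate : ∀ {c} → Tight φ₀ c → Flow.pos φ₀ c ≡ 0ℤ → Tight φ₀ (σ⁻ c)
    along : ∀ {c} → Tight φ₀ c → Flow.x φ₀ (α c) ≤ 0ℤ → Tight φ₀ (φ c)

  private
    data Walk : Fin n → Set where
      start : ∀ {c} → face c ≡ outer → Walk c
      rotate : ∀ {c} → Walk c → Walk (σ⁻ c)
      along : ∀ {c} → Walk c → Walk (φ c)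

    -- Arcs may be followed in one direction only, but `σ` is an iterate of `σ⁻` on each orbit, and
    -- `α` is `φ` followed by `σ`.
    walks : ∀ c → Walk c
    walks c = dart-connected Walk turn-back cross (proj₁ (face-surj outer)) c (start (proj₂ (face-surj outer)))
      where
      unwind : ∀ k {z} → Walk (iter σ k z) → Walk z
      unwind zero w = w
      unwind (suc k) w = unwind k (subst Walk (σ⁻σ _) (rotate w))
      turn-back : ∀ h → Walk h → Walk (σ h)
      turn-back h w with Equivalence.to (vert-orbit (σ h) h) (vert-σ h)
      ... | k , e = unwind k (subst Walk (sym e) w)
      cross : ∀ h → Walk h → Walk (α h)
      cross h w = subst Walk (σσ⁻ (α h)) (turn-back (φ h) (along w))

    walk-cost : Flow → ∀ {c} → Walk c → ℤ
    walk-cost φ₀ (start _) = 0ℤ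
    walk-cost φ₀ (rotate {c} w) = walk-cost φ₀ w + Flow.pos φ₀ c
    walk-cost φ₀ (along {c} w) = walk-cost φ₀ w + Flow.x φ₀ (α c)

    telescope : ∀ w k a b c → (w + (k - a)) + (b + (a - c)) ≡ (w + b) + (k - c)
    telescope = solve-∀

    walk-cost-shift : ∀ φ₀ π k → (∀ c → face c ≡ outer → π c ≡ k) →
      ∀ {c} (w : Walk c) → walk-cost (shift π φ₀) w ≡ walk-cost φ₀ w + (k - π c)
    walk-cost-shift φ₀ π k base {c} (start e) = sym (trans (ℤ.+-identityˡ (k - π c)) (trans (cong (_-_ k) (base c e)) (ℤ.+-inverseʳ k)))
    walk-cost-shift φ₀ π k base (rotate {c} w) = trans (cong (_+ Flow.pos (shift π φ₀) c) (walk-cost-shift φ₀ π k base w))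
      (telescope (walk-cost φ₀ w) k (π c) (Flow.pos φ₀ c) (π (σ⁻ c)))
    walk-cost-shift φ₀ π k base (along {c} w) = trans (cong₂ _+_ (walk-cost-shift φ₀ π k base w) (cong (λ z → Flow.x φ₀ (α c) + (π z - π (σ⁻ (α c)))) (αα c)))
      (telescope (walk-cost φ₀ w) k (π c) (Flow.x φ₀ (α c)) (π (φ c)))

    -- The termination measure. As the potential of `c` rises against that of the outer face, the
    -- cost of the fixed walk to `c` falls by the same amount; it stays non-negative with the flow.
    total : Flow → ℤ
    total φ₀ = ∑ (λ c → walk-cost φ₀ (walks c))

    walk-cost≥0 : (A : NonnegFlow) → ∀ {c} (w : Walk c) → 0ℤ ≤ walk-cost (NonnegFlow.flow A) w
    walk-cost≥0 A (start _) = ℤ.≤-refl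
    walk-cost≥0 A (rotate w) = 0≤-+ (walk-cost≥0 A w) (NonnegFlow.pos≥0 A _)
    walk-cost≥0 A (along w) = 0≤-+ (walk-cost≥0 A w) (NonnegFlow.x≥0 A _)

    module Raise (A : NonnegFlow) where
      open NonnegFlow A
      open Lowering M d p flow pos≥0 0ℤ

      reached : Σ (Fin n → Bool) λ S → ((∀ c → does (face c ≟ outer) ≡ true → S c ≡ true) × (∀ c → S c ≡ true → Tight flow c)) × StepClosed S
      reached = closure (Tight flow) (λ _ → rotate) (λ _ → along) (λ c → does (face c ≟ outer)) (λ c e → start (does-≡ e))

      S : Fin n → Bool
      S = proj₁ reached

      closed : StepClosed S
      closed = proj₂ (proj₂ reached)

      S-outer : ∀ c → face c ≡ outer → S c ≡ true
      S-outer c e = proj₁ (proj₁ (proj₂ reached)) c (dec-true (face c ≟ outer) e)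

      raised : NonnegFlow
      raised = record { flow = lowered S closed ; pos≥0 = lowered-pos≥0 S closed
                      ; x≥0 = λ h → subst (λ k → 0ℤ ≤ Flow.x (lowered S closed) k) (αα h) (lowered-x≥lo S closed (α h) (x≥0 _)) }

      decreases : ∀ c → S c ≡ false → 1ℤ + total (lowered S closed) ≤ total flow
      decreases c z = ≤-from (0≤-diff (subst (_≤ ∑ (λ k → 1ℤ - ⟦ S k ⟧)) (cong (λ b → 1ℤ - ⟦ b ⟧) z) (∑-term≤ (λ k → 0≤-diff (⟦⟧≤1 (S k))) c)))
        (eq₁ change (lem (total flow) (total (lowered S closed)) (∑ (λ k → 1ℤ - ⟦ S k ⟧))))
        where
        pw : ∀ k → walk-cost (lowered S closed) (walks k) ≡ walk-cost flow (walks k) - (1ℤ - ⟦ S k ⟧)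
        pw k = trans (walk-cost-shift flow (potential S closed) (- 1ℤ) (λ c e → cong (λ b → - ⟦ b ⟧) (S-outer c e)) (walks k)) (lem₁ (walk-cost flow (walks k)) ⟦ S k ⟧)
          where
          lem₁ : ∀ w s → w + (- 1ℤ - - s) ≡ w - (1ℤ - s)
          lem₁ = solve-∀
        change : total flow - ∑ (λ k → 1ℤ - ⟦ S k ⟧) ≡ total (lowered S closed)
        change = sym (trans (∑-cong pw) (∑-- _ _))
        lem : ∀ t t' s → (t - (1ℤ + t')) - (s - (1ℤ - 0ℤ)) ≡ (t - s) - t'
        lem = solve-∀

    go : ∀ k (A : NonnegFlow) → total (NonnegFlow.flow A) ≤ + k → Σ NonnegFlow λ B → ∀ c → Tight (NonnegFlow.flow B) c
    by-cases : ∀ k (A : NonnegFlow) → total (NonnegFlow.flow A) ≤ + k → Dec (∃[ c ] Raise.S A c ≡ false) →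
      Σ NonnegFlow λ B → ∀ c → Tight (NonnegFlow.flow B) c
    go k A le = by-cases k A le (Fin.any? (λ c → Raise.S A c Bool.≟ false))
    by-cases k A le (no none) = A , λ c → proj₂ (proj₁ (proj₂ (Raise.reached A))) c (decide c)
      where
      decide : ∀ c → Raise.S A c ≡ true
      decide c with bool-cases (Raise.S A c)
      ... | inj₁ y = y
      ... | inj₂ z = ⊥-elim (none (c , z))
    by-cases zero A le (yes (c , z)) = ⊥-elim (1≰0 (ℤ.≤-trans (subst (_≤ 1ℤ + total (NonnegFlow.flow (Raise.raised A))) (ℤ.+-identityʳ 1ℤ)
      (ℤ.+-monoʳ-≤ 1ℤ (∑-nonneg (λ k → walk-cost≥0 (Raise.raised A) (walks k))))) (ℤ.≤-trans (Raise.decreases A c z) le)))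
    by-cases (suc k) A le (yes (c , z)) = go k (Raise.raised A) (≤-from (0≤-diff (ℤ.≤-trans (Raise.decreases A c z) le)) (lem (+ k) (total (NonnegFlow.flow (Raise.raised A)))))
      where
      lem : ∀ k t → k - t ≡ (1ℤ + k) - (1ℤ + t)
      lem = solve-∀

  opaque
    maximal : NonnegFlow → Σ NonnegFlow λ B → ∀ c → Tight (NonnegFlow.flow B) c
    maximal A = go ℤ.∣ total (NonnegFlow.flow A) ∣ A
      (ℤ.≤-reflexive (sym (ℤ.0≤i⇒+∣i∣≡i (∑-nonneg (λ k → walk-cost≥0 A (walks k))))))

  module Consequences (A : NonnegFlow) (tight : ∀ c → Tight (NonnegFlow.flow A) c) where
    open NonnegFlow A

    -- The last arc of a free walk to the corner `σ⁻ h`, on the right of `h`, either crosses `h`,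
    -- which `0ℤ < pos h` forbids, or runs along the right side of `h` at price `x h`. The walk is
    -- not empty because this corner is not in the outer face.
    tight-complementary : ∀ h → face (α h) ≢ outer → 0ℤ < pos h → x h ≡ 0ℤ
    tight-complementary h ne 0<p = last-step (tight (σ⁻ h)) refl
      where
      last-step : ∀ {c} → Tight flow c → c ≡ σ⁻ h → x h ≡ 0ℤ
      last-step (start e) refl = ⊥-elim (ne (trans (sym (face-σ⁻ h)) e))
      last-step (rotate {c} _ z) e = ⊥-elim (ℤ.<-irrefl (sym (subst (λ k → pos k ≡ 0ℤ) (trans (sym (σσ⁻ c)) (trans (cong σ e) (σσ⁻ h))) z)) 0<p)
      last-step (along {c} _ l) e = ℤ.≤-antisym (subst (λ k → x k ≤ 0ℤ) (trans (sym (σσ⁻ (α c))) (trans (cong σ e) (σσ⁻ h))) l) (x≥0 h)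

    -- A free walk from the outer face to the left side of `C` has to enter it, and advances stay in
    -- their face; so some rotation crosses an `α (he i)` for free.
    tight-no-ccw : (C : SimpleCycle M) → Cycle.inside M C outer ≡ false → ∃[ i ] pos (α (SimpleCycle.he C i)) ≡ 0ℤ
    tight-no-ccw C outside = enters (tight (he zero)) (inside-left zero)
      where
      open Cycle M C
      enters : ∀ {c} → Tight flow c → inside (face c) ≡ true → ∃[ i ] pos (α (he i)) ≡ 0ℤ
      enters (start e) y = ⊥-elim (true≢false (trans (cong inside (sym e)) y) outside)
      enters (along {c} t _) y = enters t (trans (cong inside (sym (face-φ c))) y)
      enters (rotate {c} t z) y with bool-cases (inside (face c))
      ... | inj₁ y' = enters t y'
      ... | inj₂ z' with boundary-left {α c} (trans (cong inside (sym (face-σ⁻ c))) y) (trans (cong (inside ∘ face) (αα c)) z')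
      ...   | i , e = i , trans (cong pos (trans (cong α e) (αα c))) z

-- What a non-negative flow forces on the outer face

module OuterAnalysis (M : AnnularMap) (d p : ℕ) (0<d : 0 ℕ.< d) (degree-outer : faceDeg M (AnnularMap.outer M) ≡ p)
                     (A : Maximal.NonnegFlow M d p) where
  open Flows M d p
  open Maximal.NonnegFlow A

  outerFace : Fin F → Bool
  outerFace f = does (f ≟ outer)

  o o′ e : Fin n → Bool
  o h = outerFace (face h)
  o′ h = outerFace (face (α h))
  e h = o h ∨ o′ h

  ov : Fin V → Bool
  ov v = does (outerVertex? M v)

  private
    e-α : ∀ h → e (α h) ≡ e h
    e-α h = trans (cong (λ k → o′ h ∨ outerFace (face k)) (αα h)) (Bool.∨-comm (o′ h) (o h))

    o⇒e : ∀ {h} → o h ≡ true → e h ≡ true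
    o⇒e {h} y = cong (_∨ o′ h) y

    e⇒ov : ∀ h → e h ≡ true → ov (vert h) ≡ true
    e⇒ov h y with face h ≟ outer | face (α h) ≟ outer
    ... | yes l | _ = dec-true (outerVertex? M (vert h)) (h , refl , l)
    ... | no _ | yes r = dec-true (outerVertex? M (vert h)) (σ⁻ h , vert-σ⁻ h , trans (face-σ⁻ h) r)

    Q X Epos v : ℤ
    Q = ∑ (λ h → ⟦ e h ⟧)
    X = ∑ (λ h → ⟦ e h ⟧ * x h)
    Epos = ∑ (λ h → ⟦ e h ⟧ * pos h)
    v = ∑ (λ u → ⟦ ov u ⟧)

    ⟦⟧-mono : ∀ {a b} → (a ≡ true → b ≡ true) → ⟦ a ⟧ ≤ ⟦ b ⟧
    ⟦⟧-mono {true} imp rewrite imp refl = ℤ.≤-refl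
    ⟦⟧-mono {false} {b} _ = 0≤⟦⟧ b

    scale : ∀ {a b c} → a ≤ b → 0ℤ ≤ c → a * c ≤ b * c
    scale {a} {b} {c} a≤b 0≤c = ≤-from (0≤-* (0≤-diff a≤b) 0≤c) (lem a b c)
      where
      lem : ∀ a b c → b * c - a * c ≡ (b - a) * c
      lem = solve-∀

    ∑o : ∑ (λ h → ⟦ o h ⟧) ≡ P
    ∑o = trans (sym (degree outer)) (cong +_ degree-outer)

    ∑o′ : ∑ (λ h → ⟦ o′ h ⟧) ≡ P
    ∑o′ = trans (∑-α (λ h → ⟦ o h ⟧)) ∑o

    o+o′ : ∑ (λ h → ⟦ o h ⟧ + ⟦ o′ h ⟧) ≡ P + P
    o+o′ = trans (∑-+ _ _) (cong₂ _+_ ∑o ∑o′)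

    e≤o+o′ : ∀ h → ⟦ e h ⟧ ≤ ⟦ o h ⟧ + ⟦ o′ h ⟧
    e≤o+o′ h with o h | o′ h
    ... | true | true = ℤ.+≤+ (ℕ.s≤s ℕ.z≤n)
    ... | true | false = ℤ.≤-refl
    ... | false | true = ℤ.≤-refl
    ... | false | false = ℤ.≤-refl

    Q≤2P : Q ≤ P + P
    Q≤2P = subst (Q ≤_) o+o′ (∑-mono e≤o+o′)

    inflow-outer : ∑ (λ h → ⟦ o′ h ⟧ * x h) ≡ P + P
    inflow-outer = trans (at-face outer) (trans supply-outer (cong (λ g → + g + P) degree-outer))

    o′≤e : ∀ h → ⟦ o′ h ⟧ * x h ≤ ⟦ e h ⟧ * x h
    o′≤e h = scale (⟦⟧-mono (λ y → trans (cong (o h ∨_) y) (Bool.∨-zeroʳ (o h)))) (x≥0 h)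

    2P≤X : P + P ≤ X
    2P≤X = subst (_≤ X) inflow-outer (∑-mono o′≤e)

    vertex-total : ∑ (λ h → ⟦ ov (vert h) ⟧ * pos h) ≡ v * D
    vertex-total = trans (sym (∑-fibre vert (λ u → ⟦ ov u ⟧) pos)) (trans (∑-cong (λ u → cong (_*_ ⟦ ov u ⟧) (at-vertex u))) (∑-*ʳ D (λ u → ⟦ ov u ⟧)))

    e≤ov : ∀ h → ⟦ e h ⟧ * pos h ≤ ⟦ ov (vert h) ⟧ * pos h
    e≤ov h = scale (⟦⟧-mono (e⇒ov h)) (pos≥0 h)

    Epos≤ : Epos ≤ v * D
    Epos≤ = subst (Epos ≤_) vertex-total (∑-mono e≤ov)

    edge-total : + 2 * Epos ≡ (D - + 2) * Q + + 2 * X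
    edge-total = EdgeSum.edge-sum flow (λ h → ⟦ e h ⟧) (λ h → cong ⟦_⟧ (e-α h))

    -- The outer edges span the outer vertices, and not all of them lie in a
    -- spanning tree, since the contour of the outer face is a non-zero cycle.
    2v≤Q : v + v ≤ Q
    2v≤Q with Primal.spanning (λ u → does (r ≟ u)) e
      where
      r : Fin V
      r = vert (proj₁ (face-surj outer))
    ... | S , T , t , closed with Fin.any? (λ h → (Primal.μ T h ℤ.≟ 0ℤ) ×-dec ¬? ((⟦ o h ⟧ - ⟦ o′ h ⟧) ℤ.≟ 0ℤ))
    -- Otherwise the boundary of the outer face is divergence-free and supported on a tree, hence
    -- zero, and no edge would separate the outer face from another face.
    ...   | no none = ⊥-elim (inner≢outer (does-≡ (dual-connected (λ f → outerFace f ≡ true) across outer inner (dec-true (outer ≟ outer) refl))))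
      where
      g : Fin n → ℤ
      g h = ⟦ o h ⟧ - ⟦ o′ h ⟧
      g≡0 : ∀ h → g h ≡ 0ℤ
      g≡0 = Primal.vanish g
        (λ h → trans (cong (λ k → ⟦ o′ h ⟧ - ⟦ outerFace (face k) ⟧) (αα h)) (flip-- ⟦ o′ h ⟧ ⟦ o h ⟧))
        (λ u _ → boundary-vertex (λ f → ⟦ outerFace f ⟧) u) t supp
        where
        supp : ∀ h → Primal.μ T h ≡ 0ℤ → g h ≡ 0ℤ
        supp h z with g h ℤ.≟ 0ℤ
        ... | yes g0 = g0
        ... | no g≢0 = ⊥-elim (none (h , z , g≢0))
      across : ∀ h → o h ≡ true → o′ h ≡ true
      across h y with bool-cases (o′ h)
      ... | inj₁ y' = y'
      ... | inj₂ z' with trans (sym (cong₂ (λ a b → ⟦ a ⟧ - ⟦ b ⟧) y z')) (g≡0 h)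
      ...   | ()
    ...   | yes (k , μk , gk) = ≤-from (0≤-+ (0≤-+ (0≤-diff bound) (0≤-diff ov≤S)) (0≤-diff ov≤S))
        (eq₁ total (lem Q v (∑ (λ u → ⟦ S u ⟧)) (∑ (λ h → Primal.μ T h + (δ k h + δ (α k) h)))))
      where
      r : Fin V
      r = vert (proj₁ (face-surj outer))
      ek : e k ≡ true
      ek with o k | o′ k
      ... | true | _ = refl
      ... | false | true = refl
      ... | false | false = ⊥-elim (gk refl)
      pw : ∀ h → Primal.μ T h + (δ k h + δ (α k) h) ≤ ⟦ e h ⟧
      pw h with k ≟ h | α k ≟ h
      ... | yes refl | yes q = ⊥-elim (α-free k q)
      ... | yes refl | no _ = subst₂ _≤_ (sym (cong (_+ 1ℤ) μk)) (sym (cong ⟦_⟧ ek)) ℤ.≤-refl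
      ... | no _ | yes refl = subst₂ _≤_ (sym (cong (_+ 1ℤ) (trans (Primal.μ-sym T k) μk))) (sym (cong ⟦_⟧ (trans (e-α k) ek))) ℤ.≤-refl
      ... | no _ | no _ = subst (_≤ ⟦ e h ⟧) (sym (ℤ.+-identityʳ (Primal.μ T h))) μ≤e
        where
        μ≤e : Primal.μ T h ≤ ⟦ e h ⟧
        μ≤e with bool-cases (e h)
        ... | inj₂ z = subst₂ _≤_ (sym (Primal.μ-ok e-α t z)) (sym (cong ⟦_⟧ z)) ℤ.≤-refl
        ... | inj₁ y with Primal.μ-01 t h
        ...   | inj₁ m0 = subst₂ _≤_ (sym m0) (sym (cong ⟦_⟧ y)) 0≤1
        ...   | inj₂ m1 = subst₂ _≤_ (sym m1) (sym (cong ⟦_⟧ y)) ℤ.≤-refl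
      bound : ∑ (λ h → Primal.μ T h + (δ k h + δ (α k) h)) ≤ Q
      bound = ∑-mono pw
      total : ∑ (λ h → Primal.μ T h + (δ k h + δ (α k) h)) ≡ + 2 * ∑ (λ u → ⟦ S u ⟧)
      total = trans (∑-+ (Primal.μ T) (λ h → δ k h + δ (α k) h)) (trans (cong₂ _+_
        (trans (Primal.tree-count t) (cong (λ z → + 2 * (∑ (λ u → ⟦ S u ⟧) - z)) (∑-δ₁ r)))
        (trans (∑-+ (δ k) (δ (α k))) (cong₂ _+_ (∑-δ₁ k) (∑-δ₁ (α k))))) (lem₂ (∑ (λ u → ⟦ S u ⟧))))
        where
        lem₂ : ∀ s → + 2 * (s - 1ℤ) + (1ℤ + 1ℤ) ≡ + 2 * s
        lem₂ = solve-∀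
      S-outer : ∀ h → face h ≡ outer → S (vert h) ≡ true
      S-outer h l = proj₂ (around-face (λ y → face y ≡ outer × S (vert y) ≡ true) advance (trans (proj₂ (face-surj outer)) (sym l))
        (proj₂ (face-surj outer) , Primal.roots⊆ t (dec-true (r ≟ r) refl)))
        where
        advance : ∀ y → face y ≡ outer × S (vert y) ≡ true → face (φ y) ≡ outer × S (vert (φ y)) ≡ true
        advance y (l' , s) = trans (face-φ y) l' , trans (cong S (vert-φ y)) (closed y (o⇒e (dec-true (face y ≟ outer) l')) s)
      ov⇒S : ∀ u → ov u ≡ true → S u ≡ true
      ov⇒S u y with outerVertex? M u
      ... | yes (h , refl , l) = S-outer h l
      ov≤S : v ≤ ∑ (λ u → ⟦ S u ⟧)
      ov≤S = ∑-mono (λ u → ⟦⟧-mono (ov⇒S u))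
      lem : ∀ q v s t → (q - (v + v)) - (((q - t) + (s - v)) + (s - v)) ≡ t - + 2 * s
      lem = solve-∀

    0≤D : 0ℤ ≤ D
    0≤D = ℤ.+≤+ ℕ.z≤n

    halve : ∀ {a b} → + 2 * a ≤ + 2 * b → a ≤ b
    halve {a} {b} = ℤ.*-cancelˡ-≤-pos a b (+ 2)

    -- From `2 v D ≥ 2 Epos = (D - 2) Q + 2 X ≥ (D - 2) Q + 4 P` and `2 v ≤ Q` follows `2 Q ≥ 4
    -- P`. With `Q ≤ 2 P` the whole chain collapses to equalities, and each of them is then read off
    -- term by term.
    2P≤Q : P + P ≤ Q
    2P≤Q = halve (≤-from (0≤-+ (0≤-+ (0≤-+ (0≤-diff Epos≤) (0≤-diff Epos≤)) (0≤-+ (0≤-diff 2P≤X) (0≤-diff 2P≤X))) (0≤-* (0≤-diff 2v≤Q) 0≤D))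
      (eq₁ edge-total (lem Q P Epos v D X)))
      where
      lem : ∀ q p e v d x → (+ 2 * q - + 2 * (p + p)) - ((((v * d - e) + (v * d - e)) + ((x - (p + p)) + (x - (p + p)))) + (q - (v + v)) * d) ≡ + 2 * e - ((d - + 2) * q + + 2 * x)
      lem = solve-∀

    Q≡2P : Q ≡ P + P
    Q≡2P = ℤ.≤-antisym Q≤2P 2P≤Q

    P≤v : P ≤ v
    P≤v = ℤ.*-cancelʳ-≤-pos P v D {{ℤ.positive (ℤ.+<+ 0<d)}} (halve
      (≤-from (0≤-+ (0≤-+ (0≤-diff Epos≤) (0≤-diff Epos≤)) (0≤-+ (0≤-diff 2P≤X) (0≤-diff 2P≤X)))
        (eq₂ edge-total (cong (_*_ (D - + 2)) Q≡2P) (lem Q P Epos v D X))))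
      where
      lem : ∀ q p e v d x → (+ 2 * (v * d) - + 2 * (p * d)) - (((v * d - e) + (v * d - e)) + ((x - (p + p)) + (x - (p + p)))) ≡
        (+ 2 * e - ((d - + 2) * q + + 2 * x)) + ((d - + 2) * q - (d - + 2) * (p + p))
      lem = solve-∀

    v≡P : v ≡ P
    v≡P = ℤ.≤-antisym (halve (≤-from (0≤-diff 2v≤Q) (eq₁ (sym Q≡2P) (lem Q v P)))) P≤v
      where
      lem : ∀ q v p → (+ 2 * p - + 2 * v) - (q - (v + v)) ≡ (p + p) - q
      lem = solve-∀

    X≤2P : X ≤ P + P
    X≤2P = halve (≤-from (0≤-+ (0≤-diff Epos≤) (0≤-diff Epos≤)) (eq₃ edge-total (cong (_*_ (D - + 2)) Q≡2P) (cong (_*_ (- + 2 * D)) v≡P) (lem Q P Epos v D X)))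
      where
      lem : ∀ q p e v d x → (+ 2 * (p + p) - + 2 * x) - ((v * d - e) + (v * d - e)) ≡
        (+ 2 * e - ((d - + 2) * q + + 2 * x)) + ((d - + 2) * q - (d - + 2) * (p + p)) + (- + 2 * d * v - - + 2 * d * p)
      lem = solve-∀

    vD≤Epos : v * D ≤ Epos
    vD≤Epos = halve (≤-from (0≤-+ (0≤-diff 2P≤X) (0≤-diff 2P≤X)) (eq₃ edge-total (cong (_*_ (D - + 2)) Q≡2P) (cong (_*_ (- + 2 * D)) v≡P) (lem Q P Epos v D X)))
      where
      lem : ∀ q p e v d x → (+ 2 * e - + 2 * (v * d)) - ((x - (p + p)) + (x - (p + p))) ≡
        (+ 2 * e - ((d - + 2) * q + + 2 * x)) + ((d - + 2) * q - (d - + 2) * (p + p)) + (- + 2 * d * v - - + 2 * d * p)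
      lem = solve-∀

  one-sided : ∀ h → face h ≡ outer → face (α h) ≢ outer
  one-sided h l r = 1≢2 (trans (sym once) (trans (∑-tight e≤o+o′ (subst (_≤ Q) (sym o+o′) 2P≤Q) h) twice))
    where
    1≢2 : 1ℤ ≢ + 2
    1≢2 ()
    once : ⟦ e h ⟧ ≡ 1ℤ
    once = cong ⟦_⟧ (o⇒e {h} (dec-true (face h ≟ outer) l))
    twice : ⟦ o h ⟧ + ⟦ o′ h ⟧ ≡ + 2
    twice = cong₂ (λ a b → ⟦ a ⟧ + ⟦ b ⟧) (dec-true (face h ≟ outer) l) (dec-true (face (α h) ≟ outer) r)

  pos-outer-vertex : ∀ h → ¬ OuterHE M h → OuterVertex M (vert h) → pos h ≡ 0ℤ
  pos-outer-vertex h i o-v = trans (sym (ℤ.*-identityˡ (pos h))) (trans (cong (λ b → ⟦ b ⟧ * pos h) (sym (dec-true (outerVertex? M (vert h)) o-v)))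
    (trans (sym (∑-tight e≤ov (subst (_≤ Epos) (sym vertex-total) vD≤Epos) h))
      (cong (λ b → ⟦ b ⟧ * pos h) (cong₂ _∨_ (dec-false (face h ≟ outer) (i ∘ inj₁)) (dec-false (face (α h) ≟ outer) (i ∘ inj₂))))))

  x-outer : ∀ h → face h ≡ outer → x h ≡ 0ℤ
  x-outer h l = sym (trans (cong (λ b → ⟦ b ⟧ * x h) (sym (dec-false (face (α h) ≟ outer) (one-sided h l))))
    (trans (∑-tight o′≤e (subst (X ≤_) (sym inflow-outer) X≤2P) h)
      (trans (cong (λ b → ⟦ b ⟧ * x h) (o⇒e (dec-true (face h ≟ outer) l))) (ℤ.*-identityˡ (x h)))))

  -- Every outer vertex has an outer corner, and there are `P` outer corners and at least `P` outer
  -- vertices; so no vertex has two.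
  contour-simple : OuterContourSimple M
  contour-simple = (λ h h' l l' vv → injective h h' l l' vv (h ≟ h')) , one-sided
    where
    count : Fin V → ℤ
    count u = ∑ (λ k → δ (vert k) u * ⟦ o k ⟧)
    term≥0 : ∀ u k → 0ℤ ≤ δ (vert k) u * ⟦ o k ⟧
    term≥0 u k = 0≤-* (0≤δ (vert k) u) (0≤⟦⟧ (o k))
    outer-term : ∀ {h u} → vert h ≡ u → face h ≡ outer → δ (vert h) u * ⟦ o h ⟧ ≡ 1ℤ
    outer-term {h} {u} refl l = cong₂ (λ a b → a * ⟦ b ⟧) (δ-refl (vert h)) (dec-true (face h ≟ outer) l)
    ov≤count : ∀ u → ⟦ ov u ⟧ ≤ count u
    ov≤count u with outerVertex? M u
    ... | no _ = ∑-nonneg (term≥0 u)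
    ... | yes (h , vh , l) = subst (_≤ count u) (outer-term vh l) (∑-term≤ (term≥0 u) h)
    tightness : ∀ u → ⟦ ov u ⟧ ≡ count u
    tightness = ∑-tight ov≤count (subst (_≤ v) (sym (trans (∑-fibre₁ vert (λ k → ⟦ o k ⟧)) ∑o)) P≤v)
    injective : ∀ h h' → face h ≡ outer → face h' ≡ outer → vert h ≡ vert h' → Dec (h ≡ h') → h ≡ h'
    injective h h' l l' vv (yes q) = q
    injective h h' l l' vv (no ne) = ⊥-elim (2≰1 (ℤ.≤-trans two≤ (subst (_≤ 1ℤ) (tightness (vert h)) (⟦⟧≤1 (ov (vert h))))))
      where
      2≰1 : ¬ + 2 ≤ 1ℤ
      2≰1 (ℤ.+≤+ (ℕ.s≤s ()))
      pw : ∀ k → δ h k + δ h' k ≤ δ (vert k) (vert h) * ⟦ o k ⟧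
      pw k with h ≟ k | h' ≟ k
      ... | yes refl | yes q = ⊥-elim (ne (sym q))
      ... | yes refl | no _ = ℤ.≤-reflexive (sym (outer-term refl l))
      ... | no _ | yes refl = ℤ.≤-reflexive (sym (outer-term (sym vv) l'))
      ... | no _ | no _ = term≥0 (vert h) k
      two≤ : + 2 ≤ count (vert h)
      two≤ = subst (_≤ count (vert h)) (trans (∑-+ (δ h) (δ h')) (cong₂ _+_ (∑-δ₁ h) (∑-δ₁ h'))) (∑-mono pw)

-- The orientation of a maximal flow

inOf : (onOuter acrossOuter positive : Bool) → Bool
inOf true _ _ = false
inOf false true _ = true
inOf false false b = b

wtOf : (onOuter acrossOuter : Bool) → ℤ → ℤ
wtOf true _ w = 0ℤ
wtOf false true w = 1ℤ
wtOf false false w = w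

module FlowOrientation (M : AnnularMap) (d p q : ℕ) (0<d : 0 ℕ.< d) (type : HasType M p q)
  (A : Maximal.NonnegFlow M d p) (tight : ∀ c → Maximal.Tight M d p (Maximal.NonnegFlow.flow A) c) where
  open Flows M d p
  open Maximal M d p
  open NonnegFlow A
  open Consequences A tight
  open OuterAnalysis M d p 0<d (proj₁ type) A

  open EdgeKind M

  opaque
    kind : ∀ h → Kind h
    kind = kindOf one-sided

  -- The contour is directed clockwise with the prescribed weights 0 and 1, whatever values the flow
  -- has on it; only inner edges are read off the flow.
  into : Fin n → Bool
  into h = inOf (does (face h ≟ outer)) (does (face (α h) ≟ outer)) (does (0ℤ ℤ.<? pos h))

  weight : Fin n → ℤ
  weight h = wtOf (does (face h ≟ outer)) (does (face (α h) ≟ outer)) (pos h - x h)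

  into-L : ∀ {h} → face h ≡ outer → into h ≡ false
  into-L {h} l = cong (λ b → inOf b (does (face (α h) ≟ outer)) (does (0ℤ ℤ.<? pos h))) (dec-true (face h ≟ outer) l)

  weight-L : ∀ {h} → face h ≡ outer → weight h ≡ 0ℤ
  weight-L {h} l = cong (λ b → wtOf b (does (face (α h) ≟ outer)) (pos h - x h)) (dec-true (face h ≟ outer) l)

  into-R : ∀ {h} → face h ≢ outer → face (α h) ≡ outer → into h ≡ true
  into-R {h} nl r = cong₂ (λ b b' → inOf b b' (does (0ℤ ℤ.<? pos h))) (dec-false (face h ≟ outer) nl) (dec-true (face (α h) ≟ outer) r)

  weight-R : ∀ {h} → face h ≢ outer → face (α h) ≡ outer → weight h ≡ 1ℤ
  weight-R {h} nl r = cong₂ (λ b b' → wtOf b b' (pos h - x h)) (dec-false (face h ≟ outer) nl) (dec-true (face (α h) ≟ outer) r)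

  into-inner : ∀ {h} → ¬ OuterHE M h → into h ≡ does (0ℤ ℤ.<? pos h)
  into-inner {h} i = cong₂ (λ b b' → inOf b b' (does (0ℤ ℤ.<? pos h))) (dec-false (face h ≟ outer) (i ∘ inj₁)) (dec-false (face (α h) ≟ outer) (i ∘ inj₂))

  weight-inner : ∀ {h} → ¬ OuterHE M h → weight h ≡ pos h - x h
  weight-inner {h} i = cong₂ (λ b b' → wtOf b b' (pos h - x h)) (dec-false (face h ≟ outer) (i ∘ inj₁)) (dec-false (face (α h) ≟ outer) (i ∘ inj₂))

  data Sign (h : Fin n) : Set where
    positive : into h ≡ true → 0ℤ < pos h → x h ≡ 0ℤ → weight h ≡ pos h → Sign h
    nonpositive : into h ≡ false → pos h ≡ 0ℤ → weight h ≡ - x h → Sign h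

  sign : ∀ h → ¬ OuterHE M h → Sign h
  sign h i with 0ℤ ℤ.<? pos h
  ... | yes 0<p = positive (trans (into-inner i) (dec-true (0ℤ ℤ.<? pos h) 0<p)) 0<p x0
      (trans (weight-inner i) (trans (cong (_-_ (pos h)) x0) (ℤ.+-identityʳ (pos h))))
    where
    x0 : x h ≡ 0ℤ
    x0 = tight-complementary h (i ∘ inj₂) 0<p
  ... | no np = nonpositive (trans (into-inner i) (dec-false (0ℤ ℤ.<? pos h) np)) p0
      (trans (weight-inner i) (trans (cong (_- x h) p0) (ℤ.+-identityˡ (- x h))))
    where
    p0 : pos h ≡ 0ℤ
    p0 = ℤ.≤-antisym (ℤ.≮⇒≥ np) (pos≥0 h)

  weight-in : ∀ h → into h ≡ true → 0ℤ < weight h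
  weight-in h y with kind h
  ... | outerL l _ = ⊥-elim (true≢false y (into-L l))
  ... | outerR nl r = subst (0ℤ <_) (sym (weight-R nl r)) (ℤ.+<+ (ℕ.s≤s ℕ.z≤n))
  ... | innerE i with sign h i
  ...   | positive _ 0<p _ w = subst (0ℤ <_) (sym w) 0<p
  ...   | nonpositive z _ _ = ⊥-elim (true≢false y z)

  weight-out : ∀ h → into h ≡ false → weight h ≤ 0ℤ
  weight-out h z with kind h
  ... | outerL l _ = ℤ.≤-reflexive (weight-L l)
  ... | outerR nl r = ⊥-elim (true≢false (into-R nl r) z)
  ... | innerE i with sign h i
  ...   | positive y _ _ _ = ⊥-elim (true≢false y z)
  ...   | nonpositive _ _ w = subst (_≤ 0ℤ) (sym w) (ℤ.neg-mono-≤ (x≥0 h))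

  orientation : ZBiorientation M
  orientation = record { ingoing = into ; wt = weight ; wt-in = weight-in ; wt-out = weight-out }

  admissible : Admissible M orientation
  admissible = contour-simple , one-way , in-weight , out-weight , inner-out
    where
    one-way : ∀ h → OuterHE M h → into h ≢ into (α h)
    one-way h (inj₁ l) e = true≢false (trans e (into-R (one-sided h l) (trans (cong face (αα h)) l))) (into-L l)
    one-way h (inj₂ r) e = true≢false (into-R (λ l → one-sided h l r) r) (trans e (into-L r))
    in-weight : ∀ h → OuterHE M h → into h ≡ true → weight h ≡ + 1
    in-weight h (inj₁ l) y = ⊥-elim (true≢false y (into-L l))
    in-weight h (inj₂ r) y = weight-R (λ l → one-sided h l r) r
    out-weight : ∀ h → OuterHE M h → into h ≡ false → weight h ≡ + 0
    out-weight h (inj₁ l) z = weight-L l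
    out-weight h (inj₂ r) z = ⊥-elim (true≢false (into-R (λ l → one-sided h l r) r) z)
    inner-out : ∀ h → ¬ OuterHE M h → OuterVertex M (vert h) → into h ≡ false
    inner-out h i o-v with sign h i
    ... | positive _ 0<p _ _ = ⊥-elim (ℤ.<-irrefl (sym (pos-outer-vertex h i o-v)) 0<p)
    ... | nonpositive z _ _ = z

  d-orientation : DOrientation M d p q orientation
  d-orientation = admissible , small , edges , vertices , faces , (proj₂ type , inner-face)
    where
    open ZBiorientation orientation using (edgeWeight; vertWeight; faceWeight)
    pos≤D : ∀ h → pos h ≤ D
    pos≤D h = subst₂ _≤_ (trans (cong (_* pos h) (δ-refl (vert h))) (ℤ.*-identityˡ (pos h))) (at-vertex (vert h))
      (∑-term≤ (λ k → 0≤-* (0≤δ (vert k) (vert h)) (pos≥0 k)) h)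
    three : ∀ {a} → 0ℤ ≤ a → a ≤ + 2 → - a ≡ + 0 ⊎ - a ≡ - (+ 1) ⊎ - a ≡ - (+ 2)
    three {+ 0} _ _ = inj₁ refl
    three {+ 1} _ _ = inj₂ (inj₁ refl)
    three {+ 2} _ _ = inj₂ (inj₂ refl)
    three {+ suc (suc (suc _))} _ (ℤ.+≤+ (ℕ.s≤s (ℕ.s≤s ())))
    small : ∀ h → into h ≡ false → weight h ≡ + 0 ⊎ weight h ≡ - (+ 1) ⊎ weight h ≡ - (+ 2)
    small h z with kind h
    ... | outerL l _ = inj₁ (weight-L l)
    ... | outerR nl r = ⊥-elim (true≢false (into-R nl r) z)
    ... | innerE i with sign h i
    ...   | positive y _ _ _ = ⊥-elim (true≢false y z)
    -- Here `pos h` is 0 and `pos (α h)` is at most the vertex total `D`, so that the edge total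
    -- `D - 2` leaves at most 2 for `x h`.
    ...   | nonpositive _ p0 w = subst (λ a → a ≡ + 0 ⊎ a ≡ - (+ 1) ⊎ a ≡ - (+ 2)) (sym w) (three (x≥0 h)
        (≤-from (0≤-+ (0≤-diff (pos≤D (α h))) (x≥0 (α h))) (eq₂ (sym p0) (at-edge h) (lem (pos h) (pos (α h)) (x h) (x (α h)) D))))
      where
      lem : ∀ a b u v d → (+ 2 - u) - ((d - b) + v) ≡ (0ℤ - a) + ((a + b) - (d - + 2 + (u + v)))
      lem = solve-∀
    edges : ∀ h → ¬ OuterHE M h → weight h + weight (α h) ≡ D - + 2
    edges h i = trans (cong₂ _+_ (weight-inner i) (weight-inner (innerE-α i))) (eq₁ (at-edge h) (lem (pos h) (pos (α h)) (x h) (x (α h)) (D - + 2)))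
      where
      lem : ∀ a b u v k → ((a - u) + (b - v)) - k ≡ (a + b) - (k + (u + v))
      lem = solve-∀
    vertices : ∀ v → ¬ OuterVertex M v → vertWeight v ≡ D
    vertices v nv = trans (sum-filter id (λ h → into h ∧ does (vert h ≟ v)) weight) (trans (∑-cong pw) (at-vertex v))
      where
      pw : ∀ h → ⟦ into h ∧ does (vert h ≟ v) ⟧ * weight h ≡ δ (vert h) v * pos h
      pw h with vert h ≟ v
      ... | no _ = cong (λ b → ⟦ b ⟧ * weight h) (Bool.∧-zeroʳ (into h))
      ... | yes refl with sign h (λ o → nv (outerHE⇒outer-vertex o))
      ...   | positive y _ _ w = cong₂ (λ b c → ⟦ b ∧ true ⟧ * c) y w
      ...   | nonpositive z p0 _ = trans (cong (λ b → ⟦ b ∧ true ⟧ * weight h) z) (sym (cong (_*_ 1ℤ) p0))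
    face-total : ∀ f → f ≢ outer → faceWeight f ≡ - supply f
    face-total f nf = trans (sum-filter id (λ h → not (into h) ∧ does (face (α h) ≟ f)) weight)
      (trans (∑-cong pw) (trans (∑-neg (λ h → δ (face (α h)) f * x h)) (cong -_ (at-face f))))
      where
      pw : ∀ h → ⟦ not (into h) ∧ does (face (α h) ≟ f) ⟧ * weight h ≡ - (δ (face (α h)) f * x h)
      pw h with face (α h) ≟ f
      ... | no _ = cong (λ b → ⟦ b ⟧ * weight h) (Bool.∧-zeroʳ (not (into h)))
      ... | yes refl with kind h
      ...   | outerR _ r = ⊥-elim (nf r)
      ...   | outerL l _ = trans (cong₂ (λ b w → ⟦ not b ∧ true ⟧ * w) (into-L l) (weight-L l)) (sym (cong (λ z → - (1ℤ * z)) (x-outer h l)))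
      ...   | innerE i with sign h i
      ...     | positive y _ x0 _ = trans (cong (λ b → ⟦ not b ∧ true ⟧ * weight h) y) (sym (cong (λ z → - (1ℤ * z)) x0))
      ...     | nonpositive z _ w = trans (cong₂ (λ b c → ⟦ not b ∧ true ⟧ * c) z w) (lem (x h))
        where
        lem : ∀ a → 1ℤ * - a ≡ - (1ℤ * a)
        lem = solve-∀
    faces : ∀ f → f ≢ outer → f ≢ inner → + faceDeg M f + faceWeight f ≡ D
    faces f nf ni = trans (cong (_+_ (+ faceDeg M f)) (trans (face-total f nf) (cong -_ (supply-other nf ni)))) (lem (+ faceDeg M f) D)
      where
      lem : ∀ g d → g + - (g - d) ≡ d
      lem = solve-∀
    inner-face : faceWeight inner ≡ P - + q
    inner-face = trans (face-total inner inner≢outer) (trans (cong -_ (trans supply-inner (cong (λ g → + g - P) (proj₂ type)))) (lem (+ q) P))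
      where
      lem : ∀ q p → - (q - p) ≡ p - q
      lem = solve-∀

  minimal : Minimal M orientation
  minimal C (traversable , ccw) with bool-cases (Cycle.inside M C outer)
  ... | inj₁ y = ccw (Cycle.inside⇒left M C y)
  ... | inj₂ outside with tight-no-ccw C outside
  ...   | i , p0 with kind (α (SimpleCycle.he C i))
  ...     | outerL l _ = true≢false (traversable i) (into-L l)
  ...     | outerR _ r = true≢false (trans (cong (Cycle.inside M C) (sym (trans (sym (cong face (αα _))) r))) (Cycle.inside-left M C i)) outside
  ...     | innerE i′ with sign _ i′
  ...       | positive _ 0<p _ _ = ℤ.<-irrefl (sym p0) 0<p
  ...       | nonpositive z _ _ = true≢false (traversable i) z

  clockwise : ∀ k → face k ≡ outer → into (α k) ≡ true
  clockwise k l = into-R (one-sided k l) (trans (cong face (αα k)) l)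

-- Two flows differ by a potential

module Difference (M : AnnularMap) (d p : ℕ) where
  open Flows M d p

  private
    φ-injective : ∀ {h k} → φ h ≡ φ k → h ≡ k
    φ-injective {h} {k} e = trans (sym (ασ-φ h)) (trans (cong (α ∘ σ) e) (ασ-φ k))

    δ-φ : ∀ c h → δ (φ c) (φ h) ≡ δ c h
    δ-φ c h with c ≟ h
    ... | yes e = δ-yes (cong φ e)
    ... | no ne = δ-no (ne ∘ φ-injective)

    base : Fin F → Fin n
    base f = proj₁ (face-surj f)

    -- A unit mass moved along a face changes by a coboundary of `φ`; `λ′` records the corners
    -- passed.
    Cohomologous : Fin n → Fin n → Set
    Cohomologous b c = Σ (Fin n → ℤ) λ λ′ → ∀ h → λ′ h - λ′ (φ h) ≡ δ c h - δ b h

    cohomologous : ∀ c → Cohomologous (base (face c)) c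
    cohomologous c = around-face (Cohomologous b) advance (proj₂ (face-surj (face c)))
      ((λ _ → 0ℤ) , λ h → sym (ℤ.+-inverseʳ (δ b h)))
      where
      b = base (face c)
      advance : ∀ y → Cohomologous b y → Cohomologous b (φ y)
      advance y (λ′ , good) = (λ h → λ′ h + δ (φ y) h) , λ h → eq₂ (good h) (sym (δ-φ y h)) (lem (λ′ h) (λ′ (φ h)) (δ (φ y) h) (δ (φ y) (φ h)) (δ y h) (δ b h))
        where
        lem : ∀ l l' u u' w z → ((l + u) - (l' + u')) - (u - z) ≡ ((l - l') - (w - z)) + (w - u')
        lem = solve-∀

    -- Each value `β c` is moved to the base corner of its face. There the values of one face add up
    -- to 0, so the weighted sum of the moves has coboundary `β`.
    integrate : (β : Fin n → ℤ) → (∀ f → ∑ (λ h → δ (face h) f * β h) ≡ 0ℤ) →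
      Σ (Fin n → ℤ) λ Λ → ∀ h → Λ h - Λ (φ h) ≡ β h
    integrate β zero-sum = (λ h → ∑ (λ c → β c * l c h)) , good
      where
      l : Fin n → Fin n → ℤ
      l c = proj₁ (cohomologous c)
      good : ∀ h → ∑ (λ c → β c * l c h) - ∑ (λ c → β c * l c (φ h)) ≡ β h
      good h = begin
        ∑ (λ c → β c * l c h) - ∑ (λ c → β c * l c (φ h))   ≡⟨ sym (∑-- _ _) ⟩
        ∑ (λ c → β c * l c h - β c * l c (φ h))
          ≡⟨ ∑-cong (λ c → trans (lem (β c) (l c h) (l c (φ h))) (trans (cong (_*_ (β c)) (trans (proj₂ (cohomologous c) h) (cong (_- δ (base (face c)) h) (δ-sym c h)))) (lem₂ (β c) (δ h c) (δ (base (face c)) h)))) ⟩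
        ∑ (λ c → δ h c * β c - δ (base (face c)) h * β c)   ≡⟨ ∑-- _ _ ⟩
        ∑ (λ c → δ h c * β c) - ∑ (λ c → δ (base (face c)) h * β c)
          ≡⟨ cong₂ _-_ (∑-δ h β) (trans (sym (∑-fibre face (λ f → δ (base f) h) β)) (∑-zero (λ f → trans (cong (_*_ (δ (base f) h)) (zero-sum f)) (ℤ.*-zeroʳ (δ (base f) h))))) ⟩
        β h - 0ℤ ≡⟨ ℤ.+-identityʳ (β h) ⟩
        β h ∎
        where
        open ≡-Reasoning
        lem : ∀ b u v → b * u - b * v ≡ b * (u - v)
        lem = solve-∀
        lem₂ : ∀ b u v → b * (u - v) ≡ u * b - v * b
        lem₂ = solve-∀

  module _ (A B : Flow) where
    private
      module A = Flow A
      module B = Flow B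
      a b : Fin n → ℤ
      a h = B.pos h - A.pos h
      b h = B.x h - A.x h
      b-zero : ∀ f → ∑ (λ h → δ (face h) f * b (α h)) ≡ 0ℤ
      b-zero f = trans (sym (∑-α (λ h → δ (face h) f * b (α h))))
        (trans (∑-cong (λ h → trans (cong (λ k → δ (face (α h)) f * b k) (αα h)) (*-distribˡ-- (δ (face (α h)) f) (B.x h) (A.x h))))
          (trans (∑-- _ _) (trans (cong₂ _-_ (B.at-face f) (A.at-face f)) (ℤ.+-inverseʳ (supply f)))))
      Λ : Fin n → ℤ
      Λ = proj₁ (integrate (b ∘ α) b-zero)
      Λ-step : ∀ h → Λ (α h) - Λ (σ⁻ h) ≡ b h
      Λ-step h = trans (cong (λ k → Λ (α h) - Λ (σ⁻ k)) (sym (αα h))) (trans (proj₂ (integrate (b ∘ α) b-zero) (α h)) (cong b (αα h)))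
      ω : Fin n → ℤ
      ω h = a h - (Λ h - Λ (σ⁻ h))
      anti : ∀ h → ω (α h) ≡ - ω h
      anti h = eq₃ (cong₂ _-_ (B.at-edge h) (A.at-edge h)) (sym (Λ-step h)) (sym (trans (cong (λ k → Λ k - Λ (σ⁻ (α h))) (sym (αα h))) (Λ-step (α h))))
        (lem (A.pos h) (A.pos (α h)) (B.pos h) (B.pos (α h)) (A.x h) (A.x (α h)) (B.x h) (B.x (α h)) (Λ h) (Λ (σ⁻ h)) (Λ (α h)) (Λ (σ⁻ (α h))) (D - + 2))
        where
        lem : ∀ p p' q q' u u' v v' l s l' s' k →
          ((q' - p') - (l' - s')) - - ((q - p) - (l - s)) ≡
          (((q + q') - (p + p')) - ((k + (v + v')) - (k + (u + u')))) + ((v - u) - (l' - s)) + ((v' - u') - (l - s'))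
        lem = solve-∀
      div : ∀ v → ∑ (λ h → δ (vert h) v * ω h) ≡ 0ℤ
      div v = trans (∑-cong (λ h → lem (δ (vert h) v) (B.pos h) (A.pos h) (Λ h) (Λ (σ⁻ h))))
        (trans (∑-- _ _) (cong₂ _-_
          (trans (∑-- _ _) (trans (cong₂ _-_ (B.at-vertex v) (A.at-vertex v)) (ℤ.+-inverseʳ D)))
          (trans (∑-- _ _) (trans (cong (_-_ (∑ (λ h → δ (vert h) v * Λ h)))
            (trans (∑-cong (λ h → cong (λ u → δ u v * Λ (σ⁻ h)) (sym (vert-σ⁻ h)))) (∑-σ⁻ (λ h → δ (vert h) v * Λ h)))) (ℤ.+-inverseʳ (∑ (λ h → δ (vert h) v * Λ h)))))))
        where
        lem : ∀ k u v l s → k * ((u - v) - (l - s)) ≡ (k * u - k * v) - (k * l - k * s)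
        lem = solve-∀
      θ : Fin F → ℤ
      θ = proj₁ (exact ω anti div)

    opaque
      -- `Λ` settles the differences of `x`, and adding a function of the face does not disturb
      -- them, because `α h` and `σ⁻ h` lie in one face. The remaining difference `ω` of `pos` is
      -- antisymmetric by the edge law and divergence-free by the vertex law, so `exact` provides
      -- that function.
      gap : Fin n → ℤ
      gap h = Λ h + θ (face h)

      gap-pos : ∀ h → B.pos h - A.pos h ≡ gap h - gap (σ⁻ h)
      gap-pos h = eq₁ (sym (proj₂ (exact ω anti div) h)) (trans (cong (λ f → a h - ((Λ h + θ (face h)) - (Λ (σ⁻ h) + θ f))) (face-σ⁻ h))
        (lem (a h) (Λ h) (Λ (σ⁻ h)) (θ (face h)) (θ (face (α h)))))
        where
        lem : ∀ a l s t u → a - ((l + t) - (s + u)) ≡ (a - (l - s)) - (t - u)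
        lem = solve-∀

      gap-x : ∀ h → B.x h - A.x h ≡ gap (α h) - gap (σ⁻ h)
      gap-x h = eq₁ (sym (Λ-step h)) (trans (cong (λ f → b h - ((Λ (α h) + θ (face (α h))) - (Λ (σ⁻ h) + θ f))) (face-σ⁻ h))
        (lem (b h) (Λ (α h)) (Λ (σ⁻ h)) (θ (face (α h)))))
        where
        lem : ∀ a l s t → a - ((l + t) - (s + t)) ≡ a - (l - s)
        lem = solve-∀

-- Backward walks from a corner to the outer cycle

module Anchoring (M : AnnularMap) (d p q : ℕ) (0<d : 0 ℕ.< d) (d≤p : d ℕ.≤ p) (type : HasType M p q)
  (O : ZBiorientation M) (DO : DOrientation M d p q O) (minimal : Minimal M O) where
  open Flows M d p
  open Potentials M d p
  open OrientationFlow M d p q type O DO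
  open Rotation flow
  open ZBiorientation O

  -- One derivation serves two purposes: traversability in `along` gives accessibility, and the
  -- vanishing prices compare the potentials of two flows. All corners at outer vertices are allowed
  -- as a start.
  data Anchored : Fin n → Set where
    base : ∀ {c} → OuterVertex M (vert c) → Anchored c
    rotate : ∀ {c} → Anchored c → pos c ≡ 0ℤ → Anchored (σ⁻ c)
    along : ∀ {c} → Anchored c → ingoing (α c) ≡ true → x (α c) ≡ 0ℤ → Anchored (φ c)

  private
    inner-at : ∀ {v} → ¬ OuterVertex M v → ∀ {h} → vert h ≡ v → ¬ OuterHE M h
    inner-at nv refl o = nv (outerHE⇒outer-vertex o)

    -- y is the first ingoing dart counterclockwise from the corner h.
    Source : Fin n → Fin n → Set
    Source h y = 0ℤ < pos y × vert y ≡ vert h × Rot (σ⁻ y) h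

    source : ∀ h → Σ (Fin n) (Source h)
    source h = finish (Fin.any? (λ y → (vert y ≟ vert h) ×-dec (0ℤ ℤ.<? pos y)))
      where
      vert-iter : ∀ k → vert (iter σ k h) ≡ vert h
      vert-iter zero = refl
      vert-iter (suc k) = trans (vert-σ _) (vert-iter k)
      Zeros : ℕ → Set
      Zeros k = ∀ j → j ℕ.< k → pos (iter σ (suc j) h) ≡ 0ℤ
      search : ∀ k → (Rot (iter σ k h) h × Zeros k) ⊎ Σ (Fin n) (Source h)
      search zero = inj₁ (done , λ _ ())
      search (suc k) with search k
      ... | inj₂ found = inj₂ found
      ... | inj₁ (r , zs) with 0ℤ ℤ.<? pos (iter σ (suc k) h)
      ...   | yes 0<p = inj₂ (iter σ (suc k) h , 0<p , vert-iter (suc k) , subst (λ c → Rot c h) (sym (σ⁻σ _)) r)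
      ...   | no np = inj₁ (turn z (subst (λ c → Rot c h) (sym (σ⁻σ _)) r) , zs′)
        where
        z : pos (iter σ (suc k) h) ≡ 0ℤ
        z = ℤ.≤-antisym (ℤ.≮⇒≥ np) (pos≥0 _)
        zs′ : Zeros (suc k)
        zs′ j (ℕ.s≤s j≤k) with ℕ.m≤n⇒m<n∨m≡n j≤k
        ... | inj₁ j<k = zs j j<k
        ... | inj₂ refl = z
      commute : ∀ k → iter σ k (σ h) ≡ σ (iter σ k h)
      commute zero = refl
      commute (suc k) = cong σ (commute k)
      from : ∀ y → vert y ≡ vert h → 0ℤ < pos y → Σ (Fin n) (Source h)
      from y vy 0<p with Equivalence.to (vert-orbit (σ h) y) (trans (vert-σ h) (sym vy))
      -- `y` is `iter σ (suc k) h`, the last dart that `search (suc k)` examines, since the search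
      -- starts at `σ h`.
      ... | k , e with search (suc k)
      ...   | inj₂ found = found
      ...   | inj₁ (_ , zs) = ⊥-elim (ℤ.<-irrefl (sym (trans (cong pos (trans (sym e) (commute k))) (zs k ℕ.≤-refl))) 0<p)
      finish : Dec (∃[ y ] (vert y ≡ vert h × 0ℤ < pos y)) → Σ (Fin n) (Source h)
      finish (yes (y , vy , 0<p)) = from y vy 0<p
      finish (no none) = ⊥-elim (ℤ.<-irrefl (trans (sym (∑-zero no-weight)) (Flow.at-vertex flow (vert h))) (ℤ.+<+ 0<d))
        where
        no-weight : ∀ y → δ (vert y) (vert h) * pos y ≡ 0ℤ
        no-weight y with vert y ≟ vert h
        ... | no _ = refl
        ... | yes vy = trans (ℤ.*-identityˡ (pos y)) (ℤ.≤-antisym (ℤ.≮⇒≥ (λ 0<p → none (y , vy , 0<p))) (pos≥0 y))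

    back : Fin n → Fin n
    back h = α (proj₁ (source h))

    back-rot : ∀ h → Rot (φ (back h)) h
    back-rot h = subst (λ c → Rot (σ⁻ c) h) (sym (αα _)) (proj₂ (proj₂ (proj₂ (source h))))

    back-in : ∀ h → ¬ OuterVertex M (vert h) → ingoing (α (back h)) ≡ true
    back-in h nv = trans (cong ingoing (αα _)) (pos>0⇒in (inner-at nv (proj₁ (proj₂ (proj₂ (source h))))) (proj₁ (proj₂ (source h))))

    back-x : ∀ h → ¬ OuterVertex M (vert h) → x (α (back h)) ≡ 0ℤ
    back-x h nv = trans (cong x (αα _)) (complementary _ (inner-at nv (proj₁ (proj₂ (proj₂ (source h))))) (proj₁ (proj₂ (source h))))

    anchored-rot : ∀ {c c'} → Rot c c' → Anchored c → Anchored c'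
    anchored-rot done a = a
    anchored-rot (turn z r) a = anchored-rot r (rotate a z)

    module From (h : Fin n) where
      g : ℕ → Fin n
      g zero = h
      g (suc k) = back (g k)

      unwind : ∀ k → Anchored (g k) → Anchored h
      unwind zero a = a
      unwind (suc k) a with outerVertex? M (vert (g k))
      ... | yes o-v = unwind k (base o-v)
      ... | no nv = unwind k (anchored-rot (back-rot (g k)) (along a (back-in (g k) nv) (back-x (g k) nv)))

      module _ (s t' : ℕ) (e : vert (g s) ≡ vert (g (suc (s ℕ.+ t'))))
               (inner-upto : ∀ k → k ℕ.≤ suc (s ℕ.+ t') → ¬ OuterVertex M (vert (g k))) where
        t : ℕ
        t = suc (s ℕ.+ t')
        w : ℕ → Fin n
        w k = g (t ℕ.∸ k)
        closes : vert (w (suc t')) ≡ vert (w 0)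
        closes = trans (cong (vert ∘ g) (ℕ.m+n∸n≡m s t')) e
        w-step : ∀ k → k ℕ.≤ t' → w k ≡ back (w (suc k))
        w-step k k≤t' = cong g (ℕ.+-∸-assoc 1 (ℕ.≤-trans k≤t' (ℕ.m≤n+m t' s)))
        inner-w : ∀ k → ¬ OuterVertex M (vert (w k))
        inner-w k = inner-upto (t ℕ.∸ k) (ℕ.m∸n≤m t k)

        -- Read forwards, the repeated stretch of the backward walk is a tight loop, so the outer
        -- face is on its right. As all its edges are traversable, it is a counterclockwise circuit.
        no-loop : Repeats t' (vert ∘ w) → ⊥
        no-loop (i , m , i+m≤t' , rep , dist) = minimal cycle (traversable , ccw)
          where
          within : ∀ k → k ℕ.≤ m → i ℕ.+ k ℕ.≤ t'
          within k k≤m = ℕ.≤-trans (ℕ.+-monoʳ-≤ i k≤m) i+m≤t'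
          rot : ∀ k → k ℕ.≤ m → Rot (φ (w (i ℕ.+ k))) (w (i ℕ.+ suc k))
          rot k k≤m = subst₂ (λ a b → Rot (φ a) (w b)) (sym (w-step (i ℕ.+ k) (within k k≤m))) (sym (ℕ.+-suc i k)) (back-rot (w (suc (i ℕ.+ k))))
          T : TightCycle flow (λ k → w (i ℕ.+ k)) m
          T = TightLoop.tight-cycle d≤p flow pos≥0 (λ k → w (i ℕ.+ k)) m (λ k k<m → rot k (ℕ.<⇒≤ k<m))
            (λ k k≤m → ℤ.≤-reflexive (trans (cong (x ∘ α) (w-step (i ℕ.+ k) (within k k≤m))) (back-x (w (suc (i ℕ.+ k))) (inner-w (suc (i ℕ.+ k))))))
            (sym (trans (rot-vert (rot m ℕ.≤-refl)) (vert-φ (w (i ℕ.+ m)))))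
            (trans rep (cong (vert ∘ w) (sym (ℕ.+-identityʳ i)))) dist
          open TightCycle T
          traversable : ∀ j → ingoing (α (SimpleCycle.he cycle j)) ≡ true
          traversable j with he-time j
          ... | k , k≤m , e' = trans (cong (ingoing ∘ α) (trans e' (w-step (i ℕ.+ k) (within k k≤m)))) (back-in (w (suc (i ℕ.+ k))) (inner-w (suc (i ℕ.+ k))))
          ccw : ¬ DualReach M cycle (face (SimpleCycle.he cycle zero)) outer
          ccw r = true≢false (Cycle.left⇒inside M cycle r) outer-right

        contradiction′ : ⊥
        contradiction′ = no-loop (first-repeat t' (vert ∘ w) closes)

      early : ¬ (Σ (Fin (suc V)) λ k → OuterVertex M (vert (g (toℕ k)))) → ∀ k → k ℕ.< suc V → ¬ OuterVertex M (vert (g k))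
      early none k k<V o-v = none (Fin.fromℕ< k<V , subst (λ j → OuterVertex M (vert (g j))) (sym (Fin.toℕ-fromℕ< k<V)) o-v)

      anchored-from : Anchored h
      anchored-from with Fin.any? (λ (k : Fin (suc V)) → outerVertex? M (vert (g (toℕ k))))
      ... | yes (k , o-v) = unwind (toℕ k) (base o-v)
      ... | no none with Fin.pigeonhole (ℕ.n<1+n V) (λ k → vert (g (toℕ k)))
      ...   | s , t , s<t , e with ℕ.m≤n⇒∃[o]m+o≡n s<t
      ...     | t' , eq = ⊥-elim (contradiction′ (toℕ s) t' (trans e (cong (vert ∘ g) (sym eq)))
        (λ k k≤t → early none k (ℕ.≤-trans (ℕ.s≤s (ℕ.≤-trans k≤t (ℕ.≤-reflexive eq))) (Fin.toℕ<n t))))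

  opaque
    anchored : ∀ c → Anchored c
    anchored = From.anchored-from

  -- Rotations keep the vertex and advances are traversable, so a start on the contour suffices; the
  -- contour is a directed circuit and leads to that start.
  accessible : (∀ k → face k ≡ outer → ingoing (α k) ≡ true) → ∀ v → OuterVertex M v → AccessibleFrom M O v
  accessible clockwise v (k₀ , refl , l₀) u with vert-surj u
  ... | c , refl = to-corner (anchored c)
    where
    to-outer : ∀ k → face k ≡ outer → Reach M O v (vert k)
    to-outer k l = proj₂ (around-face (λ y → face y ≡ outer × Reach M O v (vert y)) advance (trans l₀ (sym l)) (l₀ , Reach.here))
      where
      advance : ∀ y → face y ≡ outer × Reach M O v (vert y) → face (φ y) ≡ outer × Reach M O v (vert (φ y))
      advance y (l' , r) = trans (face-φ y) l' , subst (Reach M O v) (sym (vert-φ y)) (Reach.step r (clockwise y l'))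
    to-corner : ∀ {c} → Anchored c → Reach M O v (vert c)
    to-corner (base (k , e , l)) = subst (Reach M O v) e (to-outer k l)
    to-corner (rotate {c} a _) = subst (Reach M O v) (sym (vert-σ⁻ c)) (to-corner a)
    to-corner (along {c} a y _) = subst (Reach M O v) (sym (vert-φ c)) (Reach.step (to-corner a) y)

-- Uniqueness

module Clockwise (M : AnnularMap) (O : ZBiorientation M) (suitable : Suitable M O) where
  open Map M
  open ZBiorientation O

  private
    admissible : Admissible M O
    admissible = proj₁ (proj₂ suitable)
    simple : OuterContourSimple M
    simple = proj₁ admissible
    one-way : ∀ h → OuterHE M h → ingoing h ≢ ingoing (α h)
    one-way = proj₁ (proj₂ admissible)

    last-step : ∀ {u v} → Reach M O u v → u ≢ v → ∃[ h ] (vert (α h) ≡ v × ingoing (α h) ≡ true)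
    last-step Reach.here ne = ⊥-elim (ne refl)
    last-step (Reach.step {h} _ t) _ = h , refl , t

    -- By accessibility some half-edge at `vert (φ k)` is ingoing. Inner half-edges at an outer
    -- vertex are outgoing, and so is `α k` because `k` is ingoing; only `φ k` remains.
    backward-φ : ∀ k → face k ≡ outer → ingoing k ≡ true → ingoing (φ k) ≡ true
    backward-φ k l y with vert k ≟ vert (φ k)
    -- Here the contour is a single loop, and `φ k` is `k`.
    ... | yes e = subst (λ z → ingoing z ≡ true) (proj₁ simple k (φ k) l (trans (face-φ k) l) e) y
    ... | no ne with last-step (proj₂ (proj₂ suitable) (vert k) (k , refl , l) (vert (φ k))) ne
    ...   | h , vh , yh with face (α h) ≟ outer | face (α (α h)) ≟ outer
    ...     | yes l' | _ = trans (cong ingoing (sym (proj₁ simple (α h) (φ k) l' (trans (face-φ k) l) vh))) yh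
    ...     | no nl | no nr = ⊥-elim (true≢false yh (proj₂ (proj₂ (proj₂ (proj₂ admissible))) (α h)
              (λ { (inj₁ e) → nl e ; (inj₂ e) → nr e }) (φ k , sym vh , trans (face-φ k) l)))
    ...     | no _ | yes r = ⊥-elim (one-way k (inj₁ l) (trans y (sym (trans (cong ingoing same) yh))))
      where
      same : α k ≡ α h
      same = trans (sym (σσ⁻ (α k))) (trans (cong σ (sym (proj₁ simple (σ⁻ (α h)) (φ k) (trans (face-σ⁻ (α h)) r) (trans (face-φ k) l) (trans (vert-σ⁻ (α h)) vh)))) (σσ⁻ (α h)))

  -- One backward edge would make the whole contour backward. The reversed contour would then be
  -- traversable with the outer face on its right, against minimality.
  clockwise : ∀ k → face k ≡ outer → ingoing (α k) ≡ true
  clockwise k l with bool-cases (ingoing (α k)) | bool-cases (ingoing k)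
  ... | inj₁ y | _ = y
  ... | inj₂ z | inj₂ z' = ⊥-elim (one-way k (inj₁ l) (trans z' (sym z)))
  ... | inj₂ z | inj₁ y = ⊥-elim (proj₁ suitable rev (traversable , ccw))
    where
    open OuterContour M simple
    open Reverse M contour
    all-backward : ∀ k' → face k' ≡ outer → ingoing k' ≡ true
    all-backward k' l' = proj₂ (around-face (λ y → face y ≡ outer × ingoing y ≡ true)
      (λ { y (l , b) → trans (face-φ y) l , backward-φ y l b }) (trans l (sym l')) (l , y))
    traversable : ∀ i → ingoing (α (SimpleCycle.he rev i)) ≡ true
    traversable i = all-backward _ (trans (cong face (αα _)) (contour-outer (Fin.opposite i)))
    ccw : ¬ DualReach M rev (face (SimpleCycle.he rev zero)) outer
    ccw r = true≢false (Cycle.left⇒inside M rev r)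
      (inside⇒outside-rev (trans (cong (Cycle.inside M contour) (sym (contour-outer zero))) (Cycle.inside-left M contour zero)))

module Uniqueness (M : AnnularMap) (d p q : ℕ) (0<d : 0 ℕ.< d) (d≤p : d ℕ.≤ p) (type : HasType M p q)
  (O₁ : ZBiorientation M) (DO₁ : DOrientation M d p q O₁) (suitable₁ : Suitable M O₁)
  (O₂ : ZBiorientation M) (DO₂ : DOrientation M d p q O₂) (suitable₂ : Suitable M O₂) where
  open Map M

  private
    module F₁ = OrientationFlow M d p q type O₁ DO₁
    module F₂ = OrientationFlow M d p q type O₂ DO₂
    module A₁ = Anchoring M d p q 0<d d≤p type O₁ DO₁ (proj₁ suitable₁)
    module A₂ = Anchoring M d p q 0<d d≤p type O₂ DO₂ (proj₁ suitable₂)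
    open ZBiorientation
    open Difference M d p using (gap; gap-pos; gap-x)

    g : Fin n → ℤ
    g = gap F₁.flow F₂.flow

    g-pos : ∀ h → F₂.pos h - F₁.pos h ≡ g h - g (σ⁻ h)
    g-pos = gap-pos F₁.flow F₂.flow

    g-x : ∀ c → F₂.x (α c) - F₁.x (α c) ≡ g c - g (φ c)
    g-x c = trans (gap-x F₁.flow F₂.flow (α c)) (cong (λ k → g k - g (φ c)) (αα c))

    equal : ∀ {a b u v : ℤ} → b - a ≡ u - v → b ≡ a → u ≡ v
    equal {a} {b} {u} {v} e b≡a = eq₂ (sym e) b≡a (lem a b u v)
      where
      lem : ∀ a b u v → u - v ≡ ((u - v) - (b - a)) + (b - a)
      lem = solve-∀

    c₀ : Fin n
    c₀ = proj₁ (face-surj outer)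

    g-contour : ∀ k → face k ≡ outer → g k ≡ g c₀
    g-contour k l = proj₂ (around-face (λ y → face y ≡ outer × g y ≡ g c₀) advance (trans (proj₂ (face-surj outer)) (sym l)) (proj₂ (face-surj outer) , refl))
      where
      advance : ∀ c → face c ≡ outer × g c ≡ g c₀ → face (φ c) ≡ outer × g (φ c) ≡ g c₀
      advance c (l , e) = trans (face-φ c) l , trans (sym (equal (g-x c) (trans (F₂.x-outerR nl r) (sym (F₁.x-outerR nl r))))) e
        where
        nl : face (α c) ≢ outer
        nl = proj₂ F₁.contour-simple c l
        r : face (α (α c)) ≡ outer
        r = trans (cong face (αα c)) l

    g-outer : ∀ c → OuterVertex M (vert c) → g c ≡ g c₀
    g-outer c (k , vk , l) = proj₂ (around-vertex (λ y → vert y ≡ vert k × g y ≡ g c₀) advance vk (refl , g-contour k l))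
      where
      pos-equal : ∀ h → vert h ≡ vert k → F₂.pos h ≡ F₁.pos h
      pos-equal h vh = by-cases (face h ≟ outer)
        where
        by-cases : Dec (face h ≡ outer) → F₂.pos h ≡ F₁.pos h
        by-cases (yes l') = trans (F₂.pos-outerL l') (sym (F₁.pos-outerL l'))
        by-cases (no nl) = trans (F₂.pos-outer-vertex nl (k , sym vh , l)) (sym (F₁.pos-outer-vertex nl (k , sym vh , l)))
      advance : ∀ y → vert y ≡ vert k × g y ≡ g c₀ → vert (σ y) ≡ vert k × g (σ y) ≡ g c₀
      advance y (vy , e) = trans (vert-σ y) vy , trans (equal (g-pos (σ y)) (pos-equal (σ y) (trans (vert-σ y) vy))) (trans (cong g (σ⁻σ y)) e)

    up : ∀ u v b a → (u - v) - b ≡ ((u - v) - (b - a)) + (0ℤ - a)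
    up = solve-∀

    down : ∀ u v b a → (v - u) - a ≡ ((b - a) - (u - v)) + (0ℤ - b)
    down = solve-∀

    -- Along an arc that is free for the first flow, `g` drops by the price in the second flow,
    -- which is non-negative; so `g` never exceeds its value on the contour. In `lower` the two
    -- flows exchange their parts.
    upper : ∀ {c} → A₁.Anchored c → g c ≤ g c₀
    upper (A₁.base o-v) = ℤ.≤-reflexive (g-outer _ o-v)
    upper (A₁.rotate {c} a z) = ℤ.≤-trans (≤-from (F₂.pos≥0 c) (eq₂ (sym (g-pos c)) (sym z) (up (g c) (g (σ⁻ c)) (F₂.pos c) (F₁.pos c)))) (upper a)
    upper (A₁.along {c} a _ z) = ℤ.≤-trans (≤-from (F₂.x≥0 (α c)) (eq₂ (sym (g-x c)) (sym z) (up (g c) (g (φ c)) (F₂.x (α c)) (F₁.x (α c))))) (upper a)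

    lower : ∀ {c} → A₂.Anchored c → g c₀ ≤ g c
    lower (A₂.base o-v) = ℤ.≤-reflexive (sym (g-outer _ o-v))
    lower (A₂.rotate {c} a z) = ℤ.≤-trans (lower a) (≤-from (F₁.pos≥0 c) (eq₂ (g-pos c) (sym z) (down (g c) (g (σ⁻ c)) (F₂.pos c) (F₁.pos c))))
    lower (A₂.along {c} a _ z) = ℤ.≤-trans (lower a) (≤-from (F₁.x≥0 (α c)) (eq₂ (g-x c) (sym z) (down (g c) (g (φ c)) (F₂.x (α c)) (F₁.x (α c)))))

    g-constant : ∀ c → g c ≡ g c₀
    g-constant c = ℤ.≤-antisym (upper (A₁.anchored c)) (lower (A₂.anchored c))

    equal-pos : ∀ h → F₂.pos h ≡ F₁.pos h
    equal-pos h = from-difference (trans (g-pos h) (trans (cong₂ _-_ (g-constant h) (g-constant (σ⁻ h))) (ℤ.+-inverseʳ (g c₀))))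

    equal-x : ∀ h → F₂.x h ≡ F₁.x h
    equal-x h = subst (λ k → F₂.x k ≡ F₁.x k) (αα h)
      (from-difference (trans (g-x (α h)) (trans (cong₂ _-_ (g-constant (α h)) (g-constant (φ (α h)))) (ℤ.+-inverseʳ (g c₀)))))

    -- Equality of the flows says nothing about the contour half-edges, so their directions and
    -- weights are taken from `Clockwise` and admissibility.
    out-L : ∀ O → Suitable M O → ∀ {h} → face h ≡ outer → ingoing O h ≡ false
    out-L O s {h} l = ≢true λ y → proj₁ (proj₂ (proj₁ (proj₂ s))) h (inj₁ l) (trans y (sym (Clockwise.clockwise M O s h l)))

    in-R : ∀ O → Suitable M O → ∀ {h} → face (α h) ≡ outer → ingoing O h ≡ true
    in-R O s {h} r = trans (cong (ingoing O) (sym (αα h))) (Clockwise.clockwise M O s (α h) r)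

    wt-L : ∀ O → Suitable M O → ∀ {h} → face h ≡ outer → wt O h ≡ + 0
    wt-L O s {h} l = proj₁ (proj₂ (proj₂ (proj₂ (proj₁ (proj₂ s))))) h (inj₁ l) (out-L O s l)

    wt-R : ∀ O → Suitable M O → ∀ {h} → face (α h) ≡ outer → wt O h ≡ + 1
    wt-R O s {h} r = proj₁ (proj₂ (proj₂ (proj₁ (proj₂ s)))) h (inj₂ r) (in-R O s r)

  unique : SameOrientation M O₂ O₁
  unique h with F₁.kind h
  ... | F₁.outerL l _ = trans (out-L O₂ suitable₂ l) (sym (out-L O₁ suitable₁ l)) , trans (wt-L O₂ suitable₂ l) (sym (wt-L O₁ suitable₁ l))
  ... | F₁.outerR _ r = trans (in-R O₂ suitable₂ {h} r) (sym (in-R O₁ suitable₁ {h} r)) , trans (wt-R O₂ suitable₂ {h} r) (sym (wt-R O₁ suitable₁ {h} r))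
  ... | F₁.innerE i = same-direction , trans (F₂.wt-split i) (trans (cong₂ _-_ (equal-pos h) (equal-x h)) (sym (F₁.wt-split i)))
    where
    same-direction : ingoing O₂ h ≡ ingoing O₁ h
    same-direction with bool-cases (ingoing O₂ h) | bool-cases (ingoing O₁ h)
    ... | inj₁ y₂ | inj₁ y₁ = trans y₂ (sym y₁)
    ... | inj₂ z₂ | inj₂ z₁ = trans z₂ (sym z₁)
    ... | inj₁ y₂ | inj₂ z₁ = ⊥-elim (ℤ.<-irrefl (sym (trans (sym (F₂.pos-in i y₂)) (trans (equal-pos h) (F₁.pos-out i z₁)))) (wt-in O₂ h y₂))
    ... | inj₂ z₂ | inj₁ y₁ = ⊥-elim (ℤ.<-irrefl (sym (trans (sym (F₁.pos-in i y₁)) (trans (sym (equal-pos h)) (F₂.pos-out i z₂)))) (wt-in O₁ h y₁))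

-- From the girth conditions to the suitable orientation

module Construction (M : AnnularMap) (d p q : ℕ) (0<d : 0 ℕ.< d) (d≤p : d ℕ.≤ p)
                    (type : HasType M p q) (inA : InA M d p) where
  open Map M
  open Maximal M d p

  private
    module E = Existence.FlowAbove (Existence.nonneg-flow M d p d≤p inA)

    maximal-flow : Σ NonnegFlow λ A → ∀ c → Tight (NonnegFlow.flow A) c
    maximal-flow = maximal (record { flow = E.flow ; pos≥0 = E.pos≥0 ; x≥0 = λ h → subst (λ k → 0ℤ ≤ E.x k) (αα h) (E.x≥lo (α h)) })

  open FlowOrientation M d p q 0<d type (proj₁ maximal-flow) (proj₂ maximal-flow)
    using (orientation; d-orientation; admissible; minimal; clockwise) public

  suitable : Suitable M orientation
  suitable = minimal , admissible , Anchoring.accessible M d p q 0<d d≤p type orientation d-orientation minimal clockwise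

theorem5p7 : (d p q : ℕ) → 0 ℕ.< d → 0 ℕ.< p → 0 ℕ.< q → p ℕ.≤ q →
    (M : AnnularMap) → HasType M p q →
    (∀ f → d ℕ.≤ faceDeg M f) →
    ((Σ (ZBiorientation M) (DOrientation M d p q)) ⇔ InA M d p) ×
    (InA M d p →
    Σ (ZBiorientation M) λ O → (DOrientation M d p q O × Suitable M O) ×
    (∀ O' → DOrientation M d p q O' → Suitable M O' → SameOrientation M O' O))
theorem5p7 d p q 0<d _ _ _ M type no-small-face =
  mk⇔ (orientation⇒girth M d p q type) (λ inA → orientation inA , d-orientation inA) ,
  λ inA → orientation inA , (d-orientation inA , suitable inA) ,
    λ O' DO' suitable' → Uniqueness.unique M d p q 0<d d≤p type
      (orientation inA) (d-orientation inA) (suitable inA) O' DO' suitable'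
  where
  d≤p : d ℕ.≤ p
  d≤p = ℕ.≤-trans (no-small-face (AnnularMap.outer M)) (ℕ.≤-reflexive (proj₁ type))
  open Construction M d p q 0<d d≤p type
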